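{- Let $G$ and $H$ be loop-free cactus graphs, let $\mathbb{k}$ be a field, and suppose that the Betti numbers of ungraded minimal free resolutions of the facet ideals $\mathcal{F}(M(G))$ and $\mathcal{F}(M(H))$ (over the polynomial rings over $\mathbb{k}$ with one variable per edge of $G$, resp. $H$) coincide, i.e. the resolutions have the same length and the same ranks $\beta_i$ in each homological degree. Then the higher weight hierarchies of $M(G)$ and $M(H)$ coincide: $d_i(M(G))=d_i(M(H))$ for all $i$.
   Context: A cactus graph is a finite connected graph each of whose blocks is either a cycle or a single edge. $M(G)$ is the cycle matroid of $G$ (ground set the edges, independent sets the forests). For a matroid $N$ with ground set $\{1,\dots,n\}$, its facet ideal $\mathcal{F}(N)\subset\mathbb{k}[x_1,\dots,x_n]$ is generated by the monomials $\prod_{j\in\sigma}x_j$ for $\sigma$ a basis of $N$. The higher weights are $d_i(N)=\min\{|\tau|:\tau\subset E(N),\ |\tau|-\operatorname{rk}(\tau)=i\}$. An ungraded minimal free resolution of a module over $S=\mathbb{k}[x_1,\dots,x_n]$ is an exact (except in degree $0$) complex $0\leftarrow S^{\beta_0}\leftarrow S^{\beta_1}\leftarrow\cdots$ resolving the module, with all maps having image in $\mathfrak{m}$ times the target, $\mathfrak{m}=\langle x_1,\dots,x_n\rangle$. -}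

module Defs where

open import Level using (Level; _⊔_) renaming (suc to lsuc)
open import Algebra.Bundles using (CommutativeRing)
open import Data.Bool using (Bool; true; false; if_then_else_; _∧_; _∨_)
open import Data.Nat as ℕ using (ℕ; zero; suc; _∸_; _≤_; _<_)
open import Data.Fin as Fin using (Fin)
open import Data.Fin.Subset using (Subset; _∈_; _∉_; _⊆_; ∣_∣; ⊤)
open import Data.Fin.Subset.Properties using (_∈?_)
open import Data.Vec as Vec using (Vec; []; _∷_)
open import Data.Vec.Properties using (≡-dec)
open import Data.List as List using (List; []; _∷_; _++_)
open import Data.List.Relation.Unary.All using (All)
open import Data.Sum using (_⊎_)
open import Data.Product using (Σ; ∃; _×_; _,_; proj₁; proj₂)
open import Relation.Nullary using (¬_; Dec; yes; no)
open import Relation.Nullary.Decidable using (⌊_⌋)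
open import Relation.Binary.PropositionalEquality using (_≡_; _≢_)

record Field (c ℓ : Level) : Set (lsuc (c ⊔ ℓ)) where
  field
    commutativeRing : CommutativeRing c ℓ
  open CommutativeRing commutativeRing public
  field
    0≉1     : ¬ (0# ≈ 1#)
    inverse : ∀ x → ¬ (x ≈ 0#) → Σ Carrier (λ y → (x * y) ≈ 1#)

record Graph : Set where
  field
    V    : ℕ
    E    : ℕ
    ends : Fin E → Fin V × Fin V

open Graph public

LoopFree : Graph → Set
LoopFree G = ∀ e → proj₁ (ends G e) ≢ proj₂ (ends G e)

EdgeSet : Graph → Set
EdgeSet G = Subset (E G)

incident : (G : Graph) → Fin (E G) → Fin (V G) → Bool
incident G e v = ⌊ proj₁ (ends G e) Fin.≟ v ⌋ ∨ ⌊ proj₂ (ends G e) Fin.≟ v ⌋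

sumFin : ∀ {n} → (Fin n → ℕ) → ℕ
sumFin {zero}  f = 0
sumFin {suc n} f = f Fin.zero ℕ.+ sumFin (λ i → f (Fin.suc i))

inB : ∀ {n} → Fin n → Subset n → Bool
inB e B = ⌊ e ∈? B ⌋

-- degree of v in the spanning subgraph with edge set B (graphs are
-- loop-free when this is used, so each incident edge counts once)
degree : (G : Graph) → EdgeSet G → Fin (V G) → ℕ
degree G B v = sumFin (λ e → if inB e B ∧ incident G e v then 1 else 0)

VertexOf : (G : Graph) → EdgeSet G → Fin (V G) → Set
VertexOf G B v = ∃ λ e → e ∈ B × incident G e v ≡ true

data Reach (G : Graph) (B : EdgeSet G) (ok : Fin (E G) → Set) :
           Fin (V G) → Fin (V G) → Set where
  here : ∀ {u} → Reach G B ok u u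
  step : ∀ {u w x} e → e ∈ B → ok e →
         ((proj₁ (ends G e) ≡ u × proj₂ (ends G e) ≡ w) ⊎
          (proj₂ (ends G e) ≡ u × proj₁ (ends G e) ≡ w)) →
         Reach G B ok w x → Reach G B ok u x

anyEdge : (G : Graph) → Fin (E G) → Set
anyEdge G e = ⊤′ where open import Data.Unit using () renaming (⊤ to ⊤′)

avoid : (G : Graph) → Fin (V G) → Fin (E G) → Set
avoid G x e = incident G e x ≡ false

Nonempty : (G : Graph) → EdgeSet G → Set
Nonempty G B = ∃ λ e → e ∈ B

ConnectedSub : (G : Graph) → EdgeSet G → Set
ConnectedSub G B = ∀ u v → VertexOf G B u → VertexOf G B v → Reach G B (anyEdge G) u v

NoCutVertex : (G : Graph) → EdgeSet G → Set
NoCutVertex G B = ∀ x → VertexOf G B x → ∀ u v → VertexOf G B u → VertexOf G B v →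
                  u ≢ x → v ≢ x → Reach G B (avoid G x) u v

NonSeparable : (G : Graph) → EdgeSet G → Set
NonSeparable G B = Nonempty G B × ConnectedSub G B × NoCutVertex G B

Block : (G : Graph) → EdgeSet G → Set
Block G B = NonSeparable G B × (∀ B′ → B ⊆ B′ → NonSeparable G B′ → B′ ⊆ B)

IsCycle : (G : Graph) → EdgeSet G → Set
IsCycle G B = Nonempty G B × ConnectedSub G B × (∀ v → VertexOf G B v → degree G B v ≡ 2)

Connected : Graph → Set
Connected G = ∀ u v → Reach G ⊤ (anyEdge G) u v

Cactus : Graph → Set
Cactus G = Connected G × (∀ B → Block G B → IsCycle G B ⊎ ∣ B ∣ ≡ 1)

Independent : (G : Graph) → EdgeSet G → Set
Independent G I = ∀ C → C ⊆ I → ¬ IsCycle G C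

Basis : (G : Graph) → EdgeSet G → Set
Basis G B = Independent G B × (∀ B′ → B ⊆ B′ → Independent G B′ → B′ ⊆ B)

IsRank : (G : Graph) → EdgeSet G → ℕ → Set
IsRank G τ r = (∃ λ I → I ⊆ τ × Independent G I × ∣ I ∣ ≡ r)
             × (∀ I → I ⊆ τ → Independent G I → ∣ I ∣ ≤ r)

HasNullity : (G : Graph) → EdgeSet G → ℕ → Set
HasNullity G τ i = ∃ λ r → IsRank G τ r × ∣ τ ∣ ∸ r ≡ i

IsHigherWeight : (G : Graph) → ℕ → ℕ → Set
IsHigherWeight G i d = (∃ λ τ → HasNullity G τ i × ∣ τ ∣ ≡ d)
                     × (∀ τ → HasNullity G τ i → d ≤ ∣ τ ∣)

-- Polynomial ring k[x_1..x_n]: finite formal sums of terms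
-- (coefficient, exponent vector), compared coefficientwise.

module _ {c ℓ} (k : Field c ℓ) (n : ℕ) where
  open Field k

  Poly : Set c
  Poly = List (Carrier × Vec ℕ n)

  coeff : Poly → Vec ℕ n → Carrier
  coeff []             m = 0#
  coeff ((a , e) ∷ p)  m with ≡-dec ℕ._≟_ e m
  ... | yes _ = a + coeff p m
  ... | no  _ = coeff p m

  _≈P_ : Poly → Poly → Set ℓ
  p ≈P q = ∀ m → coeff p m ≈ coeff q m

  0P : Poly
  0P = []

  _+P_ : Poly → Poly → Poly
  p +P q = p ++ q

  _*P_ : Poly → Poly → Poly
  p *P q = List.concatMap (λ t → List.map (λ u → (proj₁ t * proj₁ u , Vec.zipWith ℕ._+_ (proj₂ t) (proj₂ u))) q) p

  constTerm : Poly → Carrier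
  constTerm p = coeff p (Vec.replicate n 0)

  monomial : Subset n → Poly
  monomial σ = (1# , Vec.map (λ b → if b then 1 else 0) σ) ∷ []

  sumP : ∀ {b} → (Fin b → Poly) → Poly
  sumP {zero}  f = 0P
  sumP {suc b} f = f Fin.zero +P sumP (λ i → f (Fin.suc i))

  FreeVec : ℕ → Set c
  FreeVec b = Fin b → Poly

  _≈V_ : ∀ {b} → FreeVec b → FreeVec b → Set ℓ
  v ≈V w = ∀ i → v i ≈P w i

  0V : ∀ {b} → FreeVec b
  0V i = 0P

  Matrix : ℕ → ℕ → Set c
  Matrix a b = Fin a → Fin b → Poly

  apply : ∀ {a b} → Matrix a b → FreeVec b → FreeVec a
  apply A v i = sumP (λ j → A i j *P v j)

  -- Ungraded minimal free resolution of an ideal I ⊆ S (given by its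
  -- membership predicate):
  --   0 ← I ←ε− S^{β 0} ←d 0− S^{β 1} ←d 1− S^{β 2} ← ⋯
  -- with β i = 0 for i > len, exact everywhere, and all d i having
  -- entries in 𝔪 = ⟨x_1,…,x_n⟩ (constant term zero).
  record MinimalFreeResolution (I : Poly → Set (c ⊔ ℓ)) : Set (c ⊔ lsuc ℓ) where
    field
      β       : ℕ → ℕ
      len     : ℕ
      bounded : ∀ i → len < i → β i ≡ 0
      ε       : FreeVec (β 0)
      ε∈I     : ∀ j → I (ε j)
      ε-onto  : ∀ g → I g → ∃ λ (v : FreeVec (β 0)) → g ≈P sumP (λ j → v j *P ε j)
      d       : ∀ i → Matrix (β i) (β (suc i))
      exact₀  : ∀ (v : FreeVec (β 0)) →
                  (sumP (λ j → v j *P ε j) ≈P 0P → ∃ λ w → apply (d 0) w ≈V v)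
                × ((∃ λ w → apply (d 0) w ≈V v) → sumP (λ j → v j *P ε j) ≈P 0P)
      exact   : ∀ i (v : FreeVec (β (suc i))) →
                  (apply (d i) v ≈V 0V → ∃ λ w → apply (d (suc i)) w ≈V v)
                × ((∃ λ w → apply (d (suc i)) w ≈V v) → apply (d i) v ≈V 0V)
      minimal : ∀ i r s → constTerm (d i r s) ≈ 0#

FacetIdeal : ∀ {c ℓ} (k : Field c ℓ) (G : Graph) → Poly k (E G) → Set (c ⊔ ℓ)
FacetIdeal k G g =
  ∃ λ (L : List (Poly k (E G) × EdgeSet G)) →
      All (λ t → Basis G (proj₂ t)) L
    × _≈P_ k (E G) g
        (List.foldr (_+P_ k (E G)) (0P k (E G))
          (List.map (λ t → _*P_ k (E G) (proj₁ t) (monomial k (E G) (proj₂ t))) L))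

{-# OPTIONS --safe #-}

-- In a cactus two cycles sharing an edge lie in a common block, hence coincide. So the bases of M(G)
-- are the complements of the transversals of pairwise disjoint cycles C₁, …, C_r, and the nullity of an
-- edge set is the number of cycles it contains: d_i is the least total size of i cycles. The facet
-- ideal is a monomial times the product of the ideals (∏_{C_j ∖ c} x : c ∈ C_j) in disjoint variables,
-- and iterated mapping cones give a minimal resolution with ∑ β_i tⁱ = ∏ (n_j + (n_j - 1) t), where
-- n_j = |C_j|. Minimal resolutions of the same ideal have the same Betti numbers, and since
-- the roots -n/(n-1) are distinct this polynomial determines the multiset of the n_j.
module Submission where

open import Defs
open import Level using (Level)
open import Data.Nat using (ℕ)
open import Data.Product using (Σ; _×_)
open import Relation.Binary.PropositionalEquality using (_≡_)

-- For a cycle `y ∷ x ∷ xs` the ideal is `y I + x w J`, where `J` belongs to the remaining cycles,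
-- `I` to the list `x ∷ xs` over the same `J`, and `w = prod xs`. Multiplication by `w` maps `J`
-- into `I`, and its lift to resolutions may contain units. The cone is minimal nevertheless,
-- because the lift occurs only multiplied by `x`, next to multiplication by `y`; hence one variable
-- is split off at a time. Equality in the field is not assumed decidable, and non-separability of
-- edge sets is not decided. A pivot in Gaussian elimination and a block around a given edge set
-- therefore exist only up to double negation. Both serve conclusions that are stable: an inequality
-- between natural numbers and an equality of subsets. The roots are rational, so the polynomials
-- are homogenised and evaluated at integer points.

module FreeResolutions where

  open import Level using (_⊔_)
  open import Algebra.Bundles using (CommutativeRing)
  open import Data.Nat as ℕ using (ℕ; zero; suc)
  open import Data.Fin as Fin using (Fin)
  open import Data.Sum using (_⊎_; inj₁; inj₂)
  open import Data.Product using (Σ; ∃; _,_; proj₁; proj₂)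
  import Algebra.Properties.Ring
  import Relation.Binary.Reasoning.Setoid as SetoidReasoning
  import Algebra.Properties.CommutativeSemigroup

  infixr 6 _⊕_

  -- Index sets are formal sums of finite sets, so that a mapping cone splits into its summands
  -- definitionally. A numbering by a single `Fin` is chosen only when ranks are compared.
  data Shape : Set where
    fin : ℕ → Shape
    _⊕_ : Shape → Shape → Shape

  El : Shape → Set
  El (fin n) = Fin n
  El (X ⊕ Y) = El X ⊎ El Y

  size : Shape → ℕ
  size (fin n) = n
  size (X ⊕ Y) = size X ℕ.+ size Y

  -- Free modules of finite rank and linear maps

  module FreeModules {c ℓ} (R : CommutativeRing c ℓ) where

    open CommutativeRing R
    open Algebra.Properties.Ring ring using (-1*x≈-x; -0#≈0#; -‿+-comm; -‿involutive)
    open Algebra.Properties.CommutativeSemigroup +-commutativeSemigroup using (interchange)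
    open Algebra.Properties.CommutativeSemigroup *-commutativeSemigroup using (x∙yz≈y∙xz)
    open SetoidReasoning setoid

    Free : Shape → Set c
    Free X = El X → Carrier

    infix 4 _≋_
    _≋_ : ∀ {X} → Free X → Free X → Set ℓ
    _≋_ {X} v w = (x : El X) → v x ≈ w x

    infixl 6 _⊞_
    infixl 7 _⊡_

    _⊞_ : ∀ {X} → Free X → Free X → Free X
    (v ⊞ w) x = v x + w x

    _⊡_ : ∀ {X} → Carrier → Free X → Free X
    (r ⊡ v) x = r * v x

    𝟎 : ∀ {X} → Free X
    𝟎 x = 0#

    infixr 5 _∥_
    _∥_ : ∀ {X Y} → Free X → Free Y → Free (X ⊕ Y)
    (v ∥ w) (inj₁ x) = v x
    (v ∥ w) (inj₂ y) = w y

    fst : ∀ {X Y} → Free (X ⊕ Y) → Free X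
    fst v x = v (inj₁ x)

    snd : ∀ {X Y} → Free (X ⊕ Y) → Free Y
    snd v y = v (inj₂ y)

    ∑ : ∀ X → Free X → Carrier
    ∑ (fin zero)    f = 0#
    ∑ (fin (suc n)) f = f Fin.zero + ∑ (fin n) (λ i → f (Fin.suc i))
    ∑ (X ⊕ Y)       f = ∑ X (fst f) + ∑ Y (snd f)

    ∑-cong : ∀ X {f g : Free X} → f ≋ g → ∑ X f ≈ ∑ X g
    ∑-cong (fin zero)    h = refl
    ∑-cong (fin (suc n)) h = +-cong (h Fin.zero) (∑-cong (fin n) (λ i → h (Fin.suc i)))
    ∑-cong (X ⊕ Y)       h = +-cong (∑-cong X (λ x → h (inj₁ x))) (∑-cong Y (λ y → h (inj₂ y)))

    ∑-+ : ∀ X (f g : Free X) → ∑ X (f ⊞ g) ≈ ∑ X f + ∑ X g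
    ∑-+ (fin zero)    f g = sym (+-identityˡ 0#)
    ∑-+ (fin (suc n)) f g = trans (+-congˡ (∑-+ (fin n) _ _)) (interchange _ _ _ _)
    ∑-+ (X ⊕ Y)       f g = trans (+-cong (∑-+ X _ _) (∑-+ Y _ _)) (interchange _ _ _ _)

    ∑-* : ∀ X r (f : Free X) → ∑ X (r ⊡ f) ≈ r * ∑ X f
    ∑-* (fin zero)    r f = sym (zeroʳ r)
    ∑-* (fin (suc n)) r f = trans (+-congˡ (∑-* (fin n) r _)) (sym (distribˡ r _ _))
    ∑-* (X ⊕ Y)       r f = trans (+-cong (∑-* X r _) (∑-* Y r _)) (sym (distribˡ r _ _))

    -- Functions with laws instead of matrices: composition needs no sums, and `extend` recovers the
    -- description by a matrix where one is given.
    record Linear (X Y : Shape) : Set (c ⊔ ℓ) where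
      no-eta-equality
      infixr 8 _·_
      field
        _·_   : Free X → Free Y
        ·-cong : ∀ {v w} → v ≋ w → _·_ v ≋ _·_ w
        ·-⊞   : ∀ v w → _·_ (v ⊞ w) ≋ _·_ v ⊞ _·_ w
        ·-⊡   : ∀ r v → _·_ (r ⊡ v) ≋ r ⊡ _·_ v

    open Linear public

    module _ {X Y : Shape} (f : Linear X Y) where

      ·-𝟎 : f · 𝟎 ≋ 𝟎
      ·-𝟎 y = begin
        (f · 𝟎) y          ≈⟨ ·-cong f (λ x → sym (zeroˡ 0#)) y ⟩
        (f · (0# ⊡ 𝟎)) y   ≈⟨ ·-⊡ f 0# 𝟎 y ⟩
        0# * (f · 𝟎) y     ≈⟨ zeroˡ _ ⟩
        0#                 ∎

      ·-≋𝟎 : ∀ {v} → v ≋ 𝟎 → f · v ≋ 𝟎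
      ·-≋𝟎 h y = trans (·-cong f h y) (·-𝟎 y)

      ·-∑ : ∀ Z (u : Free Z) (g : El Z → Free X) →
            f · (λ x → ∑ Z (λ z → u z * g z x)) ≋ λ y → ∑ Z (λ z → u z * (f · g z) y)
      ·-∑ (fin zero)    u g y = ·-𝟎 y
      ·-∑ (fin (suc n)) u g y =
        trans (·-⊞ f (u Fin.zero ⊡ g Fin.zero) _ y)
              (+-cong (·-⊡ f _ _ y) (·-∑ (fin n) (λ i → u (Fin.suc i)) (λ i → g (Fin.suc i)) y))
      ·-∑ (Z ⊕ W) u g y =
        trans (·-⊞ f _ _ y)
              (+-cong (·-∑ Z (fst u) (λ z → g (inj₁ z)) y) (·-∑ W (snd u) (λ w → g (inj₂ w)) y))

    δ : ∀ X → El X → Free X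
    δ (fin (suc n)) Fin.zero    Fin.zero    = 1#
    δ (fin (suc n)) Fin.zero    (Fin.suc j) = 0#
    δ (fin (suc n)) (Fin.suc i) Fin.zero    = 0#
    δ (fin (suc n)) (Fin.suc i) (Fin.suc j) = δ (fin n) i j
    δ (X ⊕ Y) (inj₁ x) = δ X x ∥ 𝟎
    δ (X ⊕ Y) (inj₂ y) = 𝟎 ∥ δ Y y

    ∑-𝟎 : ∀ X (v : Free X) → ∑ X (λ x → v x * 0#) ≈ 0#
    ∑-𝟎 (fin zero)    v = refl
    ∑-𝟎 (fin (suc n)) v = trans (+-cong (zeroʳ _) (∑-𝟎 (fin n) (λ i → v (Fin.suc i)))) (+-identityˡ _)
    ∑-𝟎 (X ⊕ Y)       v = trans (+-cong (∑-𝟎 X (fst v)) (∑-𝟎 Y (snd v))) (+-identityˡ _)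

    ∑-δ : ∀ X (v : Free X) → v ≋ λ y → ∑ X (λ x → v x * δ X x y)
    ∑-δ (fin (suc n)) v Fin.zero =
      sym (trans (+-cong (*-identityʳ _) (∑-𝟎 (fin n) (λ i → v (Fin.suc i)))) (+-identityʳ _))
    ∑-δ (fin (suc n)) v (Fin.suc j) =
      sym (trans (+-cong (zeroʳ _) (sym (∑-δ (fin n) (λ i → v (Fin.suc i)) j))) (+-identityˡ _))
    ∑-δ (X ⊕ Y) v (inj₁ x) = sym (trans (+-cong (sym (∑-δ X (fst v) x)) (∑-𝟎 Y (snd v))) (+-identityʳ _))
    ∑-δ (X ⊕ Y) v (inj₂ y) = sym (trans (+-cong (∑-𝟎 X (fst v)) (sym (∑-δ Y (snd v) y))) (+-identityˡ _))

    extend : ∀ {X Y} → (El X → Free Y) → Linear X Y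
    extend {X} g ._·_ v y = ∑ X (λ x → v x * g x y)
    extend {X} g .·-cong h y = ∑-cong X (λ x → *-congʳ (h x))
    extend {X} g .·-⊞ v w y = trans (∑-cong X (λ x → distribʳ _ _ _)) (∑-+ X _ _)
    extend {X} g .·-⊡ r v y = trans (∑-cong X (λ x → *-assoc _ _ _)) (∑-* X r _)

    -- Free modules are projective. Preimages are chosen for the basis vectors alone and extended
    -- linearly, since a choice made vector by vector need not be linear.
    lift : ∀ {X Y Z} (φ : Linear X Z) (d : Linear Y Z) →
           (∀ x → ∃ λ u → d · u ≋ φ · δ X x) →
           Σ (Linear X Y) λ ψ → ∀ v → d · (ψ · v) ≋ φ · v
    lift {X} φ d h = extend (λ x → proj₁ (h x)) , λ v z → begin
      (d · (extend (λ x → proj₁ (h x)) · v)) z          ≈⟨ ·-∑ d X v (λ x → proj₁ (h x)) z ⟩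
      ∑ X (λ x → v x * (d · proj₁ (h x)) z)             ≈⟨ ∑-cong X (λ x → *-congˡ (proj₂ (h x) z)) ⟩
      ∑ X (λ x → v x * (φ · δ X x) z)                   ≈⟨ sym (·-∑ φ X v (δ X) z) ⟩
      (φ · (λ y → ∑ X (λ x → v x * δ X x y))) z         ≈⟨ sym (·-cong φ (∑-δ X v) z) ⟩
      (φ · v) z                                         ∎

    scale : ∀ {X} → Carrier → Linear X X
    scale r ._·_ v = r ⊡ v
    scale r .·-cong h x = *-congˡ (h x)
    scale r .·-⊞ v w x = distribˡ _ _ _
    scale r .·-⊡ s v x = x∙yz≈y∙xz r s (v x)

    infixr 9 _⊚_
    _⊚_ : ∀ {X Y Z} → Linear Y Z → Linear X Y → Linear X Z
    (f ⊚ g) ._·_ v = f · (g · v)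
    (f ⊚ g) .·-cong h = ·-cong f (·-cong g h)
    (f ⊚ g) .·-⊞ v w z = trans (·-cong f (·-⊞ g v w) z) (·-⊞ f _ _ z)
    (f ⊚ g) .·-⊡ r v z = trans (·-cong f (·-⊡ g r v) z) (·-⊡ f _ _ z)

    infixl 6 _⊞ₗ_
    _⊞ₗ_ : ∀ {X Y} → Linear X Y → Linear X Y → Linear X Y
    (f ⊞ₗ g) ._·_ v = f · v ⊞ g · v
    (f ⊞ₗ g) .·-cong h y = +-cong (·-cong f h y) (·-cong g h y)
    (f ⊞ₗ g) .·-⊞ v w y = trans (+-cong (·-⊞ f v w y) (·-⊞ g v w y)) (interchange _ _ _ _)
    (f ⊞ₗ g) .·-⊡ r v y = trans (+-cong (·-⊡ f r v y) (·-⊡ g r v y)) (sym (distribˡ _ _ _))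

    zeroₗ : ∀ {X Y} → Linear X Y
    zeroₗ ._·_ v = 𝟎
    zeroₗ .·-cong h y = refl
    zeroₗ .·-⊞ v w y = sym (+-identityˡ 0#)
    zeroₗ .·-⊡ r v y = sym (zeroʳ r)

    [_,_]ₗ : ∀ {X Y Z} → Linear X Z → Linear Y Z → Linear (X ⊕ Y) Z
    [ f , g ]ₗ ._·_ v = f · fst v ⊞ g · snd v
    [ f , g ]ₗ .·-cong h y = +-cong (·-cong f (λ x → h (inj₁ x)) y) (·-cong g (λ x → h (inj₂ x)) y)
    [ f , g ]ₗ .·-⊞ v w y = trans (+-cong (·-⊞ f _ _ y) (·-⊞ g _ _ y)) (interchange _ _ _ _)
    [ f , g ]ₗ .·-⊡ r v y = trans (+-cong (·-⊡ f r _ y) (·-⊡ g r _ y)) (sym (distribˡ _ _ _))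

    ⟨_,_⟩ₗ : ∀ {X Y Z} → Linear X Y → Linear X Z → Linear X (Y ⊕ Z)
    ⟨ f , g ⟩ₗ ._·_ v = f · v ∥ g · v
    ⟨ f , g ⟩ₗ .·-cong h (inj₁ y) = ·-cong f h y
    ⟨ f , g ⟩ₗ .·-cong h (inj₂ z) = ·-cong g h z
    ⟨ f , g ⟩ₗ .·-⊞ v w (inj₁ y) = ·-⊞ f v w y
    ⟨ f , g ⟩ₗ .·-⊞ v w (inj₂ z) = ·-⊞ g v w z
    ⟨ f , g ⟩ₗ .·-⊡ r v (inj₁ y) = ·-⊡ f r v y
    ⟨ f , g ⟩ₗ .·-⊡ r v (inj₂ z) = ·-⊡ g r v z

    π₂ : ∀ {X Y} → Linear (X ⊕ Y) Y
    π₂ ._·_ = snd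
    π₂ .·-cong h x = h (inj₂ x)
    π₂ .·-⊞ v w x = refl
    π₂ .·-⊡ r v x = refl

    infixl 6 _⊟ₗ_
    _⊟ₗ_ : ∀ {X Y} → Linear X Y → Linear X Y → Linear X Y
    f ⊟ₗ g = f ⊞ₗ scale (- 1#) ⊚ g

    ⊟ₗ-≈0 : ∀ {X Y} (f g : Linear X Y) {v y} → (f · v) y ≈ (g · v) y → ((f ⊟ₗ g) · v) y ≈ 0#
    ⊟ₗ-≈0 f g h = trans (+-cong h (-1*x≈-x _)) (-‿inverseʳ _)

    -- Resolutions of ideals, chain maps and homotopies

    module _ {i} (I : Carrier → Set i) where

      Augmented : (ℕ → Shape) → ℕ → Shape
      Augmented β zero    = fin 1
      Augmented β (suc i) = β i

      -- The ring itself sits in degree 0, so that ∂ 0 is the augmentation onto the ideal I.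
      record Resolution : Set (c ⊔ ℓ ⊔ i) where
        no-eta-equality
        field
          β : ℕ → Shape
        P : ℕ → Shape
        P = Augmented β
        field
          ∂     : ∀ i → Linear (P (suc i)) (P i)
          ∂∂    : ∀ i v → ∂ i · (∂ (suc i) · v) ≋ 𝟎
          exact : ∀ i v → ∂ i · v ≋ 𝟎 → ∃ λ w → ∂ (suc i) · w ≋ v
          ∂₀∈   : ∀ v → I ((∂ 0 · v) Fin.zero)
          onto  : ∀ g → I g → ∃ λ v → (∂ 0 · v) Fin.zero ≈ g

    -- The comparison theorem for multiplication by `r`. The case `r = 1` compares two resolutions
    -- of one ideal, and the case `r = w` supplies the map whose cone is formed.
    module ChainMap {i j} {I : Carrier → Set i} {J : Carrier → Set j}
                    (F : Resolution I) (G : Resolution J)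
                    (r : Carrier) (rI⊆J : ∀ g → I g → J (r * g)) where
      private
        module F = Resolution F
        module G = Resolution G

      Liftable : ∀ i → Linear (F.P i) (G.P i) → Set (c ⊔ ℓ)
      Liftable i φ = ∀ v → ∃ λ u → G.∂ i · u ≋ φ · (F.∂ i · v)

      extendChain : ∀ i φ → Liftable i φ →
                    Σ (Linear (F.P (suc i)) (G.P (suc i))) λ ψ → ∀ v → G.∂ i · (ψ · v) ≋ φ · (F.∂ i · v)
      extendChain i φ h = lift (φ ⊚ F.∂ i) (G.∂ i) (λ x → h (δ (F.P (suc i)) x))

      -- The recursion carries `Liftable`, which is what constructing the next map requires. In
      -- degree 0 it comes from surjectivity onto `J`, later from exactness of `G`.
      chain : ∀ i → Σ (Linear (F.P i) (G.P i)) (Liftable i)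
      chain zero = scale r , liftable
        where
        liftable : Liftable 0 (scale r)
        liftable v with G.onto _ (rI⊆J _ (F.∂₀∈ v))
        ... | u , h = u , λ { Fin.zero → h }
      chain (suc i) = proj₁ next , λ v → G.exact i _ (λ x → trans (proj₂ next _ x) (·-≋𝟎 φ (F.∂∂ i v) x))
        where
        φ : Linear (F.P i) (G.P i)
        φ = proj₁ (chain i)
        next : Σ (Linear (F.P (suc i)) (G.P (suc i))) λ ψ → ∀ v → G.∂ i · (ψ · v) ≋ φ · (F.∂ i · v)
        next = extendChain i φ (proj₂ (chain i))

      map : ∀ i → Linear (F.P i) (G.P i)
      map i = proj₁ (chain i)

      commutes : ∀ i v → G.∂ i · (map (suc i) · v) ≋ map i · (F.∂ i · v)
      commutes i = proj₂ (extendChain i (map i) (proj₂ (chain i)))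

    module Homotopy {i} {I : Carrier → Set i} (F : Resolution I) where
      open Resolution F

      module _ (φ : ∀ i → Linear (P i) (P i))
               (φ-commutes : ∀ i v → ∂ i · (φ (suc i) · v) ≋ φ i · (∂ i · v))
               (φ₀≋𝟎 : ∀ v → φ 0 · v ≋ 𝟎) where

        -- A condition on the image of `∂ i` only: just enough for `φ (suc i) ⊟ₗ h ⊚ ∂ i` to take
        -- values in the cycles, which exactness then lifts to the next homotopy.
        Contracts : ∀ i → Linear (P i) (P (suc i)) → Set (c ⊔ ℓ)
        Contracts i h = ∀ v → ∂ i · (h · (∂ i · v)) ≋ φ i · (∂ i · v)

        extendHomotopy : ∀ i h → Contracts i h →
          Σ (Linear (P (suc i)) (P (suc (suc i)))) λ h′ →
            ∀ v → ∂ (suc i) · (h′ · v) ≋ (φ (suc i) ⊟ₗ h ⊚ ∂ i) · v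
        extendHomotopy i h contracts = lift ψ (∂ (suc i)) (λ x → exact i _ (cycle _))
          where
          ψ : Linear (P (suc i)) (P (suc i))
          ψ = φ (suc i) ⊟ₗ h ⊚ ∂ i
          cycle : ∀ v → ∂ i · (ψ · v) ≋ 𝟎
          cycle v x = begin
            (∂ i · (ψ · v)) x
              ≈⟨ ·-⊞ (∂ i) _ _ x ⟩
            (∂ i · (φ (suc i) · v)) x + (∂ i · ((- 1#) ⊡ h · (∂ i · v))) x
              ≈⟨ +-cong (φ-commutes i v x) (trans (·-⊡ (∂ i) _ _ x) (trans (-1*x≈-x _) (-‿cong (contracts v x)))) ⟩
            (φ i · (∂ i · v)) x + - (φ i · (∂ i · v)) x
              ≈⟨ -‿inverseʳ _ ⟩
            0# ∎

        homotopy : ∀ i → Σ (Linear (P i) (P (suc i))) (Contracts i)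
        homotopy zero = zeroₗ , λ v x → trans (·-𝟎 (∂ 0) x) (sym (φ₀≋𝟎 _ x))
        homotopy (suc i) = proj₁ next , λ v x →
            trans (proj₂ next _ x) (trans (+-congˡ (trans (-1*x≈-x _) (trans (-‿cong (vanish v x)) -0#≈0#))) (+-identityʳ _))
          where
          h : Linear (P i) (P (suc i))
          h = proj₁ (homotopy i)
          next : Σ (Linear (P (suc i)) (P (suc (suc i)))) λ h′ →
                   ∀ v → ∂ (suc i) · (h′ · v) ≋ (φ (suc i) ⊟ₗ h ⊚ ∂ i) · v
          next = extendHomotopy i h (proj₂ (homotopy i))
          vanish : ∀ v → h · (∂ i · (∂ (suc i) · v)) ≋ 𝟎
          vanish v = ·-≋𝟎 h (∂∂ i v)

        s : ∀ i → Linear (P i) (P (suc i))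
        s i = proj₁ (homotopy i)

        φ≋∂s+s∂ : ∀ i v → φ (suc i) · v ≋ ∂ (suc i) · (s (suc i) · v) ⊞ s i · (∂ i · v)
        φ≋∂s+s∂ i v x = sym (trans (+-congʳ (proj₂ (extendHomotopy i (s i) (proj₂ (homotopy i))) v x))
          (trans (+-assoc _ _ _) (trans (+-congˡ (trans (+-congʳ (-1*x≈-x _)) (-‿inverseˡ _))) (+-identityʳ _))))

    -- For polynomials, `ε` is the constant term and `ι` embeds the constants. The section `ι` lets
    -- a linear map over the ring be read over the residue ring without forming quotient modules.
    record Augmentation {k ℓ′} (K : CommutativeRing k ℓ′) : Set (c ⊔ ℓ ⊔ k ⊔ ℓ′) where
      private module K = CommutativeRing K
      field
        ε      : Carrier → K.Carrier
        ε-cong : ∀ {x y} → x ≈ y → ε x K.≈ ε y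
        ε-+    : ∀ x y → ε (x + y) K.≈ ε x K.+ ε y
        ε-*    : ∀ x y → ε (x * y) K.≈ ε x K.* ε y
        ε-0    : ε 0# K.≈ K.0#
        ι      : K.Carrier → Carrier
        ι-cong : ∀ {x y} → x K.≈ y → ι x ≈ ι y
        ι-+    : ∀ x y → ι (x K.+ y) ≈ ι x + ι y
        ι-*    : ∀ x y → ι (x K.* y) ≈ ι x * ι y
        ε∘ι    : ∀ x → ε (ι x) K.≈ x

    module Residue {k ℓ′} {K : CommutativeRing k ℓ′} (A : Augmentation K) where
      open Augmentation A
      private module K = CommutativeRing K

      𝔪 : ∀ {X} → Free X → Set ℓ′
      𝔪 v = ∀ x → ε (v x) K.≈ K.0#

      𝔪-⊞ : ∀ {X} {v w : Free X} → 𝔪 v → 𝔪 w → 𝔪 (v ⊞ w)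
      𝔪-⊞ hv hw x = K.trans (ε-+ _ _) (K.trans (K.+-cong (hv x) (hw x)) (K.+-identityˡ _))

      𝔪-⊡ : ∀ {X} r {v : Free X} → 𝔪 v → 𝔪 (r ⊡ v)
      𝔪-⊡ r h x = K.trans (ε-* _ _) (K.trans (K.*-congˡ (h x)) (K.zeroʳ _))

      𝔪-≋ : ∀ {X} {v w : Free X} → v ≋ w → 𝔪 w → 𝔪 v
      𝔪-≋ v≋w h x = K.trans (ε-cong (v≋w x)) (h x)

      ε-∑ : ∀ X {f : Free X} → 𝔪 f → ε (∑ X f) K.≈ K.0#
      ε-∑ (fin zero)    h = ε-0
      ε-∑ (fin (suc n)) h =
        K.trans (ε-+ _ _) (K.trans (K.+-cong (h Fin.zero) (ε-∑ (fin n) (λ i → h (Fin.suc i)))) (K.+-identityˡ _))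
      ε-∑ (X ⊕ Y) h =
        K.trans (ε-+ _ _) (K.trans (K.+-cong (ε-∑ X (λ x → h (inj₁ x))) (ε-∑ Y (λ y → h (inj₂ y)))) (K.+-identityˡ _))

      𝔪-· : ∀ {X Y} (f : Linear X Y) {v} → 𝔪 v → 𝔪 (f · v)
      𝔪-· {X} f {v} h = 𝔪-≋ (λ y → trans (·-cong f (∑-δ X v) y) (·-∑ f X v (δ X) y))
        (λ y → ε-∑ X (λ x → K.trans (ε-* _ _) (K.trans (K.*-congʳ (h x)) (K.zeroˡ _))))

      -- Stated on values instead of matrix entries, so that sums and composites of maps inherit it.
      -- It starts with `∂ 1` because `∂ 0` is the augmentation onto the ideal.
      Minimal : ∀ {i} {I : Carrier → Set i} → Resolution I → Set (c ⊔ ℓ′)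
      Minimal F = ∀ i v → 𝔪 (∂ (suc i) · v) where open Resolution F

      module _ {i} {I : Carrier → Set i} (I-resp : ∀ {g h} → g ≈ h → I g → I h)
               (F G : Resolution I) (minimal : Minimal F) where

        private
          module F = Resolution F
          1I⊆I : ∀ g → I g → I (1# * g)
          1I⊆I g = I-resp (sym (*-identityˡ g))
          module f = ChainMap F G 1# 1I⊆I
          module g = ChainMap G F 1# 1I⊆I

          id : ∀ {X} → Linear X X
          id ._·_ v = v
          id .·-cong h = h
          id .·-⊞ v w x = refl
          id .·-⊡ r v x = refl

          φ : ∀ i → Linear (F.P i) (F.P i)
          φ i = g.map i ⊚ f.map i ⊟ₗ id

          φ-commutes : ∀ i v → F.∂ i · (φ (suc i) · v) ≋ φ i · (F.∂ i · v)
          φ-commutes i v x = trans (·-⊞ (F.∂ i) _ _ x)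
            (+-cong (trans (g.commutes i _ x) (·-cong (g.map i) (f.commutes i v) x)) (·-⊡ (F.∂ i) _ _ x))

          φ₀≋𝟎 : ∀ v → φ 0 · v ≋ 𝟎
          φ₀≋𝟎 v x = ⊟ₗ-≈0 (g.map 0 ⊚ f.map 0) id {v} (trans (*-identityˡ _) (*-identityˡ _))

          module H = Homotopy F

          φ∈𝔪 : ∀ i v → 𝔪 (φ (suc i) · v)
          φ∈𝔪 i v = 𝔪-≋ (H.φ≋∂s+s∂ φ φ-commutes φ₀≋𝟎 i v) (𝔪-⊞ (minimal i _) (s∂∈𝔪 i))
            where
            s∂∈𝔪 : ∀ j {v} → 𝔪 (H.s φ φ-commutes φ₀≋𝟎 j · (F.∂ j · v))
            -- Values of `∂ 0` are not controlled by minimality, but the homotopy starts with the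
            -- zero map, so this term vanishes.
            s∂∈𝔪 zero    x = ε-0
            s∂∈𝔪 (suc j) = 𝔪-· (H.s φ φ-commutes φ₀≋𝟎 (suc j)) (minimal j _)

        comparison : ∀ i → Linear (F.P i) (Resolution.P G i)
        comparison = f.map

        -- With `f` and `g` the comparison maps in both directions, `g ∘ f - id` is zero in degree
        -- 0, hence null-homotopic: it equals `∂ s + s ∂`, which has values in `𝔪` when `F` is
        -- minimal. So `f` has a left inverse modulo `𝔪`.
        comparison-reflects-𝔪 : ∀ i v → 𝔪 (comparison (suc i) · v) → 𝔪 v
        comparison-reflects-𝔪 i v h = 𝔪-≋ split (𝔪-⊞ (𝔪-· (g.map (suc i)) h) (𝔪-⊡ (- 1#) (φ∈𝔪 i v)))
          where
          split : v ≋ g.map (suc i) · (f.map (suc i) · v) ⊞ (- 1#) ⊡ φ (suc i) · v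
          split x = sym (trans (+-congˡ (trans (-1*x≈-x _) (sym (-‿+-comm _ _))))
            (trans (sym (+-assoc _ _ _)) (trans (+-cong (-‿inverseʳ _) (trans (-‿cong (-1*x≈-x _)) (-‿involutive _)))
              (+-identityˡ _))))

-- The mapping cone that adds one variable of a cycle

module MappingCones where

  open import Algebra.Bundles using (CommutativeRing)
  open import Data.Nat as ℕ using (ℕ; zero; suc)
  open import Data.Fin as Fin using (Fin)
  open import Data.Sum using (inj₁; inj₂)
  open import Data.Product using (∃; _×_; _,_; proj₁; proj₂)
  import Algebra.Properties.Ring
  import Algebra.Properties.CommutativeSemigroup
  import Relation.Binary.Reasoning.Setoid as SetoidReasoning
  open FreeResolutions

  module Cone {ρ ℓ} (R : CommutativeRing ρ ℓ) where

    open CommutativeRing R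
    open FreeModules R
    open Algebra.Properties.Ring ring using (-1*x≈-x; -0#≈0#; -‿+-comm; -‿involutive; -‿distribʳ-*; -‿distribˡ-*)
    open Algebra.Properties.CommutativeSemigroup *-commutativeSemigroup using (x∙yz≈y∙xz)
    open SetoidReasoning setoid

    x-y≈0⇒x≈y : ∀ {a b} → a + - b ≈ 0# → a ≈ b
    x-y≈0⇒x≈y {a} {b} h = begin
      a               ≈⟨ +-identityʳ a ⟨
      a + 0#          ≈⟨ +-congˡ (-‿inverseˡ b) ⟨
      a + (- b + b)   ≈⟨ +-assoc _ _ _ ⟨
      (a + - b) + b   ≈⟨ +-congʳ h ⟩
      0# + b          ≈⟨ +-identityˡ b ⟩
      b               ∎

    x+y≈0⇒x≈-y : ∀ {a b} → a + b ≈ 0# → a ≈ - b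
    x+y≈0⇒x≈-y h = x-y≈0⇒x≈y (trans (+-congˡ (-‿involutive _)) h)

    negₗ : ∀ {X} → Linear X X
    negₗ ._·_ v z = - v z
    negₗ .·-cong h z = -‿cong (h z)
    negₗ .·-⊞ v w z = sym (-‿+-comm _ _)
    negₗ .·-⊡ r v z = -‿distribʳ-* _ _

    -- The syzygies of J = y I + x w I′ are the multiples (x w g, -y g) with g ∈ I′, so J is resolved by
    -- the mapping cone of (x f, -y) : B → A ⊕ B, where f lifts multiplication by w.
    module _ {i} {I I′ J : Carrier → Set i} (A : Resolution I) (B : Resolution I′)
             (x y w : Carrier)
             (wI′⊆I : ∀ b → I′ b → I (w * b))
             (J⁺ : ∀ a b → I a → I′ b → J (y * a + x * w * b))
             (J⁻ : ∀ g → J g → ∃ λ a → ∃ λ b → I a × I′ b × y * a + x * w * b ≈ g)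
             (y-cancel : ∀ a → y * a ≈ 0# → a ≈ 0#)
             (syzygy : ∀ a b → I a → I′ b → y * a + x * w * b ≈ 0# → ∃ λ g → I′ g × y * g ≈ b)
             where

      private
        module A = Resolution A
        module B = Resolution B
        module f = ChainMap B A w wI′⊆I

        γ : ℕ → Shape
        γ zero    = A.β 0 ⊕ B.β 0
        γ (suc n) = A.β (suc n) ⊕ (B.β (suc n) ⊕ B.β n)

        P : ℕ → Shape
        P = Augmented J γ

        top : ∀ n → Linear (A.P (suc n) ⊕ (B.P (suc n) ⊕ B.P n)) (A.P n)
        top n = [ A.∂ n , scale x ⊚ f.map n ⊚ π₂ ]ₗ

        mid : ∀ n → Linear (A.P (suc n) ⊕ (B.P (suc n) ⊕ B.P n)) (B.P n)
        mid n = [ B.∂ n , negₗ ⊚ scale y ]ₗ ⊚ π₂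

        -- The shifted copy of `B` begins with its generators `B.β 0`. Its differential therefore
        -- shows up only from `∂ 2` on, and the case `∂ 1` has two components instead of three.
        ∂ : ∀ n → Linear (P (suc n)) (P n)
        ∂ 0             = [ scale y ⊚ A.∂ 0 , scale (x * w) ⊚ B.∂ 0 ]ₗ
        ∂ 1             = ⟨ top 1 , mid 1 ⟩ₗ
        ∂ (suc (suc n)) = ⟨ top (2 ℕ.+ n) , ⟨ mid (2 ℕ.+ n) , negₗ ⊚ B.∂ (suc n) ⊚ π₂ ⊚ π₂ ⟩ₗ ⟩ₗ

        neg-· : ∀ {X Y} (f : Linear X Y) v → f · (negₗ · v) ≋ negₗ · (f · v)
        neg-· f v z = trans (·-cong f (λ _ → sym (-1*x≈-x _)) z) (trans (·-⊡ f _ _ z) (-1*x≈-x _))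

        top-cycle : ∀ n a (c : Free (B.P (suc n))) c′ → c′ ≋ negₗ · (B.∂ n · c) →
                    A.∂ n · (A.∂ (suc n) · a ⊞ x ⊡ f.map (suc n) · c) ⊞ x ⊡ f.map n · c′ ≋ 𝟎
        top-cycle n a c c′ h z = begin
          (A.∂ n · (A.∂ (suc n) · a ⊞ x ⊡ f.map (suc n) · c)) z + x * (f.map n · c′) z
            ≈⟨ +-cong (trans (·-⊞ (A.∂ n) _ _ z) (+-cong (A.∂∂ n a z) (trans (·-⊡ (A.∂ n) _ _ z) (*-congˡ (f.commutes n c z)))))
                      (*-congˡ (·-cong (f.map n) (λ z → trans (h z) (sym (-1*x≈-x _))) z)) ⟩
          (0# + x * (f.map n · (B.∂ n · c)) z) + x * (f.map n · ((- 1#) ⊡ B.∂ n · c)) z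
            ≈⟨ +-cong (+-identityˡ _) (*-congˡ (trans (·-⊡ (f.map n) _ _ z) (-1*x≈-x _))) ⟩
          x * (f.map n · (B.∂ n · c)) z + x * - (f.map n · (B.∂ n · c)) z
            ≈⟨ +-congˡ (-‿distribʳ-* _ _) ⟨
          x * (f.map n · (B.∂ n · c)) z + - (x * (f.map n · (B.∂ n · c)) z)
            ≈⟨ -‿inverseʳ _ ⟩
          0# ∎

        mid-∂ : ∀ n b (c : Free (B.P (suc n))) →
                B.∂ n · (B.∂ (suc n) · b ⊞ negₗ · (y ⊡ c)) ≋ λ z → - (y * (B.∂ n · c) z)
        mid-∂ n b c z = begin
          (B.∂ n · (B.∂ (suc n) · b ⊞ negₗ · (y ⊡ c))) z
            ≈⟨ ·-⊞ (B.∂ n) _ _ z ⟩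
          (B.∂ n · (B.∂ (suc n) · b)) z + (B.∂ n · (negₗ · (y ⊡ c))) z
            ≈⟨ +-cong (B.∂∂ n b z) (·-cong (B.∂ n) (λ z → -‿distribˡ-* y _) z) ⟩
          0# + (B.∂ n · ((- y) ⊡ c)) z
            ≈⟨ +-identityˡ _ ⟩
          (B.∂ n · ((- y) ⊡ c)) z
            ≈⟨ ·-⊡ (B.∂ n) _ _ z ⟩
          - y * (B.∂ n · c) z
            ≈⟨ -‿distribˡ-* y _ ⟨
          - (y * (B.∂ n · c) z) ∎

        mid-cycle : ∀ n b (c : Free (B.P (suc n))) c′ → c′ ≋ negₗ · (B.∂ n · c) →
                    B.∂ n · (B.∂ (suc n) · b ⊞ negₗ · (y ⊡ c)) ⊞ negₗ · (y ⊡ c′) ≋ 𝟎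
        mid-cycle n b c c′ h z = begin
          (B.∂ n · (B.∂ (suc n) · b ⊞ negₗ · (y ⊡ c))) z + - (y * c′ z)
            ≈⟨ +-cong (mid-∂ n b c z) (trans (-‿cong (trans (*-congˡ (h z)) (sym (-‿distribʳ-* _ _)))) (-‿involutive _)) ⟩
          - (y * (B.∂ n · c) z) + y * (B.∂ n · c) z
            ≈⟨ -‿inverseˡ _ ⟩
          0# ∎

        ∂∂ : ∀ n v → ∂ n · (∂ (suc n) · v) ≋ 𝟎
        ∂∂ zero v Fin.zero = begin
          y * (A.∂ 0 · (A.∂ 1 · a ⊞ x ⊡ f.map 1 · c)) Fin.zero + x * w * (B.∂ 0 · (B.∂ 1 · b ⊞ negₗ · (y ⊡ c))) Fin.zero
            -- The lift in degree 0 is multiplication by `w` itself, so both summands become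
            -- `x * w * (y * β)` up to opposite signs.
            ≈⟨ +-cong (*-congˡ (x+y≈0⇒x≈-y (top-cycle 0 a c (negₗ · (B.∂ 0 · c)) (λ _ → refl) Fin.zero)))
                      (*-congˡ (mid-∂ 0 b c Fin.zero)) ⟩
          y * - (x * (w * - β)) + x * w * - (y * β)
            ≈⟨ +-cong (trans (*-congˡ (trans (-‿cong (trans (*-congˡ (sym (-‿distribʳ-* _ _))) (sym (-‿distribʳ-* _ _))))
                        (-‿involutive _))) (trans (*-congˡ (sym (*-assoc x w β))) (x∙yz≈y∙xz _ _ _))) (sym (-‿distribʳ-* _ _)) ⟩
          x * w * (y * β) + - (x * w * (y * β))
            ≈⟨ -‿inverseʳ _ ⟩
          0# ∎
          where
          a : Free (A.P 2)
          a = fst v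
          b : Free (B.P 2)
          b = fst (snd v)
          c : Free (B.P 1)
          c = snd (snd v)
          β : Carrier
          β = (B.∂ 0 · c) Fin.zero
        ∂∂ (suc zero) v (inj₁ z) = top-cycle 1 _ _ _ (λ _ → refl) z
        ∂∂ (suc zero) v (inj₂ z) = mid-cycle 1 _ _ _ (λ _ → refl) z
        ∂∂ (suc (suc n)) v (inj₁ z) = top-cycle (2 ℕ.+ n) _ _ _ (λ _ → refl) z
        ∂∂ (suc (suc n)) v (inj₂ (inj₁ z)) = mid-cycle (2 ℕ.+ n) _ _ _ (λ _ → refl) z
        ∂∂ (suc (suc n)) v (inj₂ (inj₂ z)) =
          trans (-‿cong (trans (neg-· (B.∂ (suc n)) _ z)
            (trans (-‿cong (B.∂∂ (suc n) _ z)) -0#≈0#))) -0#≈0#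

        fill-mid : ∀ n (b : Free (B.P (suc n))) (c′ : Free (B.P (suc n))) →
                   B.∂ n · b ≋ y ⊡ B.∂ n · c′ → ∃ λ b′ → B.∂ (suc n) · b′ ⊞ y ⊡ c′ ≋ b
        fill-mid n b c′ h with B.exact n (b ⊞ (- y) ⊡ c′) (λ z → begin
            (B.∂ n · (b ⊞ (- y) ⊡ c′)) z               ≈⟨ ·-⊞ (B.∂ n) _ _ z ⟩
            (B.∂ n · b) z + (B.∂ n · ((- y) ⊡ c′)) z   ≈⟨ +-cong (h z) (trans (·-⊡ (B.∂ n) _ _ z) (sym (-‿distribˡ-* _ _))) ⟩
            y * (B.∂ n · c′) z + - (y * (B.∂ n · c′) z) ≈⟨ -‿inverseʳ _ ⟩
            0# ∎)
        ... | b′ , e = b′ , λ z → begin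
            (B.∂ (suc n) · b′) z + y * c′ z      ≈⟨ +-congʳ (e z) ⟩
            (b z + - y * c′ z) + y * c′ z        ≈⟨ +-assoc _ _ _ ⟩
            b z + (- y * c′ z + y * c′ z)        ≈⟨ +-congˡ (trans (+-congʳ (sym (-‿distribˡ-* _ _))) (-‿inverseˡ _)) ⟩
            b z + 0#                             ≈⟨ +-identityʳ _ ⟩
            b z                                  ∎

        fill-top : ∀ n (a : Free (A.P (suc n))) (c′ : Free (B.P (suc n))) →
                   A.∂ n · a ⊞ x ⊡ f.map n · (B.∂ n · c′) ≋ 𝟎 →
                   ∃ λ a′ → A.∂ (suc n) · a′ ⊞ x ⊡ f.map (suc n) · (negₗ · c′) ≋ a
        fill-top n a c′ h with A.exact n (a ⊞ x ⊡ f.map (suc n) · c′) (λ z → begin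
            (A.∂ n · (a ⊞ x ⊡ f.map (suc n) · c′)) z            ≈⟨ ·-⊞ (A.∂ n) _ _ z ⟩
            (A.∂ n · a) z + (A.∂ n · (x ⊡ f.map (suc n) · c′)) z ≈⟨ +-congˡ (trans (·-⊡ (A.∂ n) _ _ z) (*-congˡ (f.commutes n c′ z))) ⟩
            (A.∂ n · a) z + x * (f.map n · (B.∂ n · c′)) z      ≈⟨ h z ⟩
            0# ∎)
        ... | a′ , e = a′ , λ z → begin
            (A.∂ (suc n) · a′) z + x * (f.map (suc n) · (negₗ · c′)) z
              ≈⟨ +-cong (e z) (*-congˡ (neg-· (f.map (suc n)) c′ z)) ⟩
            (a z + x * (f.map (suc n) · c′) z) + x * - (f.map (suc n) · c′) z
              ≈⟨ +-assoc _ _ _ ⟩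
            a z + (x * (f.map (suc n) · c′) z + x * - (f.map (suc n) · c′) z)
              ≈⟨ +-congˡ (trans (+-congˡ (sym (-‿distribʳ-* _ _))) (-‿inverseʳ _)) ⟩
            a z + 0#
              ≈⟨ +-identityʳ _ ⟩
            a z ∎

        neg-y-neg : ∀ r → - (y * - r) ≈ y * r
        neg-y-neg r = trans (-‿cong (sym (-‿distribʳ-* _ _))) (-‿involutive _)

        -- Write `v` as `(a , b , c)`. The shifted coordinate is filled by `c′` with `B.∂ c′ = c`,
        -- entering with a minus sign; then `a + x f c′` and `b - y c′` are cycles of `A` and `B`
        -- and are filled separately.
        fill : ∀ n (v : Free (P (2 ℕ.+ n))) →
               B.∂ n · snd (snd v) ≋ 𝟎 → top (suc n) · v ≋ 𝟎 → mid (suc n) · v ≋ 𝟎 →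
               ∃ λ u → ∂ (2 ℕ.+ n) · u ≋ v
        fill n v hc ha hb = (proj₁ a′ ∥ proj₁ b′ ∥ negₗ · c′) , bounds
          where
          c′ : Free (B.P (2 ℕ.+ n))
          c′ = proj₁ (B.exact n (snd (snd v)) hc)
          ec : B.∂ (suc n) · c′ ≋ snd (snd v)
          ec = proj₂ (B.exact n (snd (snd v)) hc)
          a′ : ∃ λ a′ → A.∂ (2 ℕ.+ n) · a′ ⊞ x ⊡ f.map (2 ℕ.+ n) · (negₗ · c′) ≋ fst v
          a′ = fill-top (suc n) (fst v) c′ (λ z → trans (+-congˡ (*-congˡ (·-cong (f.map (suc n)) ec z))) (ha z))
          b′ : ∃ λ b′ → B.∂ (2 ℕ.+ n) · b′ ⊞ y ⊡ c′ ≋ fst (snd v)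
          b′ = fill-mid (suc n) (fst (snd v)) c′ (λ z → trans (x-y≈0⇒x≈y (hb z)) (*-congˡ (sym (ec z))))
          bounds : ∂ (2 ℕ.+ n) · (proj₁ a′ ∥ proj₁ b′ ∥ negₗ · c′) ≋ v
          bounds (inj₁ z)        = proj₂ a′ z
          bounds (inj₂ (inj₁ z)) = trans (+-congˡ (neg-y-neg _)) (proj₂ b′ z)
          bounds (inj₂ (inj₂ z)) = trans (-‿cong (neg-· (B.∂ (suc n)) c′ z)) (trans (-‿involutive _) (ec z))

        exact : ∀ n v → ∂ n · v ≋ 𝟎 → ∃ λ u → ∂ (suc n) · u ≋ v
        exact zero v h = (proj₁ a′ ∥ proj₁ b′ ∥ negₗ · c) , λ where
            (inj₁ z) → proj₂ a′ z
            (inj₂ z) → trans (+-congˡ (neg-y-neg _)) (proj₂ b′ z)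
          where
          α β : Carrier
          α = (A.∂ 0 · fst v) Fin.zero
          β = (B.∂ 0 · snd v) Fin.zero
          syz : ∃ λ g → I′ g × y * g ≈ β
          syz = syzygy α β (A.∂₀∈ _) (B.∂₀∈ _) (h Fin.zero)
          g : Carrier
          g = proj₁ syz
          pre : ∃ λ c → (B.∂ 0 · c) Fin.zero ≈ g
          pre = B.onto g (proj₁ (proj₂ syz))
          c : Free (B.P 1)
          c = proj₁ pre
          -- Substituting `β = y g` in the relation `y α + x w β = 0` makes `y` a common factor, and
          -- cancelling it leaves a relation in `A`.
          α≈ : α + x * (w * (B.∂ 0 · c) Fin.zero) ≈ 0#
          α≈ = y-cancel _ (begin
            y * (α + x * (w * (B.∂ 0 · c) Fin.zero)) ≈⟨ *-congˡ (+-congˡ (trans (sym (*-assoc _ _ _)) (*-congˡ (proj₂ pre)))) ⟩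
            y * (α + x * w * g)                      ≈⟨ distribˡ _ _ _ ⟩
            y * α + y * (x * w * g)                  ≈⟨ +-congˡ (trans (x∙yz≈y∙xz _ _ _) (*-congˡ (proj₂ (proj₂ syz)))) ⟩
            y * α + x * w * β                        ≈⟨ h Fin.zero ⟩
            0# ∎)
          b′ : ∃ λ b′ → B.∂ 1 · b′ ⊞ y ⊡ c ≋ snd v
          b′ = fill-mid 0 (snd v) c λ { Fin.zero → sym (trans (*-congˡ (proj₂ pre)) (proj₂ (proj₂ syz))) }
          a′ : ∃ λ a′ → A.∂ 1 · a′ ⊞ x ⊡ f.map 1 · (negₗ · c) ≋ fst v
          a′ = fill-top 0 (fst v) c λ { Fin.zero → α≈ }
        exact (suc zero) v h = fill 0 v cycle (λ z → h (inj₁ z)) (λ z → h (inj₂ z))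
          where
          -- `∂ 1` has no component that records `B.∂ 0` of the shifted coordinate. Applying `B.∂ 0`
          -- to the middle equation shows that `y` times this value is zero, and `y` cancels.
          cycle : B.∂ 0 · snd (snd v) ≋ 𝟎
          cycle z = y-cancel _ (trans (sym (-‿involutive _)) (trans (-‿cong (trans (sym (mid-∂ 0 (fst (snd v)) (snd (snd v)) z))
            (·-≋𝟎 (B.∂ 0) (λ z → h (inj₂ z)) z))) -0#≈0#))
        exact (suc (suc n)) v h = fill (suc n) v cycle (λ z → h (inj₁ z)) (λ z → h (inj₂ (inj₁ z)))
          where
          cycle : B.∂ (suc n) · snd (snd v) ≋ 𝟎
          cycle z = trans (sym (-‿involutive _)) (trans (-‿cong (h (inj₂ (inj₂ z)))) -0#≈0#)

      cone : Resolution J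
      cone .Resolution.β = γ
      cone .Resolution.∂ = ∂
      cone .Resolution.∂∂ = ∂∂
      cone .Resolution.exact = exact
      cone .Resolution.∂₀∈ v = J⁺ _ _ (A.∂₀∈ _) (B.∂₀∈ _)
      cone .Resolution.onto g Jg with J⁻ g Jg
      ... | a , b , Ia , I′b , e with A.onto a Ia | B.onto b I′b
      ... | u , eu | v , ev = u ∥ v , trans (+-cong (*-congˡ eu) (*-congˡ ev)) e

      module _ {k ℓ′} {K : CommutativeRing k ℓ′} (𝔸 : Augmentation K) where
        open Augmentation 𝔸
        open Residue 𝔸
        private module K = CommutativeRing K

        -- The only components that are not differentials of `A` or `B` are `x f` and `- y`; the
        -- factors `x` and `y` lie in the kernel of `ε`, whatever entries `f` has.
        cone-minimal : ε x K.≈ K.0# → ε y K.≈ K.0# → Minimal A → Minimal B → Minimal cone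
        cone-minimal εx εy minA minB = minimal
          where
          𝔪-scale : ∀ {X} r (v : Free X) → ε r K.≈ K.0# → 𝔪 (r ⊡ v)
          𝔪-scale r v h z = K.trans (ε-* _ _) (K.trans (K.*-congʳ h) (K.zeroˡ _))
          𝔪-neg : ∀ {X} {v : Free X} → 𝔪 v → 𝔪 (negₗ · v)
          𝔪-neg h = 𝔪-≋ (λ _ → sym (-1*x≈-x _)) (𝔪-⊡ (- 1#) h)
          min-top : ∀ n v → 𝔪 (top (suc n) · v)
          min-top n v = 𝔪-⊞ (minA n _) (𝔪-scale x _ εx)
          min-mid : ∀ n v → 𝔪 (mid (suc n) · v)
          min-mid n v = 𝔪-⊞ (minB n _) (𝔪-neg (𝔪-scale y _ εy))
          minimal : Minimal cone
          minimal zero    v (inj₁ z) = min-top 0 v z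
          minimal zero    v (inj₂ z) = min-mid 0 v z
          minimal (suc n) v (inj₁ z) = min-top (suc n) v z
          minimal (suc n) v (inj₂ (inj₁ z)) = min-mid (suc n) v z
          minimal (suc n) v (inj₂ (inj₂ z)) = 𝔪-neg (minB n _) z

-- Dimension over a field and uniqueness of Betti numbers

module BettiUniqueness where

  open import Level using (_⊔_)
  open import Algebra.Bundles using (CommutativeRing)
  open import Data.Nat as ℕ using (ℕ; zero; suc; _≤_; _<_; s≤s)
  import Data.Nat.Properties as ℕ
  open import Data.Fin as Fin using (Fin; punchIn; punchOut)
  import Data.Fin.Properties as Fin
  open import Data.Sum using (_⊎_; inj₁; inj₂)
  open import Data.Product using (∃; _,_; proj₁; proj₂)
  open import Function using (_∘_)
  open import Relation.Nullary using (¬_; yes; no)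
  open import Relation.Binary.PropositionalEquality as ≡ using (_≡_)
  import Algebra.Properties.Ring
  import Algebra.Properties.CommutativeSemigroup
  import Relation.Binary.Reasoning.Setoid as SetoidReasoning
  open FreeResolutions

  -- Equality in `k` need not be decidable, so a nonzero entry of a vector is found only under a
  -- double negation. That suffices where the goal is itself a negation.
  ¬¬-all-or-counterexample : ∀ {p} n (Q : Fin n → Set p) → ¬ ¬ ((∀ i → Q i) ⊎ ∃ λ i → ¬ Q i)
  ¬¬-all-or-counterexample zero    Q k = k (inj₁ λ ())
  ¬¬-all-or-counterexample (suc n) Q k = ¬¬-all-or-counterexample n (Q ∘ Fin.suc) λ where
    (inj₂ (i , ¬q)) → k (inj₂ (Fin.suc i , ¬q))
    (inj₁ qs)       → k (inj₂ (Fin.zero , λ q → k (inj₁ λ { Fin.zero → q ; (Fin.suc i) → qs i })))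

  module Rank {κ ℓ′} (k : Field κ ℓ′) where
    open Field k
    open FreeModules commutativeRing
    open Algebra.Properties.Ring ring using (-‿distribˡ-*)
    open Algebra.Properties.CommutativeSemigroup +-commutativeSemigroup using (interchange)
    open Algebra.Properties.CommutativeSemigroup *-commutativeSemigroup using (x∙yz≈y∙xz)
    open SetoidReasoning setoid

    e₀ : ∀ {n} → Free (fin (suc n))
    e₀ Fin.zero    = 1#
    e₀ (Fin.suc i) = 0#

    shift : ∀ {n} → Linear (fin n) (fin (suc n))
    shift ._·_ w Fin.zero    = 0#
    shift ._·_ w (Fin.suc i) = w i
    shift .·-cong h Fin.zero    = refl
    shift .·-cong h (Fin.suc i) = h i
    shift .·-⊞ v w Fin.zero    = sym (+-identityˡ 0#)
    shift .·-⊞ v w (Fin.suc i) = refl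
    shift .·-⊡ r v Fin.zero    = sym (zeroʳ r)
    shift .·-⊡ r v (Fin.suc i) = refl

    -- One step of Gaussian elimination with pivot row `r`, after which that row is dropped; `c i`
    -- is the multiple subtracted from the `i`-th remaining row.
    eliminate : ∀ {n} → Fin (suc n) → (Fin n → Carrier) → Linear (fin (suc n)) (fin n)
    eliminate r c ._·_ u i = u (punchIn r i) + - (c i) * u r
    eliminate r c .·-cong h i = +-cong (h _) (*-congˡ (h r))
    eliminate r c .·-⊞ v w i = trans (+-congˡ (distribˡ _ _ _)) (interchange _ _ _ _)
    eliminate r c .·-⊡ s v i = trans (+-congˡ (x∙yz≈y∙xz _ _ _)) (sym (distribˡ _ _ _))

    Injective : ∀ {p q} → Linear (fin p) (fin q) → Set (κ ⊔ ℓ′)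
    Injective T = ∀ v → T · v ≋ 𝟎 → v ≋ 𝟎

    injective⇒≮ : ∀ p q (T : Linear (fin p) (fin q)) → Injective T → ¬ (q < p)
    injective⇒≮ (suc p) zero T inj _ = 0≉1 (sym (inj e₀ (λ ()) Fin.zero))
    injective⇒≮ (suc p) (suc q) T inj (s≤s q<p) = ¬¬-all-or-counterexample (suc q) (λ i → t i ≈ 0#) λ where
        (inj₁ t≋𝟎) → 0≉1 (sym (inj e₀ t≋𝟎 Fin.zero))
        (inj₂ (r , t≉0)) → injective⇒≮ p q (T′ r (proj₁ (inverse (t r) t≉0)))
                             (inj′ r (proj₁ (inverse (t r) t≉0)) (proj₂ (inverse (t r) t≉0))) q<p
      where
      t : Free (fin (suc q))
      t = T · e₀

      -- The map induced by `T` from the quotient by `e₀` to the quotient by `t = T · e₀`; a nonzero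
      -- coordinate `t r` identifies the latter with the coordinates other than `r`.
      T′ : Fin (suc q) → Carrier → Linear (fin p) (fin q)
      T′ r y = eliminate r (λ i → t (punchIn r i) * y) ⊚ T ⊚ shift

      inj′ : ∀ r y → t r * y ≈ 1# → Injective (T′ r y)
      inj′ r y ty≈1 w T′w≋𝟎 i = begin
          w i              ≈⟨ +-identityˡ _ ⟨
          0# + w i         ≈⟨ +-congʳ (zeroʳ a) ⟨
          a * 0# + w i     ≈⟨ inj v Tv≋𝟎 (Fin.suc i) ⟩
          0#               ∎
        where
        u : Free (fin (suc q))
        u = T · (shift · w)
        a : Carrier
        -- The multiple of `e₀` for which the coordinate `r` of `T · v` vanishes, `y` being the
        -- inverse of `t r`. The other coordinates are then those of `T′`.
        a = - (y * u r)
        v : Free (fin (suc p))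
        v = a ⊡ e₀ ⊞ shift · w
        Tv : T · v ≋ a ⊡ t ⊞ u
        Tv j = trans (·-⊞ T _ _ j) (+-congʳ (·-⊡ T _ _ j))
        Tv≋𝟎 : T · v ≋ 𝟎
        Tv≋𝟎 j with r Fin.≟ j
        ... | yes ≡.refl = trans (Tv r) (begin
          - (y * u r) * t r + u r     ≈⟨ +-congʳ (-‿distribˡ-* _ _) ⟨
          - (y * u r * t r) + u r     ≈⟨ +-congʳ (-‿cong (trans (*-comm _ _) (trans (sym (*-assoc _ _ _)) (trans (*-congʳ ty≈1) (*-identityˡ _))))) ⟩
          - u r + u r                 ≈⟨ -‿inverseˡ _ ⟩
          0# ∎)
        ... | no r≢j = ≡.subst (λ j → (T · v) j ≈ 0#) (Fin.punchIn-punchOut r≢j) (trans (Tv (punchIn r i′)) (begin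
          - (y * u r) * t (punchIn r i′) + u (punchIn r i′)   ≈⟨ +-comm _ _ ⟩
          u (punchIn r i′) + - (y * u r) * t (punchIn r i′)   ≈⟨ +-congˡ (trans (sym (-‿distribˡ-* _ _))
              (trans (-‿cong (trans (*-comm _ _) (sym (*-assoc _ _ _)))) (-‿distribˡ-* _ _))) ⟩
          u (punchIn r i′) + - (t (punchIn r i′) * y) * u r   ≈⟨ T′w≋𝟎 i′ ⟩
          0# ∎))
          where
          i′ : Fin q
          i′ = punchOut r≢j

    injective⇒≤ : ∀ {p q} (T : Linear (fin p) (fin q)) → Injective T → p ≤ q
    injective⇒≤ T inj = ℕ.≮⇒≥ (injective⇒≮ _ _ T inj)

  encode : ∀ X → El X → Fin (size X)
  encode (fin n) i = i
  encode (X ⊕ Y) (inj₁ x) = encode X x Fin.↑ˡ size Y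
  encode (X ⊕ Y) (inj₂ y) = size X Fin.↑ʳ encode Y y

  decode : ∀ X → Fin (size X) → El X
  decode (fin n) i = i
  decode (X ⊕ Y) i with Fin.splitAt (size X) i
  ... | inj₁ j = inj₁ (decode X j)
  ... | inj₂ j = inj₂ (decode Y j)

  decode-encode : ∀ X x → decode X (encode X x) ≡ x
  decode-encode (fin n) i = ≡.refl
  decode-encode (X ⊕ Y) (inj₁ x) rewrite Fin.splitAt-↑ˡ (size X) (encode X x) (size Y) = ≡.cong inj₁ (decode-encode X x)
  decode-encode (X ⊕ Y) (inj₂ y) rewrite Fin.splitAt-↑ʳ (size X) (size Y) (encode Y y) = ≡.cong inj₂ (decode-encode Y y)

  encode-decode : ∀ X i → encode X (decode X i) ≡ i
  encode-decode (fin n) i = ≡.refl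
  encode-decode (X ⊕ Y) i with Fin.splitAt (size X) i in eq
  ... | inj₁ j = ≡.trans (≡.cong (Fin._↑ˡ size Y) (encode-decode X j)) (Fin.splitAt⁻¹-↑ˡ eq)
  ... | inj₂ j = ≡.trans (≡.cong (size X Fin.↑ʳ_) (encode-decode Y j)) (Fin.splitAt⁻¹-↑ʳ eq)

  module Uniqueness {c ℓ κ ℓ′} (R : CommutativeRing c ℓ) (k : Field κ ℓ′)
                    (A : FreeModules.Augmentation R (Field.commutativeRing k)) where
    open CommutativeRing R
    open FreeModules R
    open Augmentation A
    open Residue A
    private
      module k = Field k
      module K = FreeModules k.commutativeRing

    module _ {i} {I : Carrier → Set i} (I-resp : ∀ {g h} → g ≈ h → I g → I h) where

      -- The comparison map modulo `𝔪`, with constants as representatives. Reflecting `𝔪` means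
      -- precisely that this map over `k` is injective.
      betti≤ : (F G : Resolution I) → Minimal F →
               ∀ n → size (Resolution.β F n) ≤ size (Resolution.β G n)
      betti≤ F G minimal n = Rank.injective⇒≤ k T inj
        where
        X Y : Shape
        X = Resolution.β F n
        Y = Resolution.β G n
        f : Linear X Y
        f = comparison I-resp F G minimal (suc n)
        lift-ι : K.Free (fin (size X)) → Free X
        lift-ι v x = ι (v (encode X x))
        T : K.Linear (fin (size X)) (fin (size Y))
        T .K._·_ v j = ε ((f · lift-ι v) (decode Y j))
        T .K.·-cong h j = ε-cong (·-cong f (λ x → ι-cong (h _)) _)
        T .K.·-⊞ v w j = k.trans (ε-cong (trans (·-cong f (λ x → ι-+ _ _) _) (·-⊞ f _ _ _))) (ε-+ _ _)
        T .K.·-⊡ r v j = k.trans (ε-cong (trans (·-cong f (λ x → ι-* _ _) _) (·-⊡ f _ _ _)))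
          (k.trans (ε-* _ _) (k.*-congʳ (ε∘ι r)))
        inj : Rank.Injective k T
        inj v Tv≋𝟎 j = ≡.subst (λ j → v j k.≈ k.0#) (encode-decode X j)
          (k.trans (k.sym (ε∘ι _)) (comparison-reflects-𝔪 I-resp F G minimal n (lift-ι v) fv∈𝔪 (decode X j)))
          where
          fv∈𝔪 : 𝔪 (f · lift-ι v)
          fv∈𝔪 y = ≡.subst (λ y → ε ((f · lift-ι v) y) k.≈ k.0#) (decode-encode Y y) (Tv≋𝟎 (encode Y y))

      betti-unique : (F G : Resolution I) → Minimal F → Minimal G →
                     ∀ n → size (Resolution.β F n) ≡ size (Resolution.β G n)
      betti-unique F G minF minG n = ℕ.≤-antisym (betti≤ F G minF n) (betti≤ G F minG n)

-- The polynomial ring, its augmentation and division by a variable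

module Polynomials where

  open import Algebra.Bundles using (CommutativeRing)
  open import Data.Nat as ℕ using (ℕ; zero; suc; _≤_)
  import Data.Nat.Properties as ℕ
  open import Data.Fin as Fin using (Fin)
  open import Data.Vec as Vec using (Vec; []; _∷_; updateAt; zipWith; replicate)
  import Data.Vec.Properties as Vec
  open import Data.List as List using (List; []; _∷_; _++_)
  open import Data.Sum using (_⊎_; inj₁; inj₂)
  open import Data.Product using (∃; _×_; _,_; proj₁; proj₂)
  open import Data.Empty using (⊥-elim)
  open import Data.Bool using (if_then_else_)
  open import Function using (_∘_)
  open import Relation.Nullary using (yes; no; does)
  open import Relation.Binary.PropositionalEquality as ≡ using (_≡_; _≢_)
  import Algebra.Properties.Ring
  import Algebra.Properties.CommutativeSemigroup
  import Relation.Binary.Reasoning.Setoid as SetoidReasoning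
  open FreeResolutions

  Exponent : ℕ → Set
  Exponent n = Vec ℕ n

  infixl 6 _⊹_
  _⊹_ : ∀ {n} → Exponent n → Exponent n → Exponent n
  _⊹_ = zipWith ℕ._+_

  0ᵉ : ∀ {n} → Exponent n
  0ᵉ = replicate _ 0

  raise : ∀ {n} → Fin n → Exponent n → Exponent n
  raise j e = updateAt e j suc

  unit⊹ : ∀ {n} (j : Fin n) (e : Exponent n) → raise j 0ᵉ ⊹ e ≡ raise j e
  unit⊹ Fin.zero    (x ∷ e) = ≡.cong (suc x ∷_) (Vec.zipWith-identityˡ ℕ.+-identityˡ e)
  unit⊹ (Fin.suc j) (x ∷ e) = ≡.cong (x ∷_) (unit⊹ j e)

  raise-injective : ∀ {n} (j : Fin n) {e f : Exponent n} → raise j e ≡ raise j f → e ≡ f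
  raise-injective Fin.zero    {x ∷ e} {y ∷ f} ≡.refl = ≡.refl
  raise-injective (Fin.suc j) {x ∷ e} {y ∷ f} h =
    ≡.cong₂ _∷_ (Vec.∷-injectiveˡ h) (raise-injective j (Vec.∷-injectiveʳ h))

  lower : ∀ {n} (j : Fin n) (e : Exponent n) → (∃ λ f → e ≡ raise j f) ⊎ (∀ f → e ≢ raise j f)
  lower Fin.zero    (zero ∷ e)  = inj₂ λ { (_ ∷ _) () }
  lower Fin.zero    (suc x ∷ e) = inj₁ (x ∷ e , ≡.refl)
  lower (Fin.suc j) (x ∷ e) with lower j e
  ... | inj₁ (f , h) = inj₁ (x ∷ f , ≡.cong (x ∷_) h)
  ... | inj₂ h       = inj₂ λ { (_ ∷ f) eq → h f (Vec.∷-injectiveʳ eq) }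

  raise-comm : ∀ {n} (i j : Fin n) (e : Exponent n) → raise i (raise j e) ≡ raise j (raise i e)
  raise-comm Fin.zero    Fin.zero    (x ∷ e) = ≡.refl
  raise-comm Fin.zero    (Fin.suc j) (x ∷ e) = ≡.refl
  raise-comm (Fin.suc i) Fin.zero    (x ∷ e) = ≡.refl
  raise-comm (Fin.suc i) (Fin.suc j) (x ∷ e) = ≡.cong (x ∷_) (raise-comm i j e)

  raise-lower : ∀ {n} {i j : Fin n} → i ≢ j → ∀ {e f : Exponent n} → raise i e ≡ raise j f → ∃ λ g → e ≡ raise j g
  raise-lower {i = Fin.zero}  {Fin.zero}  i≢j _ = ⊥-elim (i≢j ≡.refl)
  raise-lower {i = Fin.zero}  {Fin.suc j} i≢j {x ∷ e} {y ∷ f} h = x ∷ f , ≡.cong (x ∷_) (Vec.∷-injectiveʳ h)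
  raise-lower {i = Fin.suc i} {Fin.zero}  i≢j {x ∷ e} {y ∷ f} h = y ∷ e , ≡.cong (_∷ e) (Vec.∷-injectiveˡ h)
  raise-lower {i = Fin.suc i} {Fin.suc j} i≢j {x ∷ e} {y ∷ f} h
    with raise-lower (i≢j ∘ ≡.cong Fin.suc) (Vec.∷-injectiveʳ h)
  ... | g , eq = x ∷ g , ≡.cong (x ∷_) eq

  subtract : ∀ {n} (e m : Exponent n) → (∃ λ f → e ⊹ f ≡ m) ⊎ (∀ f → e ⊹ f ≢ m)
  subtract []      []      = inj₁ ([] , ≡.refl)
  subtract (x ∷ e) (y ∷ m) with x ℕ.≤? y | subtract e m
  ... | yes x≤y | inj₁ (f , h) = inj₁ (y ℕ.∸ x ∷ f , ≡.cong₂ _∷_ (ℕ.m+[n∸m]≡n x≤y) h)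
  ... | no  x≰y | _            = inj₂ λ { (z ∷ f) eq → x≰y (≡.subst (x ℕ.≤_) (Vec.∷-injectiveˡ eq) (ℕ.m≤m+n x z)) }
  ... | yes _   | inj₂ h       = inj₂ λ { (z ∷ f) eq → h f (Vec.∷-injectiveʳ eq) }

  ⊹-cancelˡ : ∀ {n} (e : Exponent n) {f g} → e ⊹ f ≡ e ⊹ g → f ≡ g
  ⊹-cancelˡ []      {[]}    {[]}    h = ≡.refl
  ⊹-cancelˡ (x ∷ e) {y ∷ f} {z ∷ g} h =
    ≡.cong₂ _∷_ (ℕ.+-cancelˡ-≡ x y z (Vec.∷-injectiveˡ h)) (⊹-cancelˡ e (Vec.∷-injectiveʳ h))

  ⊹-zero : ∀ {n} (e f : Exponent n) → e ⊹ f ≡ 0ᵉ → e ≡ 0ᵉ × f ≡ 0ᵉ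
  ⊹-zero []      []      h = ≡.refl , ≡.refl
  ⊹-zero (x ∷ e) (y ∷ f) h with ⊹-zero e f (Vec.∷-injectiveʳ h)
  ... | p , q = ≡.cong₂ _∷_ (ℕ.m+n≡0⇒m≡0 x (Vec.∷-injectiveˡ h)) p , ≡.cong₂ _∷_ (ℕ.m+n≡0⇒n≡0 x (Vec.∷-injectiveˡ h)) q

  module PolynomialRing {c ℓ} (k : Field c ℓ) (n : ℕ) where
    open Field k
    open Algebra.Properties.Ring ring using (-‿+-comm; -0#≈0#; -‿distribˡ-*)
    open Algebra.Properties.CommutativeSemigroup +-commutativeSemigroup using (interchange)
    open Algebra.Properties.CommutativeSemigroup *-commutativeSemigroup using (x∙yz≈y∙xz)
    open SetoidReasoning setoid

    S : Set c
    S = Poly k n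

    infix 4 _≈ᵖ_
    _≈ᵖ_ : S → S → Set ℓ
    _≈ᵖ_ = _≈P_ k n

    infixl 7 _*ᵖ_
    _*ᵖ_ : S → S → S
    _*ᵖ_ = _*P_ k n

    -- Pairing of a polynomial with a linear functional given by its values on monomials.
    ⟦_⟧ : S → (Exponent n → Carrier) → Carrier
    ⟦ [] ⟧          φ = 0#
    ⟦ (a , e) ∷ p ⟧ φ = a * φ e + ⟦ p ⟧ φ

    χ : Exponent n → Exponent n → Carrier
    χ m e = if does (Vec.≡-dec ℕ._≟_ e m) then 1# else 0#

    χ-≡ : ∀ {m e} → e ≡ m → χ m e ≡ 1#
    χ-≡ {m} {e} e≡m with Vec.≡-dec ℕ._≟_ e m
    ... | yes _  = ≡.refl
    ... | no e≢m = ⊥-elim (e≢m e≡m)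

    χ-≢ : ∀ {m e} → e ≢ m → χ m e ≡ 0#
    χ-≢ {m} {e} e≢m with Vec.≡-dec ℕ._≟_ e m
    ... | yes e≡m = ⊥-elim (e≢m e≡m)
    ... | no _    = ≡.refl

    χ-⇔ : ∀ {m e m′ e′} → (e ≡ m → e′ ≡ m′) → (e′ ≡ m′ → e ≡ m) → χ m e ≈ χ m′ e′
    χ-⇔ {m} {e} to from with Vec.≡-dec ℕ._≟_ e m
    ... | yes e≡m = reflexive (≡.sym (χ-≡ (to e≡m)))
    ... | no e≢m  = reflexive (≡.sym (χ-≢ (e≢m ∘ from)))

    coeff≈⟦⟧ : ∀ p m → coeff k n p m ≈ ⟦ p ⟧ (χ m)
    coeff≈⟦⟧ []            m = refl
    coeff≈⟦⟧ ((a , e) ∷ p) m with Vec.≡-dec ℕ._≟_ e m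
    ... | yes _ = +-cong (sym (*-identityʳ a)) (coeff≈⟦⟧ p m)
    ... | no _  = trans (coeff≈⟦⟧ p m) (sym (trans (+-congʳ (zeroʳ a)) (+-identityˡ _)))

    ⟦⟧-cong : ∀ p {φ ψ} → (∀ e → φ e ≈ ψ e) → ⟦ p ⟧ φ ≈ ⟦ p ⟧ ψ
    ⟦⟧-cong []            h = refl
    ⟦⟧-cong ((a , e) ∷ p) h = +-cong (*-congˡ (h e)) (⟦⟧-cong p h)

    ⟦⟧-++ : ∀ p q φ → ⟦ p ++ q ⟧ φ ≈ ⟦ p ⟧ φ + ⟦ q ⟧ φ
    ⟦⟧-++ []      q φ = sym (+-identityˡ _)
    ⟦⟧-++ (t ∷ p) q φ = trans (+-congˡ (⟦⟧-++ p q φ)) (sym (+-assoc _ _ _))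

    ⟦⟧-+ : ∀ p φ ψ → ⟦ p ⟧ (λ e → φ e + ψ e) ≈ ⟦ p ⟧ φ + ⟦ p ⟧ ψ
    ⟦⟧-+ []      φ ψ = sym (+-identityˡ _)
    ⟦⟧-+ (t ∷ p) φ ψ = trans (+-cong (distribˡ _ _ _) (⟦⟧-+ p φ ψ)) (interchange _ _ _ _)

    ⟦⟧-* : ∀ p r φ → ⟦ p ⟧ (λ e → r * φ e) ≈ r * ⟦ p ⟧ φ
    ⟦⟧-* []      r φ = sym (zeroʳ r)
    ⟦⟧-* (t ∷ p) r φ = trans (+-cong (x∙yz≈y∙xz _ _ _) (⟦⟧-* p r φ)) (sym (distribˡ _ _ _))

    ⟦⟧-0 : ∀ p → ⟦ p ⟧ (λ _ → 0#) ≈ 0#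
    ⟦⟧-0 []      = refl
    ⟦⟧-0 (t ∷ p) = trans (+-cong (zeroʳ _) (⟦⟧-0 p)) (+-identityˡ _)

    ⟦⟧-swap : ∀ p q (ψ : Exponent n → Exponent n → Carrier) →
              ⟦ p ⟧ (λ e → ⟦ q ⟧ (ψ e)) ≈ ⟦ q ⟧ (λ f → ⟦ p ⟧ (λ e → ψ e f))
    ⟦⟧-swap []            q ψ = sym (⟦⟧-0 q)
    ⟦⟧-swap ((a , e) ∷ p) q ψ = begin
      a * ⟦ q ⟧ (ψ e) + ⟦ p ⟧ (λ e → ⟦ q ⟧ (ψ e))                        ≈⟨ +-cong (sym (⟦⟧-* q a (ψ e))) (⟦⟧-swap p q ψ) ⟩
      ⟦ q ⟧ (λ f → a * ψ e f) + ⟦ q ⟧ (λ f → ⟦ p ⟧ (λ e → ψ e f))        ≈⟨ ⟦⟧-+ q _ _ ⟨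
      ⟦ q ⟧ (λ f → a * ψ e f + ⟦ p ⟧ (λ e → ψ e f))                      ∎

    ⟦⟧-*ᵖ : ∀ p q φ → ⟦ p *ᵖ q ⟧ φ ≈ ⟦ p ⟧ (λ e → ⟦ q ⟧ (λ f → φ (e ⊹ f)))
    ⟦⟧-*ᵖ []            q φ = refl
    ⟦⟧-*ᵖ ((a , e) ∷ p) q φ = trans (⟦⟧-++ (List.map (λ u → (a * proj₁ u , zipWith ℕ._+_ e (proj₂ u))) q) (p *ᵖ q) φ) (+-cong (term q) (⟦⟧-*ᵖ p q φ))
      where
      term : ∀ q → ⟦ List.map (λ u → (a * proj₁ u , zipWith ℕ._+_ e (proj₂ u))) q ⟧ φ ≈ a * ⟦ q ⟧ (λ f → φ (e ⊹ f))
      term []            = sym (zeroʳ a)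
      term ((b , f) ∷ q) = trans (+-cong (*-assoc _ _ _) (term q)) (sym (distribˡ _ _ _))

    toᵖ : ∀ {p q} → (∀ m → ⟦ p ⟧ (χ m) ≈ ⟦ q ⟧ (χ m)) → p ≈ᵖ q
    toᵖ {p} {q} h m = trans (coeff≈⟦⟧ p m) (trans (h m) (sym (coeff≈⟦⟧ q m)))

    fromᵖ : ∀ {p q} → p ≈ᵖ q → ∀ m → ⟦ p ⟧ (χ m) ≈ ⟦ q ⟧ (χ m)
    fromᵖ {p} {q} h m = trans (sym (coeff≈⟦⟧ p m)) (trans (h m) (coeff≈⟦⟧ q m))

    -- Makes multiplication well defined on formal sums: shifting by `e` turns the coefficient
    -- functional at `m` into the one at `m - e`, or into zero if `e` does not divide `m`.
    fromᵖ-⊹ : ∀ {p q} → p ≈ᵖ q → ∀ e m → ⟦ p ⟧ (λ f → χ m (e ⊹ f)) ≈ ⟦ q ⟧ (λ f → χ m (e ⊹ f))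
    fromᵖ-⊹ {p} {q} h e m with subtract e m
    ... | inj₁ (m′ , ≡.refl) = trans (⟦⟧-cong p same) (trans (fromᵖ {p} {q} h m′) (sym (⟦⟧-cong q same)))
      where
      same : ∀ f → χ (e ⊹ m′) (e ⊹ f) ≈ χ m′ f
      same f = χ-⇔ (⊹-cancelˡ e) (≡.cong (e ⊹_))
    ... | inj₂ h′ = trans (⟦⟧-cong p vanish) (trans (⟦⟧-0 p) (sym (trans (⟦⟧-cong q vanish) (⟦⟧-0 q))))
      where
      vanish : ∀ f → χ m (e ⊹ f) ≈ 0#
      vanish f = reflexive (χ-≢ (h′ f))

    -ᵖ_ : S → S
    -ᵖ p = List.map (λ t → (- proj₁ t , proj₂ t)) p

    ⟦⟧-neg : ∀ p φ → ⟦ -ᵖ p ⟧ φ ≈ - ⟦ p ⟧ φ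
    ⟦⟧-neg []      φ = sym -0#≈0#
    ⟦⟧-neg (t ∷ p) φ = trans (+-cong (sym (-‿distribˡ-* _ _)) (⟦⟧-neg p φ)) (-‿+-comm _ _)

    X^ : Exponent n → S
    X^ e = (1# , e) ∷ []

    ⟦X^⟧ : ∀ e φ → ⟦ X^ e ⟧ φ ≈ φ e
    ⟦X^⟧ e φ = trans (+-identityʳ _) (*-identityˡ _)

    ≈ᵖ-refl : ∀ {p} → p ≈ᵖ p
    ≈ᵖ-refl m = refl

    *ᵖ-congˡ : ∀ p {q q′} → q ≈ᵖ q′ → p *ᵖ q ≈ᵖ p *ᵖ q′
    *ᵖ-congˡ p {q} {q′} h = toᵖ {p *ᵖ q} {p *ᵖ q′} λ m → begin
      ⟦ p *ᵖ q ⟧ (χ m)                             ≈⟨ ⟦⟧-*ᵖ p q (χ m) ⟩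
      ⟦ p ⟧ (λ e → ⟦ q ⟧ (λ f → χ m (e ⊹ f)))      ≈⟨ ⟦⟧-cong p (λ e → fromᵖ-⊹ {q} {q′} h e m) ⟩
      ⟦ p ⟧ (λ e → ⟦ q′ ⟧ (λ f → χ m (e ⊹ f)))     ≈⟨ ⟦⟧-*ᵖ p q′ (χ m) ⟨
      ⟦ p *ᵖ q′ ⟧ (χ m)                            ∎

    *ᵖ-comm : ∀ p q → p *ᵖ q ≈ᵖ q *ᵖ p
    *ᵖ-comm p q = toᵖ {p *ᵖ q} {q *ᵖ p} λ m → begin
      ⟦ p *ᵖ q ⟧ (χ m)                             ≈⟨ ⟦⟧-*ᵖ p q (χ m) ⟩
      ⟦ p ⟧ (λ e → ⟦ q ⟧ (λ f → χ m (e ⊹ f)))      ≈⟨ ⟦⟧-swap p q _ ⟩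
      ⟦ q ⟧ (λ f → ⟦ p ⟧ (λ e → χ m (e ⊹ f)))      ≈⟨ ⟦⟧-cong q (λ f → ⟦⟧-cong p (λ e →
                                                        reflexive (≡.cong (χ m) (Vec.zipWith-comm ℕ.+-comm e f)))) ⟩
      ⟦ q ⟧ (λ f → ⟦ p ⟧ (λ e → χ m (f ⊹ e)))      ≈⟨ ⟦⟧-*ᵖ q p (χ m) ⟨
      ⟦ q *ᵖ p ⟧ (χ m)                             ∎

    *ᵖ-cong : ∀ {p p′ q q′} → p ≈ᵖ p′ → q ≈ᵖ q′ → p *ᵖ q ≈ᵖ p′ *ᵖ q′
    *ᵖ-cong {p} {p′} {q} {q′} hp hq m = trans (*ᵖ-congˡ p {q} {q′} hq m)
      (trans (*ᵖ-comm p q′ m) (trans (*ᵖ-congˡ q′ {p} {p′} hp m) (*ᵖ-comm q′ p′ m)))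

    *ᵖ-assoc : ∀ p q r → (p *ᵖ q) *ᵖ r ≈ᵖ p *ᵖ (q *ᵖ r)
    *ᵖ-assoc p q r = toᵖ {(p *ᵖ q) *ᵖ r} {p *ᵖ (q *ᵖ r)} λ m → begin
      ⟦ (p *ᵖ q) *ᵖ r ⟧ (χ m)
        ≈⟨ trans (⟦⟧-*ᵖ (p *ᵖ q) r (χ m)) (⟦⟧-*ᵖ p q _) ⟩
      ⟦ p ⟧ (λ e → ⟦ q ⟧ (λ f → ⟦ r ⟧ (λ g → χ m ((e ⊹ f) ⊹ g))))
        ≈⟨ ⟦⟧-cong p (λ e → ⟦⟧-cong q (λ f → ⟦⟧-cong r (λ g →
             reflexive (≡.cong (χ m) (Vec.zipWith-assoc ℕ.+-assoc e f g))))) ⟩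
      ⟦ p ⟧ (λ e → ⟦ q ⟧ (λ f → ⟦ r ⟧ (λ g → χ m (e ⊹ (f ⊹ g)))))
        ≈⟨ ⟦⟧-cong p (λ e → ⟦⟧-*ᵖ q r (λ g → χ m (e ⊹ g))) ⟨
      ⟦ p ⟧ (λ e → ⟦ q *ᵖ r ⟧ (λ g → χ m (e ⊹ g)))
        ≈⟨ ⟦⟧-*ᵖ p (q *ᵖ r) (χ m) ⟨
      ⟦ p *ᵖ (q *ᵖ r) ⟧ (χ m) ∎

    *ᵖ-identityˡ : ∀ p → X^ 0ᵉ *ᵖ p ≈ᵖ p
    *ᵖ-identityˡ p = toᵖ {X^ 0ᵉ *ᵖ p} {p} λ m → trans (⟦⟧-*ᵖ (X^ 0ᵉ) p (χ m))
      (trans (⟦X^⟧ 0ᵉ (λ e → ⟦ p ⟧ (λ f → χ m (e ⊹ f))))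
        (⟦⟧-cong p (λ f → reflexive (≡.cong (χ m) (Vec.zipWith-identityˡ ℕ.+-identityˡ f)))))

    *ᵖ-distribˡ : ∀ p q r → p *ᵖ (q ++ r) ≈ᵖ p *ᵖ q ++ p *ᵖ r
    *ᵖ-distribˡ p q r = toᵖ {p *ᵖ (q ++ r)} {p *ᵖ q ++ p *ᵖ r} λ m → begin
      ⟦ p *ᵖ (q ++ r) ⟧ (χ m)
        ≈⟨ ⟦⟧-*ᵖ p (q ++ r) (χ m) ⟩
      ⟦ p ⟧ (λ e → ⟦ q ++ r ⟧ (λ f → χ m (e ⊹ f)))
        ≈⟨ trans (⟦⟧-cong p (λ e → ⟦⟧-++ q r _)) (⟦⟧-+ p _ _) ⟩
      ⟦ p ⟧ (λ e → ⟦ q ⟧ (λ f → χ m (e ⊹ f))) + ⟦ p ⟧ (λ e → ⟦ r ⟧ (λ f → χ m (e ⊹ f)))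
        ≈⟨ +-cong (⟦⟧-*ᵖ p q (χ m)) (⟦⟧-*ᵖ p r (χ m)) ⟨
      ⟦ p *ᵖ q ⟧ (χ m) + ⟦ p *ᵖ r ⟧ (χ m)
        ≈⟨ ⟦⟧-++ (p *ᵖ q) (p *ᵖ r) (χ m) ⟨
      ⟦ p *ᵖ q ++ p *ᵖ r ⟧ (χ m) ∎

    coeff-++ : ∀ p q m → coeff k n (p ++ q) m ≈ coeff k n p m + coeff k n q m
    coeff-++ p q m = trans (coeff≈⟦⟧ (p ++ q) m) (trans (⟦⟧-++ p q (χ m)) (sym (+-cong (coeff≈⟦⟧ p m) (coeff≈⟦⟧ q m))))

    coeff-neg : ∀ p m → coeff k n (-ᵖ p) m ≈ - coeff k n p m
    coeff-neg p m = trans (coeff≈⟦⟧ (-ᵖ p) m) (trans (⟦⟧-neg p (χ m)) (sym (-‿cong (coeff≈⟦⟧ p m))))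

    polynomialRing : CommutativeRing c ℓ
    polynomialRing = record
      { Carrier = S ; _≈_ = _≈ᵖ_ ; _+_ = _++_ ; _*_ = _*ᵖ_ ; -_ = -ᵖ_ ; 0# = [] ; 1# = X^ 0ᵉ
      ; isCommutativeRing = record
        { isRing = record
          { +-isAbelianGroup = record
            { isGroup = record
              { isMonoid = record
                { isSemigroup = record
                  { isMagma = record
                    { isEquivalence = record { refl = λ m → refl ; sym = λ h m → sym (h m) ; trans = λ h h′ m → trans (h m) (h′ m) }
                    ; ∙-cong = λ {p} {p′} {q} {q′} hp hq m → trans (coeff-++ p q m) (trans (+-cong (hp m) (hq m)) (sym (coeff-++ p′ q′ m)))
                    }
                  ; assoc = λ p q r m → trans (trans (coeff-++ (p ++ q) r m) (+-congʳ (coeff-++ p q m)))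
                      (trans (+-assoc _ _ _) (sym (trans (coeff-++ p (q ++ r) m) (+-congˡ (coeff-++ q r m)))))
                  }
                ; identity = (λ p m → refl) , (λ p m → trans (coeff-++ p [] m) (+-identityʳ _))
                }
              ; inverse = (λ p m → trans (coeff-++ (-ᵖ p) p m) (trans (+-congʳ (coeff-neg p m)) (-‿inverseˡ _)))
                        , (λ p m → trans (coeff-++ p (-ᵖ p) m) (trans (+-congˡ (coeff-neg p m)) (-‿inverseʳ _)))
              ; ⁻¹-cong = λ {p} {q} h m → trans (coeff-neg p m) (trans (-‿cong (h m)) (sym (coeff-neg q m)))
              }
            ; comm = λ p q m → trans (coeff-++ p q m) (trans (+-comm _ _) (sym (coeff-++ q p m)))
            }
          ; *-cong = λ {p} {p′} {q} {q′} → *ᵖ-cong {p} {p′} {q} {q′}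
          ; *-assoc = *ᵖ-assoc
          ; *-identity = *ᵖ-identityˡ , (λ p m → trans (*ᵖ-comm p (X^ 0ᵉ) m) (*ᵖ-identityˡ p m))
          ; distrib = *ᵖ-distribˡ , λ p q r m → trans (*ᵖ-comm (q ++ r) p m) (trans (*ᵖ-distribˡ p q r m)
              (trans (coeff-++ (p *ᵖ q) (p *ᵖ r) m) (trans (+-cong (*ᵖ-comm p q m) (*ᵖ-comm p r m)) (sym (coeff-++ (q *ᵖ p) (r *ᵖ p) m)))))
          }
        ; *-comm = *ᵖ-comm
        }
      }

    module R = CommutativeRing polynomialRing

    X^-* : ∀ e f → X^ e *ᵖ X^ f ≈ᵖ X^ (e ⊹ f)
    X^-* e f = toᵖ {X^ e *ᵖ X^ f} {X^ (e ⊹ f)} λ m → +-congʳ (*-congʳ (*-identityˡ 1#))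

    var : Fin n → S
    var j = X^ (raise j 0ᵉ)

    ⟦var*⟧ : ∀ j p φ → ⟦ var j *ᵖ p ⟧ φ ≈ ⟦ p ⟧ (φ ∘ raise j)
    ⟦var*⟧ j p φ = trans (⟦⟧-*ᵖ (var j) p φ) (trans (⟦X^⟧ (raise j 0ᵉ) (λ e → ⟦ p ⟧ (λ f → φ (e ⊹ f))))
      (⟦⟧-cong p (λ f → reflexive (≡.cong φ (unit⊹ j f)))))

    -- The part of p divisible by the j-th variable, divided by it.
    quotient : Fin n → S → S
    quotient j []            = []
    quotient j ((a , e) ∷ p) with lower j e
    ... | inj₁ (f , _) = (a , f) ∷ quotient j p
    ... | inj₂ _       = quotient j p

    -- The transpose of `quotient j` under the pairing. It reduces identities about `quotient j` to
    -- case distinctions on single exponents.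
    lowered : Fin n → (Exponent n → Carrier) → Exponent n → Carrier
    lowered j φ e with lower j e
    ... | inj₁ (f , _) = φ f
    ... | inj₂ _       = 0#

    ⟦quotient⟧ : ∀ j p φ → ⟦ quotient j p ⟧ φ ≈ ⟦ p ⟧ (lowered j φ)
    ⟦quotient⟧ j []            φ = refl
    ⟦quotient⟧ j ((a , e) ∷ p) φ with lower j e
    ... | inj₁ (f , _) = +-congˡ (⟦quotient⟧ j p φ)
    ... | inj₂ _       = trans (⟦quotient⟧ j p φ) (sym (trans (+-congʳ (zeroʳ a)) (+-identityˡ _)))

    lowered-raise : ∀ j φ e → lowered j φ (raise j e) ≈ φ e
    lowered-raise j φ e with lower j (raise j e)
    ... | inj₁ (f , h) = reflexive (≡.cong φ (≡.sym (raise-injective j h)))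
    ... | inj₂ h       = ⊥-elim (h e ≡.refl)

    lowered-raise′ : ∀ {i j} → i ≢ j → ∀ φ e → lowered j φ (raise i e) ≈ lowered j (φ ∘ raise i) e
    lowered-raise′ {i} {j} i≢j φ e with lower j (raise i e) | lower j e
    ... | inj₁ (f , h) | inj₁ (g , ≡.refl) = reflexive (≡.cong φ (raise-injective j (≡.trans (≡.sym h) (raise-comm i j g))))
    ... | inj₁ (f , h) | inj₂ h′           = ⊥-elim (h′ _ (proj₂ (raise-lower i≢j h)))
    ... | inj₂ h       | inj₁ (g , ≡.refl) = ⊥-elim (h (raise i g) (raise-comm i j g))
    ... | inj₂ h       | inj₂ h′           = refl

    lowered-χ : ∀ j m e → lowered j (χ m) e ≈ χ (raise j m) e
    lowered-χ j m e with lower j e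
    ... | inj₁ (f , ≡.refl) = χ-⇔ {m} {f} (≡.cong (raise j)) (raise-injective j)
    ... | inj₂ h            = reflexive (≡.sym (χ-≢ (h m)))

    coeff-quotient : ∀ j p m → coeff k n (quotient j p) m ≈ coeff k n p (raise j m)
    coeff-quotient j p m = trans (coeff≈⟦⟧ (quotient j p) m) (trans (⟦quotient⟧ j p (χ m))
      (trans (⟦⟧-cong p (lowered-χ j m)) (sym (coeff≈⟦⟧ p (raise j m)))))

    quotient-cong : ∀ j {p q} → p ≈ᵖ q → quotient j p ≈ᵖ quotient j q
    quotient-cong j {p} {q} h m = trans (coeff-quotient j p m) (trans (h (raise j m)) (sym (coeff-quotient j q m)))

    quotient-+ : ∀ j p q → quotient j (p ++ q) ≈ᵖ quotient j p ++ quotient j q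
    quotient-+ j p q m = trans (coeff-quotient j (p ++ q) m) (trans (coeff-++ p q (raise j m))
      (sym (trans (coeff-++ (quotient j p) (quotient j q) m) (+-cong (coeff-quotient j p m) (coeff-quotient j q m)))))

    quotient-var : ∀ j p → quotient j (var j *ᵖ p) ≈ᵖ p
    quotient-var j p = toᵖ {quotient j (var j *ᵖ p)} {p} λ m → trans (⟦quotient⟧ j (var j *ᵖ p) (χ m))
      (trans (⟦var*⟧ j p (lowered j (χ m))) (⟦⟧-cong p (lowered-raise j (χ m))))

    quotient-var′ : ∀ {i j} → i ≢ j → ∀ p → quotient j (var i *ᵖ p) ≈ᵖ var i *ᵖ quotient j p
    quotient-var′ {i} {j} i≢j p = toᵖ {quotient j (var i *ᵖ p)} {var i *ᵖ quotient j p} λ m → begin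
      ⟦ quotient j (var i *ᵖ p) ⟧ (χ m)         ≈⟨ trans (⟦quotient⟧ j (var i *ᵖ p) (χ m)) (⟦var*⟧ i p _) ⟩
      ⟦ p ⟧ (lowered j (χ m) ∘ raise i)         ≈⟨ ⟦⟧-cong p (lowered-raise′ i≢j (χ m)) ⟩
      ⟦ p ⟧ (lowered j (χ m ∘ raise i))         ≈⟨ ⟦quotient⟧ j p _ ⟨
      ⟦ quotient j p ⟧ (χ m ∘ raise i)          ≈⟨ ⟦var*⟧ i (quotient j p) (χ m) ⟨
      ⟦ var i *ᵖ quotient j p ⟧ (χ m)           ∎

    augmentation : FreeModules.Augmentation polynomialRing commutativeRing
    augmentation = record
      { ε = constTerm k n
      ; ε-cong = λ h → h 0ᵉ
      ; ε-+ = λ p q → coeff-++ p q 0ᵉ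
      ; ε-* = λ p q → begin
          coeff k n (p *ᵖ q) 0ᵉ
            ≈⟨ trans (coeff≈⟦⟧ (p *ᵖ q) 0ᵉ) (⟦⟧-*ᵖ p q (χ 0ᵉ)) ⟩
          ⟦ p ⟧ (λ e → ⟦ q ⟧ (λ f → χ 0ᵉ (e ⊹ f)))
            ≈⟨ ⟦⟧-cong p (λ e → trans (⟦⟧-cong q (χ-⊹ e)) (trans (⟦⟧-* q (χ 0ᵉ e) (χ 0ᵉ)) (*-comm _ _))) ⟩
          ⟦ p ⟧ (λ e → ⟦ q ⟧ (χ 0ᵉ) * χ 0ᵉ e)
            ≈⟨ trans (⟦⟧-* p _ (χ 0ᵉ)) (*-comm _ _) ⟩
          ⟦ p ⟧ (χ 0ᵉ) * ⟦ q ⟧ (χ 0ᵉ)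
            ≈⟨ *-cong (coeff≈⟦⟧ p 0ᵉ) (coeff≈⟦⟧ q 0ᵉ) ⟨
          coeff k n p 0ᵉ * coeff k n q 0ᵉ ∎
      ; ε-0 = refl
      ; ι = λ a → (a , 0ᵉ) ∷ []
      ; ι-cong = λ h → toᵖ {(_ , 0ᵉ) ∷ []} {(_ , 0ᵉ) ∷ []} λ m → +-congʳ (*-congʳ h)
      ; ι-+ = λ a b → toᵖ {(a + b , 0ᵉ) ∷ []} {(a , 0ᵉ) ∷ (b , 0ᵉ) ∷ []} λ m → trans (+-congʳ (distribʳ _ _ _)) (+-assoc _ _ _)
      ; ι-* = λ a b → toᵖ {(a * b , 0ᵉ) ∷ []} {(a * b , 0ᵉ ⊹ 0ᵉ) ∷ []} λ m →
          +-congʳ (*-congˡ (reflexive (≡.cong (χ m) (≡.sym (Vec.zipWith-identityˡ ℕ.+-identityˡ 0ᵉ)))))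
      ; ε∘ι = λ a → trans (coeff≈⟦⟧ ((a , 0ᵉ) ∷ []) 0ᵉ) (trans (+-identityʳ _)
          (trans (*-congˡ (reflexive (χ-≡ {0ᵉ} ≡.refl))) (*-identityʳ a)))
      }
      where
      -- Exponents are natural numbers, so a product of monomials is constant only if both factors
      -- are.
      χ-⊹ : ∀ e f → χ 0ᵉ (e ⊹ f) ≈ χ 0ᵉ e * χ 0ᵉ f
      χ-⊹ e f with Vec.≡-dec ℕ._≟_ e 0ᵉ
      ... | no e≢0 = trans (reflexive (χ-≢ (e≢0 ∘ proj₁ ∘ ⊹-zero e f))) (sym (zeroˡ _))
      ... | yes ≡.refl = trans (reflexive (≡.cong (χ 0ᵉ) (Vec.zipWith-identityˡ ℕ.+-identityˡ f))) (sym (*-identityˡ _))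

    constTerm-var : ∀ j → constTerm k n (var j) ≈ 0#
    constTerm-var j = trans (coeff≈⟦⟧ (var j) 0ᵉ) (trans (⟦X^⟧ (raise j 0ᵉ) (χ 0ᵉ)) (reflexive (χ-≢ (raise≢0 j))))
      where
      raise≢0 : ∀ {n} (j : Fin n) → raise j 0ᵉ ≢ 0ᵉ
      raise≢0 Fin.zero ()
      raise≢0 (Fin.suc j) h = raise≢0 j (Vec.∷-injectiveʳ h)

-- Products of ideals in disjoint variables and their resolutions

module MonomialIdealResolutions where

  open import Level using (Level; _⊔_)
  open import Algebra.Bundles using (CommutativeRing)
  open import Data.Nat as ℕ using (ℕ; zero; suc; _≤_)
  import Data.Nat.Properties as ℕ
  open import Data.Fin as Fin using (Fin)
  open import Data.Vec using ([]; _∷_)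
  open import Data.List as List using (List; []; _∷_; length; map)
  open import Data.List.Membership.Propositional using (_∈_; _∉_)
  open import Data.List.Relation.Unary.Any using (here; there; _─_)
  open import Data.List.Relation.Unary.All as All using (All; []; _∷_)
  open import Data.List.Relation.Unary.All.Properties using (All¬⇒¬Any)
  open import Data.List.Relation.Unary.AllPairs using (AllPairs; []; _∷_)
  open import Data.List.Relation.Unary.Unique.Propositional using (Unique)
  open import Data.List.Relation.Binary.Disjoint.Propositional using (Disjoint)
  open import Data.Product using (Σ; ∃; _×_; _,_)
  open import Function using (_∘_)
  open import Relation.Binary.PropositionalEquality as ≡ using (_≡_; _≢_)
  import Data.Nat.Tactic.RingSolver as ℕ-Ring
  import Algebra.Properties.Ring
  import Algebra.Properties.CommutativeSemigroup
  import Relation.Binary.Reasoning.Setoid as SetoidReasoning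
  open FreeResolutions
  open MappingCones
  open Polynomials

  exponent : ∀ {n} → List (Fin n) → Exponent n
  exponent []       = 0ᵉ
  exponent (x ∷ xs) = raise x (exponent xs)

  delayed : (ℕ → ℕ) → ℕ → ℕ
  delayed b zero    = 0
  delayed b (suc i) = b i

  -- The coefficient of tⁱ in the product of the factors n + (n - 1) t.
  bettiPoly : List ℕ → ℕ → ℕ
  bettiPoly []       zero    = 1
  bettiPoly []       (suc i) = 0
  bettiPoly (n ∷ ns) i       = n ℕ.* bettiPoly ns i ℕ.+ (n ℕ.∸ 1) ℕ.* delayed (bettiPoly ns) i

  -- With `D` the edges on no cycle and `Cs` the cycles, these will be the exponents of the facet
  -- monomials: one element is dropped from each cycle.
  Generates : ∀ {n} → List (Fin n) → List (List (Fin n)) → Exponent n → Set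
  Generates D []       e = e ≡ exponent D
  Generates D (C ∷ Cs) e = ∃ λ c → Σ (c ∈ C) λ i → ∃ λ e′ → Generates D Cs e′ × e ≡ exponent (C ─ i) ⊹ e′

  Separated : ∀ {n} → List (Fin n) → List (List (Fin n)) → Set
  Separated D Cs = All (λ C → 1 ≤ length C) Cs × All Unique Cs × AllPairs Disjoint (D ∷ Cs)

  separated-tail : ∀ {n} {D C : List (Fin n)} {Cs} → Separated D (C ∷ Cs) → Separated D Cs
  separated-tail ((_ ∷ sizes) , (_ ∷ uniques) , ((_ ∷ D#Cs) ∷ _ ∷ disjoint)) = sizes , uniques , D#Cs ∷ disjoint

  -- What the construction uses of a polynomial ring. The operator `quotient j` takes the part
  -- divisible by the variable `j` and divides it; it gives both cancellation of variables and the
  -- description of syzygies.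
  record Variables {c ℓ} (R : CommutativeRing c ℓ) (n : ℕ) : Set (c ⊔ ℓ) where
    open CommutativeRing R
    field
      X^            : Exponent n → Carrier
      X^-0          : X^ 0ᵉ ≈ 1#
      X^-⊹          : ∀ e f → X^ (e ⊹ f) ≈ X^ e * X^ f
      quotient      : Fin n → Carrier → Carrier
      quotient-cong : ∀ j {p q} → p ≈ q → quotient j p ≈ quotient j q
      quotient-+    : ∀ j p q → quotient j (p + q) ≈ quotient j p + quotient j q
    var : Fin n → Carrier
    var j = X^ (raise j 0ᵉ)
    field
      quotient-var  : ∀ j p → quotient j (var j * p) ≈ p
      quotient-var′ : ∀ {i j} → i ≢ j → ∀ p → quotient j (var i * p) ≈ var i * quotient j p

  module MonomialIdeals {c ℓ} (R : CommutativeRing c ℓ) (n : ℕ) (𝕍 : Variables R n) where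
    open CommutativeRing R hiding (zero)
    open Variables 𝕍
    open FreeModules R
    open Algebra.Properties.Ring ring using (-‿distribʳ-*)
    open Algebra.Properties.CommutativeSemigroup +-commutativeSemigroup using (interchange)
    open Algebra.Properties.CommutativeSemigroup *-commutativeSemigroup using (x∙yz≈y∙xz)
    open SetoidReasoning setoid
    open Cone R using (cone; cone-minimal; x-y≈0⇒x≈y; x+y≈0⇒x≈-y)

    record IsIdeal {t} (T : Carrier → Set t) : Set (c ⊔ ℓ ⊔ t) where
      field
        resp  : ∀ {g h} → g ≈ h → T g → T h
        0∈    : T 0#
        +∈    : ∀ {g h} → T g → T h → T (g + h)
        *∈    : ∀ r {g} → T g → T (r * g)

    open IsIdeal

    -- The colon ideal. Passing to it absorbs a factor already split off a monomial, which is what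
    -- lets inclusions be proved by induction on the list of variables.
    _∶_ : ∀ {t} {T : Carrier → Set t} → IsIdeal T → ∀ r → IsIdeal (λ g → T (r * g))
    (T ∶ r) .resp g≈h = T .resp (*-congˡ g≈h)
    (T ∶ r) .0∈ = T .resp (sym (zeroʳ r)) (T .0∈)
    (T ∶ r) .+∈ Tg Th = T .resp (sym (distribˡ r _ _)) (T .+∈ Tg Th)
    (T ∶ r) .*∈ s Tg = T .resp (x∙yz≈y∙xz s r _) (T .*∈ s Tg)

    prod : List (Fin n) → Carrier
    prod []       = 1#
    prod (x ∷ xs) = var x * prod xs

    X^-exponent : ∀ xs → X^ (exponent xs) ≈ prod xs
    X^-exponent []       = X^-0
    X^-exponent (x ∷ xs) = trans (reflexive (≡.cong X^ (≡.sym (unit⊹ x (exponent xs)))))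
      (trans (X^-⊹ _ _) (*-congˡ (X^-exponent xs)))

    quotient-0 : ∀ j → quotient j 0# ≈ 0#
    quotient-0 j = trans (quotient-cong j (sym (zeroʳ (var j)))) (quotient-var j 0#)

    var-cancel : ∀ j a → var j * a ≈ 0# → a ≈ 0#
    var-cancel j a h = trans (sym (quotient-var j a)) (trans (quotient-cong j h) (quotient-0 j))

    prod-cancel : ∀ xs a → prod xs * a ≈ 0# → a ≈ 0#
    prod-cancel []       a h = trans (sym (*-identityˡ a)) h
    prod-cancel (x ∷ xs) a h = prod-cancel xs a (var-cancel x _ (trans (sym (*-assoc _ _ _)) h))

    quotient-prod : ∀ {z} xs → z ∉ xs → ∀ p → quotient z (prod xs * p) ≈ prod xs * quotient z p
    quotient-prod {z} [] z∉ p = trans (quotient-cong z (*-identityˡ p)) (sym (*-identityˡ _))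
    quotient-prod {z} (x ∷ xs) z∉ p = begin
      quotient z (var x * prod xs * p)       ≈⟨ quotient-cong z (*-assoc _ _ _) ⟩
      quotient z (var x * (prod xs * p))     ≈⟨ quotient-var′ (λ x≡z → z∉ (here (≡.sym x≡z))) _ ⟩
      var x * quotient z (prod xs * p)       ≈⟨ *-congˡ (quotient-prod xs (z∉ ∘ there) p) ⟩
      var x * (prod xs * quotient z p)       ≈⟨ *-assoc _ _ _ ⟨
      var x * prod xs * quotient z p         ∎

    Principal : List (Fin n) → Carrier → Set (c ⊔ ℓ)
    Principal D g = ∃ λ p → prod D * p ≈ g

    -- Omit J C is the product of J with the ideal generated by the prod (C ∖ x), x ∈ C.
    Omit : (Carrier → Set (c ⊔ ℓ)) → List (Fin n) → Carrier → Set (c ⊔ ℓ)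
    Omit J []       g = Level.Lift (c ⊔ ℓ) (g ≈ 0#)
    Omit J (y ∷ xs) g = ∃ λ a → ∃ λ b → Omit J xs a × J b × var y * a + prod xs * b ≈ g

    ⟨_∣_⟩ : List (Fin n) → List (List (Fin n)) → Carrier → Set (c ⊔ ℓ)
    ⟨ D ∣ [] ⟩     = Principal D
    ⟨ D ∣ C ∷ Cs ⟩ = Omit ⟨ D ∣ Cs ⟩ C

    principal-isIdeal : ∀ D → IsIdeal (Principal D)
    principal-isIdeal D .resp g≈h (p , e) = p , trans e g≈h
    principal-isIdeal D .0∈ = 0# , zeroʳ _
    principal-isIdeal D .+∈ (p , e) (q , f) = p + q , trans (distribˡ _ _ _) (+-cong e f)
    principal-isIdeal D .*∈ r (p , e) = r * p , trans (x∙yz≈y∙xz _ _ _) (*-congˡ e)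

    omit-isIdeal : ∀ {J} → IsIdeal J → ∀ C → IsIdeal (Omit J C)
    omit-isIdeal J []       .resp g≈h (Level.lift e) = Level.lift (trans (sym g≈h) e)
    omit-isIdeal J []       .0∈ = Level.lift refl
    omit-isIdeal J []       .+∈ (Level.lift e) (Level.lift f) = Level.lift (trans (+-cong e f) (+-identityˡ 0#))
    omit-isIdeal J []       .*∈ r (Level.lift e) = Level.lift (trans (*-congˡ e) (zeroʳ r))
    omit-isIdeal J (y ∷ xs) .resp g≈h (a , b , Oa , Jb , e) = a , b , Oa , Jb , trans e g≈h
    omit-isIdeal J (y ∷ xs) .0∈ =
      0# , 0# , omit-isIdeal J xs .0∈ , J .0∈ , trans (+-cong (zeroʳ _) (zeroʳ _)) (+-identityˡ 0#)
    omit-isIdeal J (y ∷ xs) .+∈ (a , b , Oa , Jb , e) (a′ , b′ , Oa′ , Jb′ , e′) =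
      a + a′ , b + b′ , omit-isIdeal J xs .+∈ Oa Oa′ , J .+∈ Jb Jb′ ,
      trans (+-cong (distribˡ _ _ _) (distribˡ _ _ _)) (trans (interchange _ _ _ _) (+-cong e e′))
    omit-isIdeal J (y ∷ xs) .*∈ r (a , b , Oa , Jb , e) =
      r * a , r * b , omit-isIdeal J xs .*∈ r Oa , J .*∈ r Jb ,
      trans (+-cong (x∙yz≈y∙xz _ _ _) (x∙yz≈y∙xz _ _ _)) (trans (sym (distribˡ _ _ _)) (*-congˡ e))

    isIdeal : ∀ D Cs → IsIdeal ⟨ D ∣ Cs ⟩
    isIdeal D []       = principal-isIdeal D
    isIdeal D (C ∷ Cs) = omit-isIdeal (isIdeal D Cs) C

    -- For an ideal this implies that `var z` is a nonzerodivisor modulo `J`, since dividing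
    -- `var z * g` returns `g`. It holds for the ideals built here when `z` occurs in none of the
    -- lists.
    QuotientClosed : (Carrier → Set (c ⊔ ℓ)) → Fin n → Set (c ⊔ ℓ)
    QuotientClosed J z = ∀ g → J g → J (quotient z g)

    omit-quotientClosed : ∀ {J z} → QuotientClosed J z → ∀ C → z ∉ C → QuotientClosed (Omit J C) z
    omit-quotientClosed h [] z∉ g (Level.lift e) = Level.lift (trans (quotient-cong _ e) (quotient-0 _))
    omit-quotientClosed {z = z} h (y ∷ xs) z∉ g (a , b , Oa , Jb , e) =
      quotient z a , quotient z b , omit-quotientClosed h xs (z∉ ∘ there) a Oa , h b Jb ,
      trans (+-cong (sym (quotient-var′ (λ y≡z → z∉ (here (≡.sym y≡z))) a)) (sym (quotient-prod xs (z∉ ∘ there) b)))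
        (trans (sym (quotient-+ z _ _)) (quotient-cong z e))

    quotientClosed : ∀ {z} D Cs → z ∉ D → All (z ∉_) Cs → QuotientClosed ⟨ D ∣ Cs ⟩ z
    quotientClosed {z} D [] z∉D [] g (p , e) =
      quotient z p , trans (sym (quotient-prod D z∉D p)) (quotient-cong z e)
    quotientClosed D (C ∷ Cs) z∉D (z∉C ∷ z∉Cs) = omit-quotientClosed (quotientClosed D Cs z∉D z∉Cs) C z∉C

    prod*J⊆Omit : ∀ {J} → IsIdeal J → ∀ x xs b → J b → Omit J (x ∷ xs) (prod xs * b)
    prod*J⊆Omit J x xs b Jb = 0# , b , omit-isIdeal J xs .0∈ , Jb , trans (+-congʳ (zeroʳ _)) (+-identityˡ _)

    omit-∋ : ∀ {J} → IsIdeal J → ∀ {C c} (i : c ∈ C) b → J b → Omit J C (prod (C ─ i) * b)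
    omit-∋ J {C = x ∷ xs} (here _)  b Jb = prod*J⊆Omit J x xs b Jb
    omit-∋ J {C = x ∷ xs} (there i) b Jb =
      prod (xs ─ i) * b , 0# , omit-∋ J i b Jb , J .0∈ ,
      trans (+-cong (sym (*-assoc _ _ _)) (zeroʳ _)) (+-identityʳ _)

    omit-⊆ : ∀ {t J} {T : Carrier → Set t} → IsIdeal T → ∀ C →
             (∀ {c} (i : c ∈ C) b → J b → T (prod (C ─ i) * b)) → ∀ g → Omit J C g → T g
    omit-⊆ T []       h g (Level.lift e) = T .resp (sym e) (T .0∈)
    omit-⊆ T (y ∷ xs) h g (a , b , Oa , Jb , e) = T .resp e (T .+∈
      (omit-⊆ (T ∶ var y) xs (λ i b Jb → T .resp (*-assoc _ _ _) (h (there i) b Jb)) a Oa) (h (here ≡.refl) b Jb))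

    generates-∋ : ∀ D Cs e → Generates D Cs e → ⟨ D ∣ Cs ⟩ (X^ e)
    generates-∋ D []       e ≡.refl = 1# , trans (*-identityʳ _) (sym (X^-exponent D))
    generates-∋ D (C ∷ Cs) e (c , i , e′ , gen , ≡.refl) = isIdeal D (C ∷ Cs) .resp
      (trans (*-congʳ (sym (X^-exponent (C ─ i)))) (sym (X^-⊹ _ _)))
      (omit-∋ (isIdeal D Cs) i (X^ e′) (generates-∋ D Cs e′ gen))

    generates-⊆ : ∀ {t} {T : Carrier → Set t} → IsIdeal T → ∀ D Cs →
                  (∀ e → Generates D Cs e → T (X^ e)) → ∀ g → ⟨ D ∣ Cs ⟩ g → T g
    generates-⊆ T D []       h g (p , e) =
      T .resp (trans (*-comm _ _) (trans (*-congʳ (X^-exponent D)) e)) (T .*∈ p (h _ ≡.refl))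
    generates-⊆ T D (C ∷ Cs) h = omit-⊆ T C λ i → generates-⊆ (T ∶ prod (C ─ i)) D Cs λ e′ gen →
      T .resp (trans (X^-⊹ _ _) (*-congʳ (X^-exponent (C ─ i)))) (h _ (_ , i , e′ , gen , ≡.refl))

    transport : ∀ {I J : Carrier → Set (c ⊔ ℓ)} → (∀ g → I g → J g) → (∀ g → J g → I g) → Resolution I → Resolution J
    transport to from F = record
      { β = β ; ∂ = ∂ ; ∂∂ = ∂∂ ; exact = exact ; ∂₀∈ = λ v → to _ (∂₀∈ v) ; onto = λ g Jg → onto g (from g Jg) }
      where open Resolution F

    module _ {J : Carrier → Set (c ⊔ ℓ)} (J-ideal : IsIdeal J) where

      omit-single : ∀ y g → Omit J (y ∷ []) g → J g
      omit-single y g (a , b , Level.lift a≈0 , Jb , e) = J-ideal .resp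
        (trans (sym (trans (+-cong (trans (*-congˡ a≈0) (zeroʳ _)) (*-identityˡ b)) (+-identityˡ b))) e) Jb

      single-omit : ∀ y g → J g → Omit J (y ∷ []) g
      single-omit y g Jg = omit-isIdeal J-ideal (y ∷ []) .resp (*-identityˡ g) (prod*J⊆Omit J-ideal y [] g Jg)

      -- Division by `y` commutes with `prod xs`, in which `y` does not occur. As `prod xs * b` is a
      -- multiple of `var y`, it equals `prod xs * (var y * quotient y b)`, and `prod xs` cancels.
      syzygy : ∀ y xs → y ∉ xs → QuotientClosed J y → ∀ a b → J b → var y * a + prod xs * b ≈ 0# → ∃ λ g → J g × var y * g ≈ b
      syzygy y xs y∉ closed a b Jb h = quotient y b , closed b Jb , sym (x-y≈0⇒x≈y (prod-cancel xs _ (begin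
          w * (b + - (var y * quotient y b))            ≈⟨ distribˡ _ _ _ ⟩
          w * b + w * - (var y * quotient y b)          ≈⟨ +-congˡ (-‿distribʳ-* _ _) ⟨
          w * b + - (w * (var y * quotient y b))        ≈⟨ +-congˡ (-‿cong (x∙yz≈y∙xz _ _ _)) ⟩
          w * b + - (var y * (w * quotient y b))        ≈⟨ +-congˡ (-‿cong (*-congˡ (quotient-prod xs y∉ b))) ⟨
          w * b + - (var y * quotient y (w * b))        ≈⟨ +-congˡ (-‿cong (*-congˡ (quotient-cong y wb≈y[-a]))) ⟩
          w * b + - (var y * quotient y (var y * - a))  ≈⟨ +-congˡ (-‿cong (*-congˡ (quotient-var y (- a)))) ⟩
          w * b + - (var y * - a)                       ≈⟨ +-congʳ wb≈y[-a] ⟩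
          var y * - a + - (var y * - a)                 ≈⟨ -‿inverseʳ _ ⟩
          0# ∎)))
        where
        w : Carrier
        w = prod xs
        wb≈y[-a] : w * b ≈ var y * - a
        wb≈y[-a] = trans (x+y≈0⇒x≈-y (trans (+-comm _ _) h)) (-‿distribʳ-* _ _)

      -- In `prod (x ∷ xs)` the factor `var x` is kept apart from the lifted one: `prod xs * J`
      -- already lies in `Omit J (x ∷ xs)`, and the factor left over secures minimality.
      omitResolution : ∀ y xs → Unique (y ∷ xs) → All (QuotientClosed J) (y ∷ xs) → Resolution J → Resolution (Omit J (y ∷ xs))
      omitResolution y []       _                _                F = transport (single-omit y) (omit-single y) F
      omitResolution y (x ∷ xs) (y≢ ∷ unique) (closed ∷ closeds) F =
        cone (omitResolution x xs unique closeds F) F (var x) (var y) (prod xs)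
          (prod*J⊆Omit J-ideal x xs) (λ a b Oa Jb → a , b , Oa , Jb , refl) (λ g Og → Og)
          (var-cancel y) (λ a b _ → syzygy y (x ∷ xs) (All¬⇒¬Any y≢) closed a b)

      -- Each element of the list beyond the first contributes, through the cone, one copy of the
      -- resolution of `J` and one shifted copy.
      betti-omit : ∀ y xs unique closed (F : Resolution J) i →
        size (Resolution.β (omitResolution y xs unique closed F) i) ≡
        suc (length xs) ℕ.* size (Resolution.β F i) ℕ.+ length xs ℕ.* delayed (λ i → size (Resolution.β F i)) i
      betti-omit y [] unique closed F i =
        ≡.sym (≡.trans (ℕ.+-identityʳ _) (ℕ.+-identityʳ _))
      betti-omit y (x ∷ xs) (y≢ ∷ unique) (_ ∷ closeds) F ℕ.zero
        rewrite betti-omit x xs unique closeds F 0 = lemma (length xs) (size (Resolution.β F 0))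
        where
        lemma : ∀ l b → (suc l ℕ.* b ℕ.+ l ℕ.* 0) ℕ.+ b ≡ suc (suc l) ℕ.* b ℕ.+ suc l ℕ.* 0
        lemma = ℕ-Ring.solve-∀
      betti-omit y (x ∷ xs) (y≢ ∷ unique) (_ ∷ closeds) F (suc i)
        rewrite betti-omit x xs unique closeds F (suc i) = lemma (length xs) (size (Resolution.β F (suc i))) (size (Resolution.β F i))
        where
        lemma : ∀ l b b′ → (suc l ℕ.* b ℕ.+ l ℕ.* b′) ℕ.+ (b ℕ.+ b′) ≡ suc (suc l) ℕ.* b ℕ.+ suc l ℕ.* b′
        lemma = ℕ-Ring.solve-∀

    principalResolution : ∀ D → Resolution (Principal D)
    principalResolution D = record
      { β = β ; ∂ = ∂ ; ∂∂ = ∂∂ ; exact = exact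
      ; ∂₀∈ = λ v → v Fin.zero , refl
      ; onto = λ { g (p , e) → (λ _ → p) , e }
      }
      where
      β : ℕ → Shape
      β ℕ.zero  = fin 1
      β (suc i) = fin 0
      ∂ : ∀ i → Linear (Augmented (Principal D) β (suc i)) (Augmented (Principal D) β i)
      ∂ ℕ.zero  = scale (prod D)
      ∂ (suc i) = zeroₗ
      ∂∂ : ∀ i v → ∂ i · (∂ (suc i) · v) ≋ 𝟎
      ∂∂ ℕ.zero  v x = zeroʳ _
      ∂∂ (suc i) v x = refl
      exact : ∀ i v → ∂ i · v ≋ 𝟎 → ∃ λ w → ∂ (suc i) · w ≋ v
      exact ℕ.zero  v h = (λ ()) , λ x → sym (prod-cancel D (v x) (h x))
      exact (suc i) v h = (λ ()) , λ ()

    separated-closed : ∀ {D C Cs} → Separated D (C ∷ Cs) → All (QuotientClosed ⟨ D ∣ Cs ⟩) C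
    separated-closed {D} {C} {Cs} (_ , _ , ((D#C ∷ D#Cs) ∷ C#Cs ∷ _)) = All.tabulate λ {z} z∈C →
      quotientClosed D Cs (λ z∈D → D#C (z∈D , z∈C)) (All.map (λ C#C′ z∈C′ → C#C′ (z∈C , z∈C′)) C#Cs)

    resolution : ∀ D Cs → Separated D Cs → Resolution ⟨ D ∣ Cs ⟩
    resolution D []              sep = principalResolution D
    resolution D ((y ∷ xs) ∷ Cs) sep@(_ , (unique ∷ _) , _) =
      omitResolution (isIdeal D Cs) y xs unique (separated-closed sep) (resolution D Cs (separated-tail sep))
    resolution D ([] ∷ Cs) ((() ∷ _) , _)

    betti-resolution : ∀ D Cs sep i → size (Resolution.β (resolution D Cs sep) i) ≡ bettiPoly (map length Cs) i
    betti-resolution D []              sep ℕ.zero  = ≡.refl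
    betti-resolution D []              sep (suc i) = ≡.refl
    betti-resolution D ((y ∷ xs) ∷ Cs) sep@(_ , (unique ∷ _) , _) i =
      ≡.trans (betti-omit (isIdeal D Cs) y xs unique (separated-closed sep) F i)
        (≡.cong₂ (λ b b′ → suc (length xs) ℕ.* b ℕ.+ length xs ℕ.* b′) (IH i) (delayed-cong i))
      where
      F : Resolution ⟨ D ∣ Cs ⟩
      F = resolution D Cs (separated-tail sep)
      IH : ∀ i → size (Resolution.β F i) ≡ bettiPoly (map length Cs) i
      IH = betti-resolution D Cs (separated-tail sep)
      delayed-cong : ∀ i → delayed (λ i → size (Resolution.β F i)) i ≡ delayed (bettiPoly (map length Cs)) i
      delayed-cong ℕ.zero  = ≡.refl
      delayed-cong (suc i) = IH i
    betti-resolution D ([] ∷ Cs) ((() ∷ _) , _)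

    module _ {κ ℓ′} {K : CommutativeRing κ ℓ′} (𝔸 : Augmentation K)
             (ε-var : ∀ j → CommutativeRing._≈_ K (Augmentation.ε 𝔸 (var j)) (CommutativeRing.0# K)) where
      open Residue 𝔸

      resolution-minimal : ∀ D Cs sep → Minimal (resolution D Cs sep)
      resolution-minimal D []              sep i v x = Augmentation.ε-0 𝔸
      resolution-minimal D ((y ∷ xs) ∷ Cs) sep@(_ , (unique ∷ _) , _) =
        omit-minimal y xs unique (separated-closed sep)
        where
        F : Resolution ⟨ D ∣ Cs ⟩
        F = resolution D Cs (separated-tail sep)
        omit-minimal : ∀ y xs unique closed → Minimal (omitResolution (isIdeal D Cs) y xs unique closed F)
        omit-minimal y []       _ _ = resolution-minimal D Cs (separated-tail sep)
        omit-minimal y (x ∷ xs) (_ ∷ unique) (_ ∷ closeds) = cone-minimal _ F (var x) (var y) (prod xs)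
          _ _ _ _ _ 𝔸 (ε-var x) (ε-var y) (omit-minimal x xs unique closeds) (resolution-minimal D Cs (separated-tail sep))
      resolution-minimal D ([] ∷ Cs) ((() ∷ _) , _)

-- From minimal resolutions of facet ideals to Betti polynomials

module FacetIdealBetti where

  open import Level using (_⊔_)
  open import Data.Bool using (if_then_else_)
  open import Data.Nat as ℕ using (ℕ; zero; suc)
  open import Data.Fin as Fin using (Fin)
  open import Data.Fin.Subset using (Subset)
  open import Data.Vec as Vec using (Vec; []; _∷_)
  open import Data.List as List using (List; []; _∷_; _++_; length; map)
  open import Data.List.Relation.Unary.All as All using (All; []; _∷_)
  import Data.List.Relation.Unary.All.Properties as All
  open import Data.Product using (∃; _×_; _,_; proj₁; proj₂)
  open import Relation.Binary.PropositionalEquality as ≡ using (_≡_)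
  open FreeResolutions
  open BettiUniqueness
  open Polynomials
  open MonomialIdealResolutions

  indicator : ∀ {n} → Subset n → Exponent n
  indicator = Vec.map (λ b → if b then 1 else 0)

  module FacetResolution {c ℓ} (k : Field c ℓ) (G : Graph) where
    open PolynomialRing k (E G)

    polynomialVariables : Variables polynomialRing (E G)
    polynomialVariables = record
      { X^            = X^
      ; X^-0          = ≈ᵖ-refl {X^ 0ᵉ}
      ; X^-⊹          = λ e f m → R.sym {X^ e *ᵖ X^ f} {X^ (e ⊹ f)} (X^-* e f) m
      ; quotient      = quotient
      ; quotient-cong = λ j {p} {q} → quotient-cong j {p} {q}
      ; quotient-+    = quotient-+
      ; quotient-var  = quotient-var
      ; quotient-var′ = quotient-var′
      }

    open FreeModules polynomialRing
    open Residue augmentation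
    open MonomialIdeals polynomialRing (E G) polynomialVariables
    private module k = Field k

    sumP≡∑ : ∀ {b} (f : Fin b → S) → sumP k (E G) f ≡ ∑ (fin b) f
    sumP≡∑ {zero}  f = ≡.refl
    sumP≡∑ {suc b} f = ≡.cong (f Fin.zero ++_) (sumP≡∑ (λ i → f (Fin.suc i)))

    combination : List (S × EdgeSet G) → S
    combination L = List.foldr _++_ [] (map (λ t → proj₁ t *ᵖ monomial k (E G) (proj₂ t)) L)

    combination-++ : ∀ L L′ → combination L R.+ combination L′ ≈ᵖ combination (L ++ L′)
    combination-++ []      L′ m = k.refl
    combination-++ (t ∷ L) L′ m = R.trans {combination (t ∷ L) R.+ combination L′} {h R.+ (combination L R.+ combination L′)} {h R.+ combination (L ++ L′)}
      (R.+-assoc h (combination L) (combination L′))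
      (R.+-congˡ {h} {combination L R.+ combination L′} {combination (L ++ L′)} (combination-++ L L′)) m
      where
      h : S
      h = proj₁ t *ᵖ monomial k (E G) (proj₂ t)

    combination-* : ∀ r L → r *ᵖ combination L ≈ᵖ combination (map (λ t → r *ᵖ proj₁ t , proj₂ t) L)
    combination-* r []      = R.zeroʳ r
    combination-* r (t ∷ L) m = R.trans {r *ᵖ (h R.+ combination L)} {r *ᵖ h R.+ r *ᵖ combination L} {r *ᵖ proj₁ t *ᵖ x R.+ combination L′}
      (R.distribˡ r h (combination L))
      (R.+-cong {r *ᵖ h} {r *ᵖ proj₁ t *ᵖ x} {r *ᵖ combination L} {combination L′}
        (R.sym {r *ᵖ proj₁ t *ᵖ x} {r *ᵖ h} (R.*-assoc r (proj₁ t) x)) (combination-* r L)) m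
      where
      x h : S
      x = monomial k (E G) (proj₂ t)
      h = proj₁ t *ᵖ x
      L′ : List (S × EdgeSet G)
      L′ = map (λ t → r *ᵖ proj₁ t , proj₂ t) L

    facetIdeal-isIdeal : IsIdeal (FacetIdeal k G)
    facetIdeal-isIdeal = record
      { resp = λ { g≈h (L , bases , e) → L , bases , λ m → k.trans (k.sym (g≈h m)) (e m) }
      ; 0∈   = [] , [] , λ m → k.refl
      ; +∈   = λ { {g} {h} (L , bases , e) (L′ , bases′ , e′) → L ++ L′ , All.++⁺ bases bases′ ,
                 R.trans {g R.+ h} {combination L R.+ combination L′} {combination (L ++ L′)}
                   (R.+-cong {g} {combination L} {h} {combination L′} e e′) (combination-++ L L′) }
      ; *∈   = λ { r {g} (L , bases , e) → map (λ t → r *ᵖ proj₁ t , proj₂ t) L , All.map⁺ bases ,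
                 R.trans {r *ᵖ g} {r *ᵖ combination L} {combination (map (λ t → r *ᵖ proj₁ t , proj₂ t) L)}
                   (*ᵖ-congˡ r {g} {combination L} e) (combination-* r L) }
      }

    basis∈facetIdeal : ∀ σ → Basis G σ → FacetIdeal k G (X^ (indicator σ))
    basis∈facetIdeal σ basis = (X^ 0ᵉ , σ) ∷ [] , basis ∷ [] ,
      R.sym {X^ 0ᵉ *ᵖ x R.+ R.0#} {x} (R.trans {X^ 0ᵉ *ᵖ x R.+ R.0#} {X^ 0ᵉ *ᵖ x} {x} (R.+-identityʳ (X^ 0ᵉ *ᵖ x)) (R.*-identityˡ x))
      where
      x : S
      x = X^ (indicator σ)

    facetIdeal-⊆ : ∀ {t} {T : S → Set t} → IsIdeal T → (∀ σ → Basis G σ → T (X^ (indicator σ))) →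
                   ∀ g → FacetIdeal k G g → T g
    facetIdeal-⊆ {T = T} T-ideal h g (L , bases , e) = resp {combination L} {g} (R.sym {g} {combination L} e) (go L bases)
      where
      open IsIdeal T-ideal
      go : ∀ L → All (λ t → Basis G (proj₂ t)) L → T (combination L)
      go []            []              = 0∈
      go ((p , σ) ∷ L) (basis ∷ bases) = +∈ (*∈ p (h σ basis)) (go L bases)

    module _ {I : S → Set (c ⊔ ℓ)} (I-ideal : IsIdeal I) (M : MinimalFreeResolution k (E G) I) where
      open MinimalFreeResolution M
      open IsIdeal I-ideal

      private
        ∑∈I : ∀ {b} (v : Fin b → S) (g : Fin b → S) → (∀ j → I (g j)) → I (∑ (fin b) (λ j → v j *ᵖ g j))
        ∑∈I {zero}  v g h = 0∈
        ∑∈I {suc b} v g h = +∈ (*∈ (v Fin.zero) (h Fin.zero)) (∑∈I (λ j → v (Fin.suc j)) (λ j → g (Fin.suc j)) (λ j → h (Fin.suc j)))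

        γ : ℕ → Shape
        γ i = fin (β i)

        -- The generators `ε` become the differential `∂ 0`, so that `exact₀` and `exact` are
        -- instances of a single exactness condition.
        ∂ : ∀ i → Linear (Augmented I γ (suc i)) (Augmented I γ i)
        ∂ zero    = extend (λ j _ → ε j)
        ∂ (suc i) = extend (λ j r → d i r j)

        apply≈∂ : ∀ i v → _≈V_ k (E G) (apply k (E G) (d i) v) (∂ (suc i) · v)
        apply≈∂ i v r m = k.trans (k.reflexive (≡.cong (λ p → coeff k (E G) p m) (sumP≡∑ (λ j → d i r j *ᵖ v j))))
          (∑-cong (fin (β (suc i))) {λ j → d i r j *ᵖ v j} {λ j → v j *ᵖ d i r j} (λ j → R.*-comm (d i r j) (v j)) m)

        ε≈∂₀ : ∀ v → sumP k (E G) (λ j → v j *ᵖ ε j) ≈ᵖ (∂ 0 · v) Fin.zero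
        ε≈∂₀ v m = k.reflexive (≡.cong (λ p → coeff k (E G) p m) (sumP≡∑ (λ j → v j *ᵖ ε j)))

        ∂∂ : ∀ i v → ∂ i · (∂ (suc i) · v) ≋ 𝟎
        ∂∂ zero v Fin.zero m = k.trans (k.sym (ε≈∂₀ (∂ 1 · v) m)) (proj₂ (exact₀ (∂ 1 · v)) (v , apply≈∂ 0 v) m)
        ∂∂ (suc i) v r m = k.trans (k.sym (apply≈∂ i (∂ (2 ℕ.+ i) · v) r m))
          (proj₂ (exact i (∂ (2 ℕ.+ i) · v)) (v , apply≈∂ (suc i) v) r m)

        ∂-exact : ∀ i v → ∂ i · v ≋ 𝟎 → ∃ λ w → ∂ (suc i) · w ≋ v
        ∂-exact zero v h with proj₁ (exact₀ v) (λ m → k.trans (ε≈∂₀ v m) (h Fin.zero m))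
        ... | w , e = w , λ r m → k.trans (k.sym (apply≈∂ 0 w r m)) (e r m)
        ∂-exact (suc i) v h with proj₁ (exact i v) (λ r m → k.trans (apply≈∂ i v r m) (h r m))
        ... | w , e = w , λ r m → k.trans (k.sym (apply≈∂ (suc i) w r m)) (e r m)

      fromMinimalFreeResolution : Resolution I
      fromMinimalFreeResolution = record
        { β = γ ; ∂ = ∂ ; ∂∂ = ∂∂ ; exact = ∂-exact
        ; ∂₀∈ = λ v → ∑∈I v ε ε∈I
        ; onto = λ g Ig → proj₁ (ε-onto g Ig) , λ m → k.trans (k.sym (ε≈∂₀ (proj₁ (ε-onto g Ig)) m)) (k.sym (proj₂ (ε-onto g Ig) m))
        }

      fromMinimalFreeResolution-minimal : Minimal fromMinimalFreeResolution
      fromMinimalFreeResolution-minimal i v r = ε-∑ (fin (β (suc i))) {λ j → v j *ᵖ d i r j} λ j →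
        k.trans (FreeModules.Augmentation.ε-* augmentation (v j) (d i r j)) (k.trans (k.*-congˡ (minimal i r j)) (k.zeroʳ _))

    -- The two hypotheses match generators, so the facet ideal and `⟨ D ∣ Cs ⟩` have the same
    -- members. The iterated cone and `M` thus are minimal resolutions of one ideal.
    betti-facetIdeal : ∀ D Cs → Separated D Cs →
      (∀ σ → Basis G σ → Generates D Cs (indicator σ)) →
      (∀ e → Generates D Cs e → ∃ λ σ → Basis G σ × indicator σ ≡ e) →
      (M : MinimalFreeResolution k (E G) (FacetIdeal k G)) →
      ∀ i → MinimalFreeResolution.β M i ≡ bettiPoly (map length Cs) i
    betti-facetIdeal D Cs sep basis⇒generates generates⇒basis M i =
      ≡.trans (Uniqueness.betti-unique polynomialRing k augmentation (λ {g} {h} → IsIdeal.resp facetIdeal-isIdeal {g} {h})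
                (fromMinimalFreeResolution facetIdeal-isIdeal M) F
                (fromMinimalFreeResolution-minimal facetIdeal-isIdeal M)
                (resolution-minimal augmentation constTerm-var D Cs sep) i)
              (betti-resolution D Cs sep i)
      where
      F : Resolution (FacetIdeal k G)
      F = transport
        (generates-⊆ facetIdeal-isIdeal D Cs λ e gen → facet (generates⇒basis e gen))
        (facetIdeal-⊆ (isIdeal D Cs) λ σ basis → generates-∋ D Cs _ (basis⇒generates σ basis))
        (resolution D Cs sep)
        where
        facet : ∀ {e} → (∃ λ σ → Basis G σ × indicator σ ≡ e) → FacetIdeal k G (X^ e)
        facet (σ , basis , ≡.refl) = basis∈facetIdeal σ basis

-- Unique factorisation of the Betti polynomial

module BettiPolynomials where

  open import Data.Nat as ℕ using (ℕ; zero; suc; _≤_; _<_; s≤s; _+_; _*_; _∸_)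
  import Data.Nat.Properties as ℕ
  open import Data.Integer as ℤ using (ℤ; +_)
  import Data.Integer.Properties as ℤ
  import Data.Integer.Tactic.RingSolver as ℤ-Ring
  import Data.Nat.Tactic.RingSolver as ℕ-Ring
  open import Data.List as List using (List; []; _∷_; length)
  open import Data.Nat.ListAction using (sum)
  open import Data.Nat.ListAction.Properties using (sum-↭)
  open import Data.List.Membership.Propositional using (_∈_)
  open import Data.List.Relation.Unary.Any using (here; there; _─_)
  open import Data.List.Relation.Unary.All as All using (All; []; _∷_)
  open import Data.List.Relation.Binary.Sublist.Propositional using (_⊆_; []; _∷_; _∷ʳ_)
  open import Data.List.Relation.Binary.Permutation.Propositional as Perm using (_↭_; ↭-refl; ↭-sym; ↭-trans; prep; swap)
  open import Data.List.Relation.Binary.Permutation.Propositional.Properties using (↭-length; All-resp-↭)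
  open import Data.Product using (∃; _×_; _,_)
  open import Data.Sum using (inj₂; [_,_]′)
  open import Function using (_∘_)
  open import Relation.Binary.PropositionalEquality as ≡ using (_≡_; _≢_; refl; cong; cong₂; sym; trans)
  open MonomialIdealResolutions using (bettiPoly; delayed)

  private
    swap-eq : ∀ a b a′ b′ x y z → a * (b * x + b′ * y) + a′ * (b * y + b′ * z) ≡ b * (a * x + a′ * y) + b′ * (a * y + a′ * z)
    swap-eq = ℕ-Ring.solve-∀

  bettiPoly-∷-cong : ∀ n L L′ → (∀ i → bettiPoly L i ≡ bettiPoly L′ i) → ∀ i → bettiPoly (n ∷ L) i ≡ bettiPoly (n ∷ L′) i
  bettiPoly-∷-cong n L L′ h zero    = cong (λ b → n * b + (n ∸ 1) * 0) (h zero)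
  bettiPoly-∷-cong n L L′ h (suc i) = cong₂ (λ b b′ → n * b + (n ∸ 1) * b′) (h (suc i)) (h i)

  bettiPoly-swap : ∀ m n L i → bettiPoly (m ∷ n ∷ L) i ≡ bettiPoly (n ∷ m ∷ L) i
  bettiPoly-swap m n L zero          = lemma m n (m ∸ 1) (n ∸ 1) (bettiPoly L 0)
    where
    lemma : ∀ a b a′ b′ x → a * (b * x + b′ * 0) + a′ * 0 ≡ b * (a * x + a′ * 0) + b′ * 0
    lemma = ℕ-Ring.solve-∀
  bettiPoly-swap m n L (suc zero)    = swap-eq m n (m ∸ 1) (n ∸ 1) (bettiPoly L 1) (bettiPoly L 0) 0
  bettiPoly-swap m n L (suc (suc i)) = swap-eq m n (m ∸ 1) (n ∸ 1) (bettiPoly L (2 + i)) (bettiPoly L (1 + i)) (bettiPoly L i)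

  bettiPoly-↭ : ∀ {L L′} → L ↭ L′ → ∀ i → bettiPoly L i ≡ bettiPoly L′ i
  bettiPoly-↭ Perm.refl               i = refl
  bettiPoly-↭ (prep {L} {L′} x p)     i = bettiPoly-∷-cong x L L′ (bettiPoly-↭ p) i
  bettiPoly-↭ (swap {L} {L′} x y p)   i = trans (bettiPoly-swap x y L i)
    (bettiPoly-∷-cong y (x ∷ L) (x ∷ L′) (bettiPoly-∷-cong x L L′ (bettiPoly-↭ p)) i)
  bettiPoly-↭ (Perm.trans p q)        i = trans (bettiPoly-↭ p i) (bettiPoly-↭ q i)

  -- The constant term `n` of the factor is nonzero, so coefficients can be compared in increasing
  -- degree.
  bettiPoly-cancel : ∀ n L L′ → 2 ≤ n → (∀ i → bettiPoly (n ∷ L) i ≡ bettiPoly (n ∷ L′) i) →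
                     ∀ i → bettiPoly L i ≡ bettiPoly L′ i
  bettiPoly-cancel n@(suc _) L L′ 2≤n h zero    = ℕ.*-cancelˡ-≡ _ _ n (ℕ.+-cancelʳ-≡ ((n ∸ 1) * 0) _ _ (h zero))
  bettiPoly-cancel n@(suc _) L L′ 2≤n h (suc i) = ℕ.*-cancelˡ-≡ _ _ n (ℕ.+-cancelʳ-≡ ((n ∸ 1) * bettiPoly L i) _ _
    (trans (h (suc i)) (cong (λ b → n * bettiPoly L′ (suc i) + (n ∸ 1) * b) (sym (bettiPoly-cancel n L L′ 2≤n h i)))))

  bettiPoly-degree : ∀ L i → length L < i → bettiPoly L i ≡ 0
  bettiPoly-degree []      (suc i) _       = refl
  bettiPoly-degree (n ∷ L) (suc i) (s≤s h)
    rewrite bettiPoly-degree L (suc i) (ℕ.m<n⇒m<1+n h) | bettiPoly-degree L i h = cong₂ _+_ (ℕ.*-zeroʳ n) (ℕ.*-zeroʳ (n ∸ 1))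

  -- The leading coefficient is the product of the numbers `n - 1`. Its being nonzero makes the
  -- degree equal to the number of factors.
  bettiPoly-leading : ∀ L → All (2 ≤_) L → bettiPoly L (length L) ≢ 0
  bettiPoly-leading []                  []                  ()
  bettiPoly-leading (suc (suc m) ∷ L) (s≤s (s≤s _) ∷ 2≤L) h with ℕ.m*n≡0⇒m≡0∨n≡0 (suc m) {bettiPoly L (length L)} (ℕ.m+n≡0⇒n≡0 (suc (suc m) * bettiPoly L (suc (length L))) h)
  ... | inj₂ h′ = bettiPoly-leading L 2≤L h′

  length-≤ : ∀ L L′ → All (2 ≤_) L → (∀ i → bettiPoly L i ≡ bettiPoly L′ i) → length L ≤ length L′
  length-≤ L L′ 2≤L h = ℕ.≮⇒≥ λ L′<L → bettiPoly-leading L 2≤L (trans (h _) (bettiPoly-degree L′ _ L′<L))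

  -- The homogenised polynomial ∑ f(i) tⁱ u^(N-i), by Horner's rule.
  evaluate : ℕ → (ℕ → ℕ) → ℤ → ℤ → ℤ
  evaluate zero    f u t = + f 0
  evaluate (suc N) f u t = + f 0 ℤ.* u ℤ.^ suc N ℤ.+ t ℤ.* evaluate N (f ∘ suc) u t

  evaluate-cong : ∀ N {f g} u t → (∀ i → f i ≡ g i) → evaluate N f u t ≡ evaluate N g u t
  evaluate-cong zero    u t h = cong +_ (h 0)
  evaluate-cong (suc N) u t h = cong₂ (λ a b → + a ℤ.* u ℤ.^ suc N ℤ.+ t ℤ.* b) (h 0) (evaluate-cong N u t (h ∘ suc))

  evaluate-linear : ∀ N a b f g u t → evaluate N (λ i → a * f i + b * g i) u t ≡ + a ℤ.* evaluate N f u t ℤ.+ + b ℤ.* evaluate N g u t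
  evaluate-linear zero a b f g u t = trans (ℤ.pos-+ (a * f 0) (b * g 0)) (cong₂ ℤ._+_ (ℤ.pos-* a (f 0)) (ℤ.pos-* b (g 0)))
  evaluate-linear (suc N) a b f g u t = trans
    (cong₂ (λ x y → x ℤ.* u ℤ.^ suc N ℤ.+ t ℤ.* y) (evaluate-linear 0 a b f g u t) (evaluate-linear N a b (f ∘ suc) (g ∘ suc) u t))
    (lemma (+ a) (+ b) (+ f 0) (+ g 0) (u ℤ.^ suc N) t (evaluate N (f ∘ suc) u t) (evaluate N (g ∘ suc) u t))
    where
    lemma : ∀ a b f g w t F G → (a ℤ.* f ℤ.+ b ℤ.* g) ℤ.* w ℤ.+ t ℤ.* (a ℤ.* F ℤ.+ b ℤ.* G) ≡
            a ℤ.* (f ℤ.* w ℤ.+ t ℤ.* F) ℤ.+ b ℤ.* (g ℤ.* w ℤ.+ t ℤ.* G)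
    lemma = ℤ-Ring.solve-∀

  evaluate-degree : ∀ N f u t → f (suc N) ≡ 0 → evaluate (suc N) f u t ≡ u ℤ.* evaluate N f u t
  evaluate-degree zero    f u t h = trans
    (cong (λ x → + f 0 ℤ.* (u ℤ.* + 1) ℤ.+ t ℤ.* + x) h) (lemma (+ f 0) u t)
    where
    lemma : ∀ f u t → f ℤ.* (u ℤ.* + 1) ℤ.+ t ℤ.* + 0 ≡ u ℤ.* f
    lemma = ℤ-Ring.solve-∀
  evaluate-degree (suc N) f u t h = trans
    (cong (λ x → + f 0 ℤ.* u ℤ.^ suc (suc N) ℤ.+ t ℤ.* x) (evaluate-degree N (f ∘ suc) u t h))
    (lemma (+ f 0) u t (u ℤ.^ suc N) (evaluate N (f ∘ suc) u t))
    where
    lemma : ∀ f u t w F → f ℤ.* (u ℤ.* w) ℤ.+ t ℤ.* (u ℤ.* F) ≡ u ℤ.* (f ℤ.* w ℤ.+ t ℤ.* F)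
    lemma = ℤ-Ring.solve-∀

  -- The polynomial of `L` has no term of degree `length L + 1`, so homogenising it one degree
  -- higher yields a factor `u`; the shifted copy yields `t`, and together they form the linear
  -- factor.
  evaluate-bettiPoly : ∀ n L u t → evaluate (suc (length L)) (bettiPoly (n ∷ L)) u t ≡
                       (+ n ℤ.* u ℤ.+ + (n ∸ 1) ℤ.* t) ℤ.* evaluate (length L) (bettiPoly L) u t
  evaluate-bettiPoly n L u t = trans (evaluate-linear (suc N) n (n ∸ 1) (bettiPoly L) (delayed (bettiPoly L)) u t)
    (trans (cong (λ e → + n ℤ.* e ℤ.+ + (n ∸ 1) ℤ.* evaluate (suc N) (delayed (bettiPoly L)) u t)
             (evaluate-degree N (bettiPoly L) u t (bettiPoly-degree L _ (ℕ.n<1+n _))))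
           (lemma (+ n) (+ (n ∸ 1)) u t (u ℤ.^ suc N) (evaluate N (bettiPoly L) u t)))
    where
    N : ℕ
    N = length L
    lemma : ∀ n m u t w F → n ℤ.* (u ℤ.* F) ℤ.+ m ℤ.* (+ 0 ℤ.* w ℤ.+ t ℤ.* F) ≡ (n ℤ.* u ℤ.+ m ℤ.* t) ℤ.* F
    lemma = ℤ-Ring.solve-∀

  -- At the root (u : t) = (m : -(m+1)) of the factor of m+1, the factor of n is (m+1) - n.
  root-factor : ∀ m n → 2 ≤ n → + n ℤ.* + m ℤ.+ + (n ∸ 1) ℤ.* ℤ.- + suc m ≡ + suc m ℤ.- + n
  root-factor m (suc n) _ = lemma (+ m) (+ n) (+ suc m) (+ suc n) refl refl
    where
    identity : ∀ m n → (+ 1 ℤ.+ n) ℤ.* m ℤ.+ n ℤ.* ℤ.- (+ 1 ℤ.+ m) ≡ (+ 1 ℤ.+ m) ℤ.+ ℤ.- (+ 1 ℤ.+ n)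
    identity = ℤ-Ring.solve-∀
    lemma : ∀ m n m′ n′ → m′ ≡ + 1 ℤ.+ m → n′ ≡ + 1 ℤ.+ n → n′ ℤ.* m ℤ.+ n ℤ.* ℤ.- m′ ≡ m′ ℤ.- n′
    lemma m n _ _ refl refl = identity m n

  module _ (c : ℕ) (u t : ℤ) (factor : ∀ n → 2 ≤ n → + n ℤ.* u ℤ.+ + (n ∸ 1) ℤ.* t ≡ + c ℤ.- + n) where

    -- The value is a product of the integers `c - n` over the list, and ℤ has no zero divisors.
    root⇒∈ : ∀ L → All (2 ≤_) L → evaluate (length L) (bettiPoly L) u t ≡ + 0 → c ∈ L
    root⇒∈ []      []          ()
    root⇒∈ (n ∷ L) (2≤n ∷ 2≤L) h = [ here ∘ equal , there ∘ root⇒∈ L 2≤L ]′ (ℤ.i*j≡0⇒i≡0∨j≡0 x zero-product)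
      where
      x : ℤ
      x = + n ℤ.* u ℤ.+ + (n ∸ 1) ℤ.* t
      zero-product : x ℤ.* evaluate (length L) (bettiPoly L) u t ≡ + 0
      zero-product = trans (sym (evaluate-bettiPoly n L u t)) h
      equal : x ≡ + 0 → c ≡ n
      equal x≡0 = ℤ.+-injective (ℤ.i-j≡0⇒i≡j (+ c) (+ n) (trans (sym (factor n 2≤n)) x≡0))

    common-factor : ∀ L L′ → 2 ≤ c → All (2 ≤_) L → All (2 ≤_) L′ →
                    (∀ i → bettiPoly (c ∷ L) i ≡ bettiPoly L′ i) → c ∈ L′
    common-factor L L′ 2≤c 2≤L 2≤L′ h = root⇒∈ L′ 2≤L′ (trans (cong (λ N → evaluate N (bettiPoly L′) u t) lengths)
        (trans (evaluate-cong (suc (length L)) u t (sym ∘ h)) root))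
      where
      -- Values depend on the degree of homogenisation, so they can be compared only once both lists
      -- are known to have the same length.
      lengths : length L′ ≡ suc (length L)
      lengths = ℕ.≤-antisym (length-≤ L′ (c ∷ L) 2≤L′ (sym ∘ h)) (length-≤ (c ∷ L) L′ (2≤c ∷ 2≤L) h)
      root : evaluate (suc (length L)) (bettiPoly (c ∷ L)) u t ≡ + 0
      root = trans (evaluate-bettiPoly c L u t)
        (cong (ℤ._* evaluate (length L) (bettiPoly L) u t) (trans (factor c 2≤c) (ℤ.+-inverseʳ (+ c))))

  ∈⇒↭ : ∀ {L : List ℕ} {x} (i : x ∈ L) → L ↭ x ∷ (L ─ i)
  ∈⇒↭ (here refl)         = ↭-refl
  ∈⇒↭ {L = y ∷ _} (there i) = ↭-trans (prep y (∈⇒↭ i)) (swap y _ ↭-refl)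

  bettiPoly-injective : ∀ L L′ → All (2 ≤_) L → All (2 ≤_) L′ → (∀ i → bettiPoly L i ≡ bettiPoly L′ i) → L ↭ L′
  bettiPoly-injective []      []      _ _ _ = ↭-refl
  bettiPoly-injective []      (n ∷ L′) _ 2≤L′ h with length-≤ (n ∷ L′) [] 2≤L′ (sym ∘ h)
  ... | ()
  bettiPoly-injective (zero ∷ L)  L′ (() ∷ _) _ h
  bettiPoly-injective (suc m ∷ L) L′ (2≤n ∷ 2≤L) 2≤L′ h =
    ↭-trans (prep (suc m) (bettiPoly-injective L (L′ ─ i) 2≤L 2≤L″ (bettiPoly-cancel (suc m) L (L′ ─ i) 2≤n λ j → trans (h j) (bettiPoly-↭ (∈⇒↭ i) j))))
            (↭-sym (∈⇒↭ i))
    where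
    i : suc m ∈ L′
    i = common-factor (suc m) (+ m) (ℤ.- + suc m) (root-factor m) L L′ 2≤n 2≤L 2≤L′ h
    2≤L″ : All (2 ≤_) (L′ ─ i)
    2≤L″ = All.tail (All-resp-↭ (∈⇒↭ i) 2≤L′)

  sublist-↭ : ∀ {L L′ s : List ℕ} → L ↭ L′ → s ⊆ L → ∃ λ s′ → s′ ⊆ L′ × s ↭ s′
  sublist-↭ Perm.refl s⊆L = _ , s⊆L , ↭-refl
  sublist-↭ (prep x p) (.x ∷ʳ s⊆L) with sublist-↭ p s⊆L
  ... | s′ , s′⊆L′ , q = s′ , x ∷ʳ s′⊆L′ , q
  sublist-↭ (prep x p) (refl ∷ s⊆L) with sublist-↭ p s⊆L
  ... | s′ , s′⊆L′ , q = x ∷ s′ , refl ∷ s′⊆L′ , prep x q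
  sublist-↭ (swap x y p) (.x ∷ʳ .y ∷ʳ s⊆L) with sublist-↭ p s⊆L
  ... | s′ , s′⊆L′ , q = s′ , y ∷ʳ x ∷ʳ s′⊆L′ , q
  sublist-↭ (swap x y p) (.x ∷ʳ refl ∷ s⊆L) with sublist-↭ p s⊆L
  ... | s′ , s′⊆L′ , q = y ∷ s′ , refl ∷ x ∷ʳ s′⊆L′ , prep y q
  sublist-↭ (swap x y p) (refl ∷ .y ∷ʳ s⊆L) with sublist-↭ p s⊆L
  ... | s′ , s′⊆L′ , q = x ∷ s′ , y ∷ʳ refl ∷ s′⊆L′ , prep x q
  sublist-↭ (swap x y p) (refl ∷ refl ∷ s⊆L) with sublist-↭ p s⊆L
  ... | s′ , s′⊆L′ , q = y ∷ x ∷ s′ , refl ∷ refl ∷ s′⊆L′ , swap x y q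
  sublist-↭ (Perm.trans p p′) s⊆L with sublist-↭ p s⊆L
  ... | s′ , s′⊆L′ , q with sublist-↭ p′ s′⊆L′
  ... | s″ , s″⊆L″ , q′ = s″ , s″⊆L″ , ↭-trans q q′

  -- Sublists count equal entries with multiplicity, as needed when several cycles have the same
  -- length.
  LeastSum : List ℕ → ℕ → ℕ → Set
  LeastSum L i d = (∃ λ s → s ⊆ L × length s ≡ i × sum s ≡ d) × (∀ s → s ⊆ L → length s ≡ i → d ≤ sum s)

  leastSum-↭ : ∀ {L L′ i d} → L ↭ L′ → LeastSum L i d → LeastSum L′ i d
  leastSum-↭ {i = i} {d} p ((s , s⊆L , length-s , sum-s) , least) = attained , least′
    where
    attained : ∃ λ s → s ⊆ _ × length s ≡ i × sum s ≡ d
    attained with sublist-↭ p s⊆L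
    ... | s′ , s′⊆L′ , q = s′ , s′⊆L′ , trans (sym (↭-length q)) length-s , trans (sym (sum-↭ q)) sum-s
    least′ : ∀ s → s ⊆ _ → length s ≡ i → d ≤ sum s
    least′ s s⊆L′ length-s with sublist-↭ (↭-sym p) s⊆L′
    ... | s′ , s′⊆L , q = ≡.subst (d ≤_) (sym (sum-↭ q)) (least s′ s′⊆L (trans (sym (↭-length q)) length-s))

-- Bases, rank and higher weights for pairwise disjoint circuits

module DisjointCircuitMatroids where

  open import Data.Bool using (true; if_then_else_)
  open import Data.Nat as ℕ using (ℕ; zero; suc; _≤_; z≤n; _+_; _*_; _∸_)
  import Data.Nat.Properties as ℕ
  open import Data.Nat.ListAction using (sum)
  open import Data.Fin as Fin using (Fin)
  import Data.Fin.Properties as Fin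
  open import Data.Fin.Subset using (Subset; _∈_; _∉_; _⊆_; ∣_∣; inside; outside)
  open import Data.Fin.Subset.Properties using (_∈?_)
  open import Data.Vec as Vec using (Vec; []; _∷_; lookup; tabulate)
  import Data.Vec.Properties as Vec
  open import Data.List as List using (List; []; _∷_; _++_; length; map; concat; allFin; filter)
  import Data.List.Properties as List
  open import Data.List.Membership.Propositional using (find) renaming (_∈_ to _∈ˡ_; _∉_ to _∉ˡ_)
  open import Data.List.Membership.Propositional.Properties
  open import Data.List.Relation.Unary.Any using (here; there; _─_)
  open import Data.List.Relation.Unary.All as All using (All; []; _∷_)
  import Data.List.Relation.Unary.All.Properties as All
  open import Data.List.Relation.Unary.AllPairs using (AllPairs; []; _∷_)
  open import Data.List.Relation.Unary.Unique.Propositional using (Unique)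
  import Data.List.Relation.Unary.Unique.Propositional.Properties as Unique
  open import Data.List.Relation.Binary.Disjoint.Propositional using (Disjoint)
  open import Data.List.Relation.Binary.Pointwise using (Pointwise; []; _∷_; Pointwise-length)
  open import Data.List.Relation.Binary.Sublist.Propositional using ([]; _∷_; _∷ʳ_) renaming (_⊆_ to _⊑_)
  import Data.List.Relation.Binary.Sublist.Propositional as Sublist
  import Data.List.Relation.Binary.Sublist.Propositional.Properties as Sublist
  open import Data.Product using (∃; _×_; _,_; proj₁; proj₂)
  open import Data.Sum using (_⊎_; inj₁; inj₂; [_,_]′)
  import Data.Unit as Unit
  open import Data.Empty using (⊥; ⊥-elim)
  open import Function using (_∘_)
  open import Relation.Nullary using (¬_; Dec; yes; no; does; ¬?)
  open import Relation.Unary using (Decidable)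
  open import Relation.Binary.PropositionalEquality as ≡ using (_≡_; _≢_; refl; sym; trans; cong; cong₂; subst)
  open import Algebra.Properties.CommutativeSemigroup ℕ.+-commutativeSemigroup using (interchange)
  open Polynomials
  open MonomialIdealResolutions
  open FacetIdealBetti using (indicator)
  open BettiPolynomials using (LeastSum)

  module _ {n : ℕ} where
    open import Data.List.Membership.DecPropositional (Fin._≟_ {n}) using () renaming (_∈?_ to _∈ˡ?_) public

  -- The Iverson bracket; it turns statements about sizes of sets into sums compared term by term.
  ⟪_⟫ : ∀ {a} {A : Set a} → Dec A → ℕ
  ⟪ d ⟫ = if does d then 1 else 0

  ⟪⟫-yes : ∀ {a} {A : Set a} (d : Dec A) → A → ⟪ d ⟫ ≡ 1
  ⟪⟫-yes (yes _) a = refl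
  ⟪⟫-yes (no ¬a) a = ⊥-elim (¬a a)

  ⟪⟫-no : ∀ {a} {A : Set a} (d : Dec A) → ¬ A → ⟪ d ⟫ ≡ 0
  ⟪⟫-no (yes a) ¬a = ⊥-elim (¬a a)
  ⟪⟫-no (no _)  ¬a = refl

  ⟪⟫≡1 : ∀ {a} {A : Set a} (d : Dec A) → ⟪ d ⟫ ≡ 1 → A
  ⟪⟫≡1 (yes a) _ = a

  ⟪⟫-⇔ : ∀ {a b} {A : Set a} {B : Set b} (d : Dec A) (d′ : Dec B) → (A → B) → (B → A) → ⟪ d ⟫ ≡ ⟪ d′ ⟫
  ⟪⟫-⇔ (yes a) d′ to from = sym (⟪⟫-yes d′ (to a))
  ⟪⟫-⇔ (no ¬a) d′ to from = sym (⟪⟫-no d′ (¬a ∘ from))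

  ⟪⟫-≤ : ∀ {a b} {A : Set a} {B : Set b} (d : Dec A) (d′ : Dec B) → (A → B) → ⟪ d ⟫ ≤ ⟪ d′ ⟫
  ⟪⟫-≤ (yes a) d′ to = ℕ.≤-reflexive (sym (⟪⟫-yes d′ (to a)))
  ⟪⟫-≤ (no ¬a) d′ to = z≤n

  sumFin-cong : ∀ {n} {f g : Fin n → ℕ} → (∀ i → f i ≡ g i) → sumFin f ≡ sumFin g
  sumFin-cong {zero}  h = refl
  sumFin-cong {suc n} h = cong₂ _+_ (h Fin.zero) (sumFin-cong (h ∘ Fin.suc))

  sumFin-mono : ∀ {n} {f g : Fin n → ℕ} → (∀ i → f i ≤ g i) → sumFin f ≤ sumFin g
  sumFin-mono {zero}  h = z≤n
  sumFin-mono {suc n} h = ℕ.+-mono-≤ (h Fin.zero) (sumFin-mono (h ∘ Fin.suc))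

  sumFin-0 : ∀ n → sumFin {n} (λ _ → 0) ≡ 0
  sumFin-0 zero    = refl
  sumFin-0 (suc n) = sumFin-0 n

  sumFin-+ : ∀ {n} (f g : Fin n → ℕ) → sumFin (λ i → f i + g i) ≡ sumFin f + sumFin g
  sumFin-+ {zero}  f g = refl
  sumFin-+ {suc n} f g = trans (cong (f Fin.zero + g Fin.zero +_) (sumFin-+ (f ∘ Fin.suc) (g ∘ Fin.suc)))
                               (interchange (f Fin.zero) (g Fin.zero) _ _)

  sumFin-* : ∀ {n} c (f : Fin n → ℕ) → sumFin (λ i → c * f i) ≡ c * sumFin f
  sumFin-* {zero}  c f = sym (ℕ.*-zeroʳ c)
  sumFin-* {suc n} c f = trans (cong (c * f Fin.zero +_) (sumFin-* c (f ∘ Fin.suc))) (sym (ℕ.*-distribˡ-+ c _ _))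

  sumFin-swap : ∀ {m n} (f : Fin m → Fin n → ℕ) → sumFin (λ i → sumFin (f i)) ≡ sumFin (λ j → sumFin (λ i → f i j))
  sumFin-swap {zero}  {n} f = sym (sumFin-0 n)
  sumFin-swap {suc m} f = trans (cong (sumFin (f Fin.zero) +_) (sumFin-swap (f ∘ Fin.suc)))
                                (sym (sumFin-+ (f Fin.zero) (λ j → sumFin (λ i → f (Fin.suc i) j))))

  sumFin-single : ∀ {n} (x : Fin n) (f : Fin n → ℕ) → sumFin (λ v → f v * ⟪ x Fin.≟ v ⟫) ≡ f x
  sumFin-single {suc n} Fin.zero f = trans (cong₂ _+_ (ℕ.*-identityʳ (f Fin.zero))
    (trans (sumFin-cong (λ v → ℕ.*-zeroʳ (f (Fin.suc v)))) (sumFin-0 n))) (ℕ.+-identityʳ _)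
  sumFin-single {suc n} (Fin.suc x) f = trans (cong (_+ sumFin (λ v → f (Fin.suc v) * ⟪ Fin.suc x Fin.≟ Fin.suc v ⟫)) (ℕ.*-zeroʳ (f Fin.zero)))
    (trans (sumFin-cong (λ v → cong (f (Fin.suc v) *_) (⟪⟫-⇔ (Fin.suc x Fin.≟ Fin.suc v) (x Fin.≟ v) Fin.suc-injective (cong Fin.suc))))
      (sumFin-single x (f ∘ Fin.suc)))

  sumFin-≤-equality : ∀ {n} {f g : Fin n → ℕ} → (∀ i → f i ≤ g i) → sumFin g ≤ sumFin f → ∀ i → f i ≡ g i
  sumFin-≤-equality {suc n} {f} {g} f≤g h Fin.zero = ℕ.≤-antisym (f≤g Fin.zero)
    (ℕ.+-cancelʳ-≤ _ _ _ (ℕ.≤-trans (ℕ.+-monoʳ-≤ (g Fin.zero) (sumFin-mono (f≤g ∘ Fin.suc))) h))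
  sumFin-≤-equality {suc n} {f} {g} f≤g h (Fin.suc i) = sumFin-≤-equality (f≤g ∘ Fin.suc)
    (ℕ.+-cancelˡ-≤ (f Fin.zero) _ _ (ℕ.≤-trans (ℕ.+-monoˡ-≤ _ (f≤g Fin.zero)) h)) i

  sumFin-term : ∀ {n} (f : Fin n → ℕ) i → f i ≤ sumFin f
  sumFin-term f Fin.zero    = ℕ.m≤m+n _ _
  sumFin-term f (Fin.suc i) = ℕ.≤-trans (sumFin-term (f ∘ Fin.suc) i) (ℕ.m≤n+m _ (f Fin.zero))

  χ : ∀ {n} → Subset n → Fin n → ℕ
  χ σ v = ⟪ v ∈? σ ⟫

  ∣∣≡sumFin : ∀ {n} (σ : Subset n) → ∣ σ ∣ ≡ sumFin (χ σ)
  ∣∣≡sumFin []            = refl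
  ∣∣≡sumFin (inside  ∷ σ) = cong suc (∣∣≡sumFin σ)
  ∣∣≡sumFin (outside ∷ σ) = ∣∣≡sumFin σ

  lookup-indicator : ∀ {n} (σ : Subset n) v → lookup (indicator σ) v ≡ χ σ v
  lookup-indicator (inside  ∷ σ) Fin.zero    = refl
  lookup-indicator (outside ∷ σ) Fin.zero    = refl
  lookup-indicator (s ∷ σ)       (Fin.suc v) = lookup-indicator σ v

  ⁅_⁆ : ∀ {n p} {P : Fin n → Set p} → (∀ v → Dec (P v)) → Subset n
  ⁅ P? ⁆ = tabulate (does ∘ P?)

  ∈-⁅⁆⁺ : ∀ {n p} {P : Fin n → Set p} (P? : ∀ v → Dec (P v)) {v} → P v → v ∈ ⁅ P? ⁆
  ∈-⁅⁆⁺ P? {v} Pv = Vec.lookup⇒[]= v _ (trans (Vec.lookup∘tabulate _ v) (does≡true (P? v)))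
    where
    does≡true : (d : Dec _) → does d ≡ true
    does≡true (yes _) = refl
    does≡true (no ¬p) = ⊥-elim (¬p Pv)

  ∈-⁅⁆⁻ : ∀ {n p} {P : Fin n → Set p} (P? : ∀ v → Dec (P v)) {v} → v ∈ ⁅ P? ⁆ → P v
  ∈-⁅⁆⁻ P? {v} h = does≡true (P? v) (trans (sym (Vec.lookup∘tabulate _ v)) (Vec.[]=⇒lookup h))
    where
    does≡true : (d : Dec _) → does d ≡ true → _
    does≡true (yes p) _ = p

  count : ∀ {n} → Fin n → List (Fin n) → ℕ
  count v []       = 0
  count v (x ∷ xs) = ⟪ x Fin.≟ v ⟫ + count v xs

  count-∉ : ∀ {n} {v : Fin n} xs → v ∉ˡ xs → count v xs ≡ 0
  count-∉ []       v∉ = refl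
  count-∉ (x ∷ xs) v∉ = cong₂ _+_ (⟪⟫-no (x Fin.≟ _) (λ x≡v → v∉ (here (sym x≡v)))) (count-∉ xs (v∉ ∘ there))

  count-∈ : ∀ {n} {v : Fin n} {xs} → Unique xs → v ∈ˡ xs → count v xs ≡ 1
  count-∈ {xs = x ∷ xs} (x∉ ∷ _) (here refl) = cong₂ _+_ (⟪⟫-yes (x Fin.≟ x) refl) (count-∉ xs (All.All¬⇒¬Any x∉))
  count-∈ {xs = x ∷ xs} (x∉ ∷ u) (there v∈) = cong₂ _+_ (⟪⟫-no (x Fin.≟ _) (All.lookup x∉ v∈)) (count-∈ u v∈)

  count-unique : ∀ {n} {xs : List (Fin n)} → Unique xs → ∀ v → count v xs ≡ ⟪ v ∈ˡ? xs ⟫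
  count-unique {xs = xs} u v with v ∈ˡ? xs
  ... | yes v∈ = count-∈ u v∈
  ... | no  v∉ = count-∉ xs v∉

  count-++ : ∀ {n} (v : Fin n) xs ys → count v (xs ++ ys) ≡ count v xs + count v ys
  count-++ v []       ys = refl
  count-++ v (x ∷ xs) ys = trans (cong (⟪ x Fin.≟ v ⟫ +_) (count-++ v xs ys)) (sym (ℕ.+-assoc ⟪ x Fin.≟ v ⟫ _ _))

  count-─ : ∀ {n} (v : Fin n) {c xs} (i : c ∈ˡ xs) → count v (xs ─ i) + ⟪ c Fin.≟ v ⟫ ≡ count v xs
  count-─ v {xs = x ∷ xs} (here refl) = ℕ.+-comm (count v xs) _
  count-─ v {xs = x ∷ xs} (there i)   = trans (ℕ.+-assoc ⟪ x Fin.≟ v ⟫ _ _) (cong (⟪ x Fin.≟ v ⟫ +_) (count-─ v i))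

  sumFin-count : ∀ {n} (xs : List (Fin n)) → sumFin (λ v → count v xs) ≡ length xs
  sumFin-count {n} []   = sumFin-0 n
  sumFin-count (x ∷ xs) = trans (sumFin-+ (λ v → ⟪ x Fin.≟ v ⟫) (λ v → count v xs))
    (cong₂ _+_ (trans (sumFin-cong (λ v → sym (ℕ.+-identityʳ ⟪ x Fin.≟ v ⟫))) (sumFin-single x (λ _ → 1))) (sumFin-count xs))

  length≡∣∣ : ∀ {n} {xs : List (Fin n)} {σ} → Unique xs → (∀ {v} → v ∈ˡ xs → v ∈ σ) → (∀ {v} → v ∈ σ → v ∈ˡ xs) → length xs ≡ ∣ σ ∣
  length≡∣∣ {xs = xs} {σ} u to from = trans (sym (sumFin-count xs))
    (trans (sumFin-cong (λ v → trans (count-unique u v) (⟪⟫-⇔ (v ∈ˡ? xs) (v ∈? σ) to from))) (sym (∣∣≡sumFin σ)))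

  lookup-raise : ∀ {n} (x : Fin n) e v → lookup (raise x e) v ≡ ⟪ x Fin.≟ v ⟫ + lookup e v
  lookup-raise x e v with x Fin.≟ v
  ... | yes refl = Vec.lookup∘updateAt x e
  ... | no x≢v   = Vec.lookup∘updateAt′ v x (x≢v ∘ sym) e

  lookup-exponent : ∀ {n} xs (v : Fin n) → lookup (exponent xs) v ≡ count v xs
  lookup-exponent []       v = Vec.lookup-replicate v 0
  lookup-exponent (x ∷ xs) v = trans (lookup-raise x (exponent xs) v) (cong (⟪ x Fin.≟ v ⟫ +_) (lookup-exponent xs v))

  lookup-ext : ∀ {n} {e f : Exponent n} → (∀ v → lookup e v ≡ lookup f v) → e ≡ f
  lookup-ext {e = e} {f} h = trans (sym (Vec.tabulate∘lookup e)) (trans (Vec.tabulate-cong h) (Vec.tabulate∘lookup f))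

  Transversal : ∀ {n} → List (Fin n) → List (List (Fin n)) → Set
  Transversal = Pointwise _∈ˡ_

  transversal : ∀ {n p} {P : Fin n → Set p} Cs → (∀ {C} → C ∈ˡ Cs → ∃ λ c → c ∈ˡ C × P c) →
                ∃ λ cs → Transversal cs Cs × All P cs
  transversal []       h = [] , [] , []
  transversal (C ∷ Cs) h with h (here refl) | transversal Cs (h ∘ there)
  ... | c , c∈C , Pc | cs , cs∈Cs , Pcs = c ∷ cs , c∈C ∷ cs∈Cs , Pc ∷ Pcs

  transversal-∈ : ∀ {n cs Cs} → Transversal {n} cs Cs → ∀ {C} → C ∈ˡ Cs → ∃ λ c → c ∈ˡ C × c ∈ˡ cs
  transversal-∈ (c∈C ∷ _)  (here refl) = _ , c∈C , here refl
  transversal-∈ (_ ∷ cs∈Cs) (there C∈) with transversal-∈ cs∈Cs C∈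
  ... | c , c∈C , c∈cs = c , c∈C , there c∈cs

  transversal-∋ : ∀ {n cs Cs} → Transversal {n} cs Cs → ∀ {c} → c ∈ˡ cs → ∃ λ C → C ∈ˡ Cs × c ∈ˡ C
  transversal-∋ (c∈C ∷ _)  (here refl) = _ , here refl , c∈C
  transversal-∋ (_ ∷ cs∈Cs) (there c∈) with transversal-∋ cs∈Cs c∈
  ... | C , C∈ , c∈C = C , there C∈ , c∈C

  transversal-unique : ∀ {n cs Cs} → AllPairs Disjoint Cs → Transversal {n} cs Cs → Unique cs
  transversal-unique []             []            = []
  transversal-unique (C#Cs ∷ disj) (c∈C ∷ cs∈Cs) = All.tabulate c≢ ∷ transversal-unique disj cs∈Cs
    where
    c≢ : ∀ {c′} → c′ ∈ˡ _ → _ ≢ c′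
    c≢ c′∈ refl with transversal-∋ cs∈Cs c′∈
    ... | C′ , C′∈ , c∈C′ = All.lookup C#Cs C′∈ (c∈C , c∈C′)

  disjoint-≡ : ∀ {n Cs} → AllPairs (Disjoint {A = Fin n}) Cs → ∀ {C C′ v} → C ∈ˡ Cs → C′ ∈ˡ Cs → v ∈ˡ C → v ∈ˡ C′ → C ≡ C′
  disjoint-≡ (_ ∷ _)       (here refl) (here refl) _ _ = refl
  disjoint-≡ (C#Cs ∷ _)    (here refl) (there C′∈) v∈C v∈C′ = ⊥-elim (All.lookup C#Cs C′∈ (v∈C , v∈C′))
  disjoint-≡ (C#Cs ∷ _)    (there C∈) (here refl) v∈C v∈C′ = ⊥-elim (All.lookup C#Cs C∈ (v∈C′ , v∈C))
  disjoint-≡ (_ ∷ disj)    (there C∈) (there C′∈) v∈C v∈C′ = disjoint-≡ disj C∈ C′∈ v∈C v∈C′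

  transversal-injective : ∀ {n cs Cs} → AllPairs Disjoint Cs → Transversal {n} cs Cs →
                          ∀ {x y C} → x ∈ˡ cs → y ∈ˡ cs → C ∈ˡ Cs → x ∈ˡ C → y ∈ˡ C → x ≡ y
  transversal-injective _ _ (here refl) (here refl) _ _ _ = refl
  transversal-injective disj@(C₀#Cs ∷ _) (x∈C₀ ∷ cs∈Cs) (here refl) (there y∈) C∈ x∈C y∈C
    with transversal-∋ cs∈Cs y∈ | disjoint-≡ disj C∈ (here refl) x∈C x∈C₀
  ... | C′ , C′∈ , y∈C′ | refl = ⊥-elim (All.lookup C₀#Cs C′∈ (y∈C , y∈C′))
  transversal-injective disj@(C₀#Cs ∷ _) (y∈C₀ ∷ cs∈Cs) (there x∈) (here refl) C∈ x∈C y∈C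
    with transversal-∋ cs∈Cs x∈ | disjoint-≡ disj C∈ (here refl) y∈C y∈C₀
  ... | C′ , C′∈ , x∈C′ | refl = ⊥-elim (All.lookup C₀#Cs C′∈ (x∈C , x∈C′))
  transversal-injective disj@(_ ∷ disj′) (_ ∷ cs∈Cs) (there x∈) (there y∈) C∈ x∈C y∈C
    with transversal-∋ cs∈Cs x∈
  ... | C′ , C′∈ , x∈C′ with disjoint-≡ disj C∈ (there C′∈) x∈C x∈C′
  ... | refl = transversal-injective disj′ cs∈Cs x∈ y∈ C′∈ x∈C y∈C

  module _ {n : ℕ} (D : List (Fin n)) where

    -- Says that `e` is what remains of `Cs` and `D` after removing `cs`. The additive form avoids
    -- truncated subtraction.
    Complementary : List (Fin n) → List (List (Fin n)) → Exponent n → Set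
    Complementary cs Cs e = ∀ v → lookup e v + count v cs ≡ count v (concat Cs) + count v D

    private
      adjoin : ∀ {C c cs Cs} (i : c ∈ˡ C) e → Complementary cs Cs e → Complementary (c ∷ cs) (C ∷ Cs) (exponent (C ─ i) ⊹ e)
      adjoin {C} {c} {cs} {Cs} i e h v = begin
          lookup (exponent (C ─ i) ⊹ e) v + (⟪ c Fin.≟ v ⟫ + count v cs)
            ≡⟨ cong (_+ (⟪ c Fin.≟ v ⟫ + count v cs)) (trans (Vec.lookup-zipWith _+_ v (exponent (C ─ i)) e) (cong (_+ lookup e v) (lookup-exponent (C ─ i) v))) ⟩
          (count v (C ─ i) + lookup e v) + (⟪ c Fin.≟ v ⟫ + count v cs)
            ≡⟨ interchange (count v (C ─ i)) _ _ _ ⟩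
          (count v (C ─ i) + ⟪ c Fin.≟ v ⟫) + (lookup e v + count v cs)
            ≡⟨ cong₂ _+_ (count-─ v i) (h v) ⟩
          count v C + (count v (concat Cs) + count v D)
            ≡⟨ sym (ℕ.+-assoc (count v C) _ _) ⟩
          count v C + count v (concat Cs) + count v D
            ≡⟨ cong (_+ count v D) (sym (count-++ v C (concat Cs))) ⟩
          count v (C ++ concat Cs) + count v D ∎
        where open ≡.≡-Reasoning

    generates⇒transversal : ∀ Cs e → Generates D Cs e → ∃ λ cs → Transversal cs Cs × Complementary cs Cs e
    generates⇒transversal []       e refl = [] , [] , λ v → trans (ℕ.+-identityʳ _) (lookup-exponent D v)
    generates⇒transversal (C ∷ Cs) e (c , i , e′ , gen , refl) with generates⇒transversal Cs e′ gen
    ... | cs , cs∈Cs , h = c ∷ cs , i ∷ cs∈Cs , adjoin {cs = cs} {Cs} i e′ h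

    transversal⇒generates : ∀ {cs Cs} → Transversal cs Cs → ∃ λ e → Generates D Cs e × Complementary cs Cs e
    transversal⇒generates [] = exponent D , refl , λ v → trans (ℕ.+-identityʳ _) (lookup-exponent D v)
    transversal⇒generates {c ∷ cs} {C ∷ Cs} (i ∷ cs∈Cs) with transversal⇒generates cs∈Cs
    ... | e , gen , h = exponent (C ─ i) ⊹ e , (c , i , e , gen , refl) , adjoin {cs = cs} {Cs} i e h

  -- The cycle matroid of G, when its circuits Cs are pairwise disjoint.
  module DisjointCircuits (G : Graph) (Cs : List (List (Fin (E G))))
    (nonempty : All (λ C → 1 ≤ length C) Cs) (unique : All Unique Cs) (disjoint : AllPairs Disjoint Cs)
    (independent⇒ : ∀ {I} → Independent G I → ∀ {C} → C ∈ˡ Cs → ∃ λ c → c ∈ˡ C × c ∉ I)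
    (⇒independent : ∀ {I} → (∀ {C} → C ∈ˡ Cs → ∃ λ c → c ∈ˡ C × c ∉ I) → Independent G I)
    where

    private
      n : ℕ
      n = E G

    bridges : List (Fin n)
    bridges = filter (λ v → ¬? (v ∈ˡ? concat Cs)) (allFin n)

    unique-concat : Unique (concat Cs)
    unique-concat = Unique.concat⁺ unique disjoint

    separated : Separated bridges Cs
    separated = nonempty , unique , (All.tabulate bridges#C ∷ disjoint)
      where
      bridges#C : ∀ {C} → C ∈ˡ Cs → Disjoint bridges C
      bridges#C C∈ (v∈bridges , v∈C) =
        proj₂ (∈-filter⁻ (λ v → ¬? (v ∈ˡ? concat Cs)) {xs = allFin n} v∈bridges) (∈-concat⁺′ v∈C C∈)

    complementary-count : ∀ v → count v (concat Cs) + count v bridges ≡ 1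
    complementary-count v with v ∈ˡ? concat Cs
    ... | yes v∈ = cong₂ _+_ (count-∈ unique-concat v∈)
                    (count-∉ bridges (λ v∈b → proj₂ (∈-filter⁻ (λ v → ¬? (v ∈ˡ? concat Cs)) {xs = allFin n} v∈b) v∈))
    ... | no v∉  = cong₂ _+_ (count-∉ (concat Cs) v∉)
                    (count-∈ (Unique.filter⁺ (λ v → ¬? (v ∈ˡ? concat Cs)) (Unique.allFin⁺ n))
                      (∈-filter⁺ (λ v → ¬? (v ∈ˡ? concat Cs)) (∈-allFin v) v∉))

    -- A basis misses some edge of each circuit. Adding an edge other than these chosen ones
    -- preserves independence, so by maximality nothing else is missing.
    basis⇒generates : ∀ σ → Basis G σ → Generates bridges Cs (indicator σ)
    basis⇒generates σ (indep , maximal) with transversal Cs (independent⇒ indep)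
    ... | cs , cs∈Cs , cs∉σ with transversal⇒generates bridges cs∈Cs
    ... | e , gen , comp = subst (Generates bridges Cs) (lookup-ext λ v →
        ℕ.+-cancelʳ-≡ (count v cs) _ _ (trans (trans (comp v) (complementary-count v)) (sym (complementary v)))) gen
      where
      outside⇒∈ : ∀ v → v ∉ σ → v ∈ˡ cs
      outside⇒∈ v v∉σ with v ∈ˡ? cs
      ... | yes v∈ = v∈
      ... | no v∉  = ⊥-elim (v∉σ (maximal _ (∈-⁅⁆⁺ τ? ∘ inj₁) τ-independent (∈-⁅⁆⁺ τ? (inj₂ refl))))
        where
        τ? : ∀ w → Dec (w ∈ σ ⊎ w ≡ v)
        τ? w with w ∈? σ | w Fin.≟ v
        ... | yes w∈ | _       = yes (inj₁ w∈)
        ... | no _   | yes w≡v = yes (inj₂ w≡v)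
        ... | no w∉  | no w≢v  = no [ w∉ , w≢v ]′
        τ-independent : Independent G ⁅ τ? ⁆
        τ-independent = ⇒independent λ C∈ → let c , c∈C , c∈cs = transversal-∈ cs∈Cs C∈ in
          c , c∈C , λ c∈τ → [ All.lookup cs∉σ c∈cs , (λ { refl → v∉ c∈cs }) ]′ (∈-⁅⁆⁻ τ? c∈τ)
      complementary : ∀ v → lookup (indicator σ) v + count v cs ≡ 1
      complementary v with v ∈? σ in eq
      ... | yes v∈ = cong₂ _+_ (trans (lookup-indicator σ v) (⟪⟫-yes (v ∈? σ) v∈))
                               (count-∉ cs (λ v∈cs → All.lookup cs∉σ v∈cs v∈))
      ... | no v∉  = cong₂ _+_ (trans (lookup-indicator σ v) (⟪⟫-no (v ∈? σ) v∉))
                               (count-∈ (transversal-unique disjoint cs∈Cs) (outside⇒∈ v v∉))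

    generates⇒basis : ∀ e → Generates bridges Cs e → ∃ λ σ → Basis G σ × indicator σ ≡ e
    generates⇒basis e gen with generates⇒transversal bridges Cs e gen
    ... | cs , cs∈Cs , comp = σ , (indep , maximal) , lookup-ext λ v →
        ℕ.+-cancelʳ-≡ (count v cs) _ _ (trans (complementary v) (sym (trans (comp v) (complementary-count v))))
      where
      σ? : ∀ v → Dec (v ∉ˡ cs)
      σ? v = ¬? (v ∈ˡ? cs)
      σ : Subset n
      σ = ⁅ σ? ⁆
      indep : Independent G σ
      indep = ⇒independent λ C∈ → let c , c∈C , c∈cs = transversal-∈ cs∈Cs C∈ in
        c , c∈C , λ c∈σ → ∈-⁅⁆⁻ σ? c∈σ c∈cs
      maximal : ∀ τ → σ ⊆ τ → Independent G τ → τ ⊆ σ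
      maximal τ σ⊆τ τ-indep {v} v∈τ = ∈-⁅⁆⁺ σ? λ v∈cs → contradiction v∈cs
        where
        -- The independent set `τ` misses an edge `c` of the circuit through `v`. If `c` is not in
        -- `cs` it belongs to `σ`, hence to `τ`; otherwise `c = v`, as `cs` meets the circuit once.
        contradiction : v ∈ˡ cs → ⊥
        contradiction v∈cs with transversal-∋ cs∈Cs v∈cs
        ... | C , C∈ , v∈C with independent⇒ τ-indep C∈
        ... | c , c∈C , c∉τ with c ∈ˡ? cs
        ... | no c∉cs  = c∉τ (σ⊆τ (∈-⁅⁆⁺ σ? c∉cs))
        ... | yes c∈cs = c∉τ (subst (_∈ τ) (transversal-injective disjoint cs∈Cs v∈cs c∈cs C∈ v∈C c∈C) v∈τ)
      complementary : ∀ v → lookup (indicator σ) v + count v cs ≡ 1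
      complementary v with v ∈ˡ? cs
      ... | yes v∈ = cong₂ _+_ (trans (lookup-indicator σ v) (⟪⟫-no (v ∈? σ) (λ v∈σ → ∈-⁅⁆⁻ σ? v∈σ v∈)))
                               (count-∈ (transversal-unique disjoint cs∈Cs) v∈)
      ... | no v∉  = cong₂ _+_ (trans (lookup-indicator σ v) (⟪⟫-yes (v ∈? σ) (∈-⁅⁆⁺ σ? v∉))) (count-∉ cs v∉)

    private
      ⊑-allPairs : ∀ {a r} {A : Set a} {R : A → A → Set r} {xs ys : List A} → xs ⊑ ys → AllPairs R ys → AllPairs R xs
      ⊑-allPairs []          []         = []
      ⊑-allPairs (y ∷ʳ p)    (_ ∷ rs)   = ⊑-allPairs p rs
      ⊑-allPairs (refl ∷ p)  (r ∷ rs)   = Sublist.All-resp-⊆ p r ∷ ⊑-allPairs p rs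

      ⊑-map⁻ : ∀ {a b} {A : Set a} {B : Set b} (f : A → B) {ys} xs → ys ⊑ map f xs → ∃ λ zs → zs ⊑ xs × map f zs ≡ ys
      ⊑-map⁻ f []       []         = [] , [] , refl
      ⊑-map⁻ f (x ∷ xs) (_ ∷ʳ p) with ⊑-map⁻ f xs p
      ... | zs , zs⊑xs , eq = zs , x ∷ʳ zs⊑xs , eq
      ⊑-map⁻ f (x ∷ xs) (refl ∷ p) with ⊑-map⁻ f xs p
      ... | zs , zs⊑xs , eq = x ∷ zs , refl ∷ zs⊑xs , cong (f x ∷_) eq

      length-concat : ∀ {a} {A : Set a} (xss : List (List A)) → length (concat xss) ≡ sum (map length xss)
      length-concat []         = refl
      length-concat (xs ∷ xss) = trans (List.length-++ xs) (cong (length xs +_) (length-concat xss))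

      rank-unique : ∀ {τ r r′} → IsRank G τ r → IsRank G τ r′ → r ≡ r′
      rank-unique ((I , I⊆τ , indep , refl) , max) ((I′ , I′⊆τ , indep′ , refl) , max′) =
        ℕ.≤-antisym (max′ I I⊆τ indep) (max I′ I′⊆τ indep′)

    -- Here `s` lists precisely the circuits inside `τ`. As a parameter it can be either a filtered
    -- list or a chosen list whose union is `τ`.
    module _ (τ : EdgeSet G) (s : List (List (Fin n))) (s⊑Cs : s ⊑ Cs)
             (s-inside : ∀ {C v} → C ∈ˡ s → v ∈ˡ C → v ∈ τ)
             (s-complete : ∀ {C} → C ∈ˡ Cs → All (_∈ τ) C → C ∈ˡ s) where

      private
        s-disjoint : AllPairs Disjoint s
        s-disjoint = ⊑-allPairs s⊑Cs disjoint

        transversal-size : ∀ {cs} → Transversal cs s → sumFin (λ v → count v cs) ≡ length s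
        transversal-size {cs} cs∈s = trans (sumFin-count cs) (Pointwise-length cs∈s)

        transversal-inside : ∀ {cs} → Transversal cs s → ∀ {v} → v ∈ˡ cs → v ∈ τ
        transversal-inside cs∈s v∈ with transversal-∋ cs∈s v∈
        ... | C , C∈ , v∈C = s-inside C∈ v∈C

      -- Removing a transversal of `s` from `τ` leaves an independent set. Conversely an independent
      -- subset of `τ` misses a transversal of `s`, that is `length s` distinct edges of `τ`.
      rank+length : ∃ λ r → IsRank G τ r × r + length s ≡ ∣ τ ∣
      rank+length with transversal s (λ C∈ → first (All.lookup nonempty (Sublist.lookup s⊑Cs C∈)))
        where
        first : ∀ {C : List (Fin n)} → 1 ≤ length C → ∃ λ c → c ∈ˡ C × Unit.⊤
        first {c ∷ C} _ = c , here refl , Unit.tt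
      ... | cs , cs∈s , _ = ∣ I ∣ , ((I , proj₁ ∘ ∈-⁅⁆⁻ I? , I-indep , refl) , maximal) , size-I
        where
        I? : ∀ v → Dec (v ∈ τ × v ∉ˡ cs)
        I? v with v ∈? τ | v ∈ˡ? cs
        ... | yes v∈ | no v∉cs  = yes (v∈ , v∉cs)
        ... | no v∉  | _        = no (v∉ ∘ proj₁)
        ... | yes _  | yes v∈cs = no (λ p → proj₂ p v∈cs)
        I : EdgeSet G
        I = ⁅ I? ⁆
        I-indep : Independent G I
        I-indep = ⇒independent missing
          where
          missing : ∀ {C} → C ∈ˡ Cs → ∃ λ c → c ∈ˡ C × c ∉ I
          missing {C} C∈ with All.all? (_∈? τ) C
          ... | yes C⊆τ = let c , c∈C , c∈cs = transversal-∈ cs∈s (s-complete C∈ C⊆τ) in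
                          c , c∈C , λ c∈I → proj₂ (∈-⁅⁆⁻ I? c∈I) c∈cs
          ... | no C⊈τ with find (All.¬All⇒Any¬ (_∈? τ) C C⊈τ)
          ... | c , c∈C , c∉τ = c , c∈C , λ c∈I → c∉τ (proj₁ (∈-⁅⁆⁻ I? c∈I))
        pointwise : ∀ v → χ I v + count v cs ≡ χ τ v
        pointwise v with v ∈ˡ? cs
        ... | yes v∈cs = trans (cong₂ _+_ (⟪⟫-no (v ∈? I) (λ v∈I → proj₂ (∈-⁅⁆⁻ I? v∈I) v∈cs))
                                          (count-∈ (transversal-unique s-disjoint cs∈s) v∈cs))
                               (sym (⟪⟫-yes (v ∈? τ) (transversal-inside cs∈s v∈cs)))
        ... | no v∉cs  = trans (cong₂ _+_ (⟪⟫-⇔ (v ∈? I) (v ∈? τ) (proj₁ ∘ ∈-⁅⁆⁻ I?) (λ v∈τ → ∈-⁅⁆⁺ I? (v∈τ , v∉cs)))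
                                          (count-∉ cs v∉cs)) (ℕ.+-identityʳ _)
        size-I : ∣ I ∣ + length s ≡ ∣ τ ∣
        size-I = trans (cong₂ _+_ (∣∣≡sumFin I) (sym (transversal-size cs∈s)))
          (trans (sym (sumFin-+ (χ I) (λ v → count v cs))) (trans (sumFin-cong pointwise) (sym (∣∣≡sumFin τ))))
        maximal : ∀ J → J ⊆ τ → Independent G J → ∣ J ∣ ≤ ∣ I ∣
        maximal J J⊆τ J-indep with transversal s (independent⇒ J-indep ∘ Sublist.lookup s⊑Cs)
        ... | cs′ , cs′∈s , cs′∉J = ℕ.+-cancelʳ-≤ (length s) _ _ (begin
            ∣ J ∣ + length s                                  ≡⟨ cong₂ _+_ (∣∣≡sumFin J) (sym (transversal-size cs′∈s)) ⟩
            sumFin (χ J) + sumFin (λ v → count v cs′)         ≡⟨ sym (sumFin-+ (χ J) (λ v → count v cs′)) ⟩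
            sumFin (λ v → χ J v + count v cs′)                ≤⟨ sumFin-mono bound ⟩
            sumFin (χ τ)                                      ≡⟨ sym (∣∣≡sumFin τ) ⟩
            ∣ τ ∣                                             ≡⟨ sym size-I ⟩
            ∣ I ∣ + length s                                  ∎)
          where
          open ℕ.≤-Reasoning
          bound : ∀ v → χ J v + count v cs′ ≤ χ τ v
          bound v with v ∈ˡ? cs′
          ... | yes v∈cs′ = ℕ.≤-reflexive (trans (cong₂ _+_ (⟪⟫-no (v ∈? J) (All.lookup cs′∉J v∈cs′))
                                                   (count-∈ (transversal-unique s-disjoint cs′∈s) v∈cs′))
                                             (sym (⟪⟫-yes (v ∈? τ) (transversal-inside cs′∈s v∈cs′))))
          ... | no v∉cs′  = ℕ.≤-trans (ℕ.≤-reflexive (trans (cong (χ J v +_) (count-∉ cs′ v∉cs′)) (ℕ.+-identityʳ _)))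
                                      (⟪⟫-≤ (v ∈? J) (v ∈? τ) J⊆τ)

      hasNullity : HasNullity G τ (length s)
      hasNullity = let r , isRank , eq = rank+length in
        r , isRank , trans (cong (_∸ r) (sym eq)) (ℕ.m+n∸m≡n r (length s))

      hasNullity-unique : ∀ {i} → HasNullity G τ i → length s ≡ i
      hasNullity-unique (r′ , isRank′ , eq′) = let r , isRank , eq = rank+length in
        trans (sym (ℕ.m+n∸m≡n r (length s))) (trans (cong₂ _∸_ eq (rank-unique isRank isRank′)) eq′)

    union : List (List (Fin n)) → EdgeSet G
    union s = ⁅ (λ v → v ∈ˡ? concat s) ⁆

    module _ {s : List (List (Fin n))} (s⊑Cs : s ⊑ Cs) where

      union-nullity : HasNullity G (union s) (length s)
      union-nullity = hasNullity (union s) s s⊑Cs (λ C∈ v∈C → ∈-⁅⁆⁺ (λ v → v ∈ˡ? concat s) (∈-concat⁺′ v∈C C∈)) complete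
        where
        -- The first edge of such a circuit lies on a member of `s`, and disjoint circuits that
        -- share an edge are equal.
        complete : ∀ {C} → C ∈ˡ Cs → All (_∈ union s) C → C ∈ˡ s
        complete {[]}    C∈ _ with All.lookup nonempty C∈
        ... | ()
        complete {c ∷ C} C∈ (c∈ ∷ _) with ∈-concat⁻′ s (∈-⁅⁆⁻ (λ v → v ∈ˡ? concat s) c∈)
        ... | C′ , c∈C′ , C′∈ = subst (_∈ˡ s) (disjoint-≡ disjoint (Sublist.lookup s⊑Cs C′∈) C∈ c∈C′ (here refl)) C′∈

      unique-concat-⊑ : Unique (concat s)
      unique-concat-⊑ = Unique.concat⁺ (Sublist.All-resp-⊆ s⊑Cs unique) (⊑-allPairs s⊑Cs disjoint)

      union-size : ∣ union s ∣ ≡ sum (map length s)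
      union-size = trans (sym (length≡∣∣ unique-concat-⊑ (∈-⁅⁆⁺ (λ v → v ∈ˡ? concat s)) (∈-⁅⁆⁻ (λ v → v ∈ˡ? concat s)))) (length-concat s)

    -- The circuits inside `τ` are disjoint, and their number is the nullity; `τ` is at least as
    -- large as their union, possibly larger through edges that complete no circuit.
    nullity⇒sublist : ∀ τ i → HasNullity G τ i → ∃ λ s → s ⊑ Cs × length s ≡ i × sum (map length s) ≤ ∣ τ ∣
    nullity⇒sublist τ i nullity = s , s⊑Cs , hasNullity-unique τ s s⊑Cs inside-τ complete nullity , (begin
        sum (map length s)                    ≡⟨ sym (length-concat s) ⟩
        length (concat s)                     ≡⟨ sym (sumFin-count (concat s)) ⟩
        sumFin (λ v → count v (concat s))     ≤⟨ sumFin-mono bound ⟩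
        sumFin (χ τ)                          ≡⟨ sym (∣∣≡sumFin τ) ⟩
        ∣ τ ∣                                 ∎)
      where
      open ℕ.≤-Reasoning
      inside? : Decidable (All (_∈ τ))
      inside? = All.all? (_∈? τ)
      s : List (List (Fin n))
      s = filter inside? Cs
      s⊑Cs : s ⊑ Cs
      s⊑Cs = Sublist.filter-⊆ inside? Cs
      inside-τ : ∀ {C v} → C ∈ˡ s → v ∈ˡ C → v ∈ τ
      inside-τ C∈ = All.lookup (proj₂ (∈-filter⁻ inside? {xs = Cs} C∈))
      complete : ∀ {C} → C ∈ˡ Cs → All (_∈ τ) C → C ∈ˡ s
      complete = ∈-filter⁺ inside?
      bound : ∀ v → count v (concat s) ≤ χ τ v
      bound v = ℕ.≤-trans (ℕ.≤-reflexive (count-unique (unique-concat-⊑ s⊑Cs) v))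
        (⟪⟫-≤ (v ∈ˡ? concat s) (v ∈? τ) λ v∈ → let C , v∈C , C∈ = ∈-concat⁻′ s v∈ in inside-τ C∈ v∈C)

    higherWeight⇒leastSum : ∀ i d → IsHigherWeight G i d → LeastSum (map length Cs) i d
    higherWeight⇒leastSum i d ((τ , nullity , refl) , least) = attained , lower-bound
      where
      lower-bound : ∀ t → t ⊑ map length Cs → length t ≡ i → ∣ τ ∣ ≤ sum t
      lower-bound t t⊑ refl with ⊑-map⁻ length Cs t⊑
      ... | s , s⊑Cs , refl = subst (∣ τ ∣ ≤_) (union-size s⊑Cs)
        (least (union s) (subst (HasNullity G (union s)) (sym (List.length-map length s)) (union-nullity s⊑Cs)))
      attained : ∃ λ t → t ⊑ map length Cs × length t ≡ i × sum t ≡ ∣ τ ∣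
      attained with nullity⇒sublist τ i nullity
      ... | s , s⊑Cs , length-s , sum≤ = map length s , Sublist.map⁺ length s⊑Cs , length-t ,
          -- The union of the circuits inside the optimal `τ` has the same nullity, so it competes
          -- with `τ` and cannot be smaller.
          ℕ.≤-antisym sum≤ (lower-bound _ (Sublist.map⁺ length s⊑Cs) length-t)
        where
        length-t : length (map length s) ≡ i
        length-t = trans (List.length-map length s) length-s

    leastSum⇒higherWeight : ∀ i d → LeastSum (map length Cs) i d → IsHigherWeight G i d
    leastSum⇒higherWeight i d ((t , t⊑ , refl , refl) , least) with ⊑-map⁻ length Cs t⊑
    ... | s , s⊑Cs , refl =
      (union s , subst (HasNullity G (union s)) (sym (List.length-map length s)) (union-nullity s⊑Cs) , union-size s⊑Cs) ,
      λ τ nullity → let s′ , s′⊑Cs , length-s′ , sum≤ = nullity⇒sublist τ _ nullity in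
        ℕ.≤-trans (least _ (Sublist.map⁺ length s′⊑Cs) (trans (List.length-map length s′) length-s′)) sum≤

-- The cycles of a cactus

module Cacti where

  open import Data.Bool using (Bool; true; false; if_then_else_; _∧_; not)
  import Data.Bool.Properties as Bool
  open import Data.Nat as ℕ using (ℕ; zero; suc; _≤_; s≤s; z≤n; _+_; _*_)
  import Data.Nat.Properties as ℕ
  import Data.Nat.Tactic.RingSolver as ℕ-Ring
  open import Data.Fin as Fin using (Fin)
  import Data.Fin.Properties as Fin
  open import Data.Fin.Subset using (Subset; _∈_; _∉_; _⊆_; _⊃_; ∣_∣; inside; outside; _∪_)
  open import Data.Fin.Subset.Properties using (_∈?_; p⊆q⇒∣p∣≤∣q∣; ⊆-antisym; x∈p∪q⁺; x∈p∪q⁻)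
  open import Data.Fin.Subset.Induction using (⊃-wellFounded)
  open import Induction.WellFounded using (Acc; acc)
  open import Data.Vec as Vec using (Vec; []; _∷_)
  import Data.Vec.Properties as Vec
  open import Data.List as List using (List; []; _∷_; _++_; length; map; allFin; filter)
  open import Data.List.Membership.Propositional using (find) renaming (_∈_ to _∈ˡ_)
  open import Data.List.Membership.Propositional.Properties
  open import Data.List.Relation.Unary.Any using (here; there)
  open import Data.List.Relation.Unary.All as All using (All; []; _∷_)
  import Data.List.Relation.Unary.All.Properties as All
  open import Data.List.Relation.Unary.AllPairs as AllPairs using (AllPairs; []; _∷_)
  import Data.List.Relation.Unary.AllPairs.Properties as AllPairs
  open import Data.List.Relation.Unary.Unique.Propositional using (Unique)
  import Data.List.Relation.Unary.Unique.Propositional.Properties as Unique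
  open import Data.List.Relation.Binary.Disjoint.Propositional using (Disjoint)
  open import Data.Product using (∃; _×_; _,_; proj₁; proj₂)
  open import Data.Sum as Sum using (_⊎_; inj₁; inj₂; [_,_]′)
  import Data.Unit as Unit
  open import Data.Empty using (⊥-elim)
  open import Function using (_∘_)
  open import Relation.Nullary using (¬_; Dec; yes; no; _×-dec_; _⊎-dec_; _→-dec_)
  open import Relation.Nullary.Decidable using (decidable-stable)
  open import Relation.Binary.PropositionalEquality as ≡ using (_≡_; _≢_; refl; sym; trans; cong; cong₂; subst)
  open DisjointCircuitMatroids

  -- Walks and the decidability of reachability

  module Paths (G : Graph) where

    src tgt : Fin (E G) → Fin (V G)
    src e = proj₁ (ends G e)
    tgt e = proj₂ (ends G e)

    Joins : Fin (E G) → Fin (V G) → Fin (V G) → Set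
    Joins e u w = (src e ≡ u × tgt e ≡ w) ⊎ (tgt e ≡ u × src e ≡ w)

    Path : EdgeSet G → (Fin (E G) → Set) → Fin (V G) → Fin (V G) → Set
    Path = Reach G

    incident-src : ∀ e → incident G e (src e) ≡ true
    incident-src e with src e Fin.≟ src e
    ... | yes _ = refl
    ... | no ≢  = ⊥-elim (≢ refl)

    incident-tgt : ∀ e → incident G e (tgt e) ≡ true
    incident-tgt e with src e Fin.≟ tgt e | tgt e Fin.≟ tgt e
    ... | yes _ | _     = refl
    ... | no _  | yes _ = refl
    ... | no _  | no ≢  = ⊥-elim (≢ refl)

    incident⁻ : ∀ e v → incident G e v ≡ true → src e ≡ v ⊎ tgt e ≡ v
    incident⁻ e v h with src e Fin.≟ v | tgt e Fin.≟ v
    ... | yes p | _     = inj₁ p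
    ... | no _  | yes p = inj₂ p

    joins-incidentˡ : ∀ {e u w} → Joins e u w → incident G e u ≡ true
    joins-incidentˡ {e} (inj₁ (refl , _)) = incident-src e
    joins-incidentˡ {e} (inj₂ (refl , _)) = incident-tgt e

    joins-sym : ∀ {e u w} → Joins e u w → Joins e w u
    joins-sym (inj₁ (p , q)) = inj₂ (q , p)
    joins-sym (inj₂ (p , q)) = inj₁ (q , p)

    joins-incidentʳ : ∀ {e u w} → Joins e u w → incident G e w ≡ true
    joins-incidentʳ {e} j = joins-incidentˡ {e} (joins-sym {e} j)

    joins-end : ∀ {e u w v} → Joins e u w → incident G e v ≡ true → u ≡ v ⊎ w ≡ v
    joins-end {e} {v = v} (inj₁ (refl , refl)) h = incident⁻ e v h
    joins-end {e} {v = v} (inj₂ (refl , refl)) h = Sum.swap (incident⁻ e v h)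

    path-trans : ∀ {B ok u v w} → Path B ok u v → Path B ok v w → Path B ok u w
    path-trans here              q = q
    path-trans (step e e∈ ok j p) q = step e e∈ ok j (path-trans p q)

    path-sym : ∀ {B ok u v} → Path B ok u v → Path B ok v u
    path-sym here               = here
    path-sym (step e e∈ ok j p) = path-trans (path-sym p) (step e e∈ ok (joins-sym {e} j) here)

    path-mono : ∀ {B B′ ok ok′ u v} → (∀ {e} → e ∈ B → e ∈ B′) → (∀ {e} → e ∈ B → ok e → ok′ e) → Path B ok u v → Path B′ ok′ u v
    path-mono B⊆B′ ok⊆ here               = here
    path-mono B⊆B′ ok⊆ (step e e∈ ok j p) = step e (B⊆B′ e∈) (ok⊆ e∈ ok) j (path-mono B⊆B′ ok⊆ p)

    vertexOf? : ∀ B v → Dec (VertexOf G B v)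
    vertexOf? B v = Fin.any? (λ e → (e ∈? B) ×-dec (incident G e v Bool.≟ true))

    path-vertex : ∀ {B ok u v} → VertexOf G B u → Path B ok u v → VertexOf G B v
    path-vertex u∈ here               = u∈
    path-vertex u∈ (step e e∈ ok j p) = path-vertex (e , e∈ , joins-incidentʳ {e} j) p

    avoid-end : ∀ {e x u w} → avoid G x e → Joins e u w → w ≢ x
    avoid-end {e} {x} ok j refl with trans (sym (joins-incidentʳ {e} j)) ok
    ... | ()

    path-avoid-≢ : ∀ {B x u v} → u ≢ x → Path B (avoid G x) u v → v ≢ x
    path-avoid-≢ u≢x here               = u≢x
    path-avoid-≢ u≢x (step e e∈ ok j p) = path-avoid-≢ (avoid-end {e} ok j) p

    -- A path need cross a given edge only once, so reachability can be decided edge by edge.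
    Linked : List (Fin (E G)) → Fin (V G) → Fin (V G) → Set
    Linked []       u v = u ≡ v
    Linked (e ∷ es) u v = Linked es u v ⊎ (Linked es u (src e) × Linked es (tgt e) v)
                                        ⊎ (Linked es u (tgt e) × Linked es (src e) v)

    linked? : ∀ es u v → Dec (Linked es u v)
    linked? []       u v = u Fin.≟ v
    linked? (e ∷ es) u v = linked? es u v ⊎-dec (linked? es u (src e) ×-dec linked? es (tgt e) v)
                                          ⊎-dec (linked? es u (tgt e) ×-dec linked? es (src e) v)

    linked-refl : ∀ es u → Linked es u u
    linked-refl []       u = refl
    linked-refl (e ∷ es) u = inj₁ (linked-refl es u)

    linked-trans : ∀ es {u v w} → Linked es u v → Linked es v w → Linked es u w
    linked-trans []       refl q = q
    linked-trans (e ∷ es) (inj₁ p) (inj₁ q) = inj₁ (linked-trans es p q)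
    linked-trans (e ∷ es) (inj₁ p) (inj₂ (inj₁ (q , r))) = inj₂ (inj₁ (linked-trans es p q , r))
    linked-trans (e ∷ es) (inj₁ p) (inj₂ (inj₂ (q , r))) = inj₂ (inj₂ (linked-trans es p q , r))
    linked-trans (e ∷ es) (inj₂ (inj₁ (p , q))) (inj₁ r) = inj₂ (inj₁ (p , linked-trans es q r))
    linked-trans (e ∷ es) (inj₂ (inj₂ (p , q))) (inj₁ r) = inj₂ (inj₂ (p , linked-trans es q r))
    -- From here on both parts cross `e`. In the same direction, the stretch between the crossings
    -- is dropped; in opposite directions, both crossings are dropped as well.
    linked-trans (e ∷ es) (inj₂ (inj₁ (p , _))) (inj₂ (inj₁ (_ , r))) = inj₂ (inj₁ (p , r))
    linked-trans (e ∷ es) (inj₂ (inj₁ (p , _))) (inj₂ (inj₂ (_ , r))) = inj₁ (linked-trans es p r)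
    linked-trans (e ∷ es) (inj₂ (inj₂ (p , _))) (inj₂ (inj₁ (_ , r))) = inj₁ (linked-trans es p r)
    linked-trans (e ∷ es) (inj₂ (inj₂ (p , _))) (inj₂ (inj₂ (_ , r))) = inj₂ (inj₂ (p , r))

    linked-edge : ∀ es {e u w} → e ∈ˡ es → Joins e u w → Linked es u w
    linked-edge (e ∷ es) (here refl) (inj₁ (refl , refl)) = inj₂ (inj₁ (linked-refl es _ , linked-refl es _))
    linked-edge (e ∷ es) (here refl) (inj₂ (refl , refl)) = inj₂ (inj₂ (linked-refl es _ , linked-refl es _))
    linked-edge (_ ∷ es) {e} (there e∈) j = inj₁ (linked-edge es {e} e∈ j)

    module _ (B : EdgeSet G) {ok : Fin (E G) → Set} (ok? : ∀ e → Dec (ok e)) where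

      private
        usable? : ∀ e → Dec (e ∈ B × ok e)
        usable? e = (e ∈? B) ×-dec ok? e

        edges : List (Fin (E G))
        edges = filter usable? (allFin (E G))

        linked⇒path : ∀ es → All (λ e → e ∈ B × ok e) es → ∀ {u v} → Linked es u v → Path B ok u v
        linked⇒path []       []                  refl = here
        linked⇒path (e ∷ es) (_ ∷ usable)         (inj₁ p) = linked⇒path es usable p
        linked⇒path (e ∷ es) ((e∈ , oke) ∷ usable) (inj₂ (inj₁ (p , q))) =
          path-trans (linked⇒path es usable p) (step e e∈ oke (inj₁ (refl , refl)) (linked⇒path es usable q))
        linked⇒path (e ∷ es) ((e∈ , oke) ∷ usable) (inj₂ (inj₂ (p , q))) =
          path-trans (linked⇒path es usable p) (step e e∈ oke (inj₂ (refl , refl)) (linked⇒path es usable q))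

        path⇒linked : ∀ {u v} → Path B ok u v → Linked edges u v
        path⇒linked here                = linked-refl edges _
        path⇒linked (step e e∈ oke j p) =
          linked-trans edges (linked-edge edges {e} (∈-filter⁺ usable? (∈-allFin e) (e∈ , oke)) j) (path⇒linked p)

      path? : ∀ u v → Dec (Path B ok u v)
      path? u v with linked? edges u v
      ... | yes p = yes (linked⇒path edges (All.tabulate (proj₂ ∘ ∈-filter⁻ usable? {xs = allFin (E G)})) p)
      ... | no ¬p = no (¬p ∘ path⇒linked)

    isCycle? : ∀ B → Dec (IsCycle G B)
    isCycle? B = Fin.any? (_∈? B)
      ×-dec Fin.all? (λ u → Fin.all? λ v → vertexOf? B u →-dec (vertexOf? B v →-dec path? B (λ _ → yes Unit.tt) u v))
      ×-dec Fin.all? (λ v → vertexOf? B v →-dec (degree G B v ℕ.≟ 2))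

  -- Degrees, cycles and blocks in a loop-free graph

  module LoopFreeGraph (G : Graph) (loopFree : LoopFree G) where
    open Paths G

    inc : EdgeSet G → Fin (E G) → Fin (V G) → ℕ
    inc C e v = if inB e C ∧ incident G e v then 1 else 0

    inc-yes : ∀ {C e v} → e ∈ C → incident G e v ≡ true → inc C e v ≡ 1
    inc-yes {C} {e} e∈ h rewrite h with e ∈? C
    ... | yes _ = refl
    ... | no e∉ = ⊥-elim (e∉ e∈)

    inc⁻ : ∀ C e v → inc C e v ≡ 1 → e ∈ C × incident G e v ≡ true
    inc⁻ C e v h with e ∈? C | incident G e v
    ... | yes e∈ | true = e∈ , refl

    inc≤χ : ∀ C e v → inc C e v ≤ χ C e
    inc≤χ C e v with e ∈? C | incident G e v
    ... | yes _ | true  = ℕ.≤-refl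
    ... | yes _ | false = z≤n
    ... | no _  | _     = z≤n

    inc-mono : ∀ {C B} → C ⊆ B → ∀ e v → inc C e v ≤ inc B e v
    inc-mono {C} {B} C⊆B e v with e ∈? C | e ∈? B | incident G e v
    ... | yes _  | yes _ | true  = ℕ.≤-refl
    ... | yes _  | yes _ | false = z≤n
    ... | yes e∈ | no e∉ | _     = ⊥-elim (e∉ (C⊆B e∈))
    ... | no _   | _     | _     = z≤n

    inc-ends : ∀ C e v → inc C e v ≡ χ C e * (⟪ src e Fin.≟ v ⟫ + ⟪ tgt e Fin.≟ v ⟫)
    inc-ends C e v with e ∈? C | src e Fin.≟ v | tgt e Fin.≟ v
    ... | no _  | _     | _     = refl
    ... | yes _ | yes p | yes q = ⊥-elim (loopFree e (trans p (sym q)))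
    ... | yes _ | yes _ | no _  = refl
    ... | yes _ | no _  | yes _ = refl
    ... | yes _ | no _  | no _  = refl

    -- Weighted double counting of incidences. With `κ` the indicator of a vertex set, it relates
    -- the total degree of the set to the edges inside it and those leaving it.
    handshake : ∀ C (κ : Fin (V G) → ℕ) →
                sumFin (λ v → κ v * degree G C v) ≡ sumFin (λ e → χ C e * (κ (src e) + κ (tgt e)))
    handshake C κ = begin
        sumFin (λ v → κ v * degree G C v)
          ≡⟨ sumFin-cong (λ v → sym (sumFin-* (κ v) (λ e → inc C e v))) ⟩
        sumFin (λ v → sumFin (λ e → κ v * inc C e v))
          ≡⟨ sumFin-swap (λ v e → κ v * inc C e v) ⟩
        sumFin (λ e → sumFin (λ v → κ v * inc C e v))
          ≡⟨ sumFin-cong edge ⟩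
        sumFin (λ e → χ C e * (κ (src e) + κ (tgt e))) ∎
      where
      open ≡.≡-Reasoning
      rearrange : ∀ a b c d → a * (b * (c + d)) ≡ b * (a * c + a * d)
      rearrange = ℕ-Ring.solve-∀
      edge : ∀ e → sumFin (λ v → κ v * inc C e v) ≡ χ C e * (κ (src e) + κ (tgt e))
      edge e = begin
          sumFin (λ v → κ v * inc C e v)
            ≡⟨ sumFin-cong (λ v → trans (cong (κ v *_) (inc-ends C e v)) (rearrange (κ v) (χ C e) _ _)) ⟩
          sumFin (λ v → χ C e * (atSrc v + atTgt v))
            ≡⟨ sumFin-* (χ C e) (λ v → atSrc v + atTgt v) ⟩
          χ C e * sumFin (λ v → atSrc v + atTgt v)
            ≡⟨ cong (χ C e *_) (sumFin-+ atSrc atTgt) ⟩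
          χ C e * (sumFin atSrc + sumFin atTgt)
            ≡⟨ cong (χ C e *_) (cong₂ _+_ (sumFin-single (src e) κ) (sumFin-single (tgt e) κ)) ⟩
          χ C e * (κ (src e) + κ (tgt e)) ∎
        where
        atSrc atTgt : Fin (V G) → ℕ
        atSrc v = κ v * ⟪ src e Fin.≟ v ⟫
        atTgt v = κ v * ⟪ tgt e Fin.≟ v ⟫

    joins-sum : ∀ {e u w} (κ : Fin (V G) → ℕ) → Joins e u w → κ (src e) + κ (tgt e) ≡ κ u + κ w
    joins-sum κ (inj₁ (refl , refl)) = refl
    joins-sum {e} κ (inj₂ (refl , refl)) = ℕ.+-comm (κ (src e)) _

    -- The vertices K reachable from u without passing x have total degree 2|K|, so an even number of
    -- edges joins K to x; as x has degree 2, all edges at x lead to K.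
    cycle-noCutVertex : ∀ C → IsCycle G C → NoCutVertex G C
    cycle-noCutVertex C (_ , connected , degree≡2) x x∈C u v u∈C v∈C u≢x v≢x = entry v≢x (connected v x v∈C x∈C)
      where
      K : Fin (V G) → Set
      K = Path C (avoid G x) u
      K? : ∀ w → Dec (K w)
      K? = path? C (λ e → incident G e x Bool.≟ false) u
      κ : Fin (V G) → ℕ
      κ w = ⟪ K? w ⟫
      κ-x : κ x ≡ 0
      κ-x = ⟪⟫-no (K? x) (λ Kx → path-avoid-≢ u≢x Kx refl)
      -- Among the edges of `C`, `f` marks those joining `x` to `K`, and `h` those within `K`: an
      -- edge that avoids `x` has either both ends in `K` or none.
      f h : Fin (E G) → ℕ
      f e = if inB e C ∧ incident G e x then κ (src e) + κ (tgt e) else 0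
      h e = if inB e C ∧ not (incident G e x) then κ (src e) else 0
      across : ∀ {e w w′} → e ∈ C → incident G e x ≡ false → Joins e w w′ → K w → K w′
      across {e} e∈ avoids j Kw = path-trans Kw (step e e∈ avoids j here)
      split : ∀ e → χ C e * (κ (src e) + κ (tgt e)) ≡ f e + 2 * h e
      split e with e ∈? C | incident G e x in eq
      ... | no _   | _     = refl
      ... | yes _  | true  = refl
      ... | yes e∈ | false = trans (ℕ.+-identityʳ _) (cong (κ (src e) +_) (trans
        (⟪⟫-⇔ (K? (tgt e)) (K? (src e)) (across {e} e∈ eq (inj₂ (refl , refl))) (across {e} e∈ eq (inj₁ (refl , refl))))
        (sym (ℕ.+-identityʳ _))))
      κ≤1 : ∀ w → κ w ≤ 1
      κ≤1 w with K? w
      ... | yes _ = ℕ.≤-refl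
      ... | no _  = z≤n
      f≤inc : ∀ e → f e ≤ inc C e x
      f≤inc e with e ∈? C | incident G e x in eq
      ... | no _  | _     = z≤n
      ... | yes _ | false = z≤n
      ... | yes _ | true with incident⁻ e x eq
      ... | inj₁ refl = subst (λ k → k + κ (tgt e) ≤ 1) (sym κ-x) (κ≤1 (tgt e))
      ... | inj₂ refl = subst (λ k → κ (src e) + k ≤ 1) (sym κ-x) (subst (_≤ 1) (sym (ℕ.+-identityʳ _)) (κ≤1 (src e)))
      parity : sumFin f + 2 * sumFin h ≡ 2 * sumFin κ
      parity = begin
          sumFin f + 2 * sumFin h                          ≡⟨ cong (sumFin f +_) (sym (sumFin-* 2 h)) ⟩
          sumFin f + sumFin (λ e → 2 * h e)                ≡⟨ sym (sumFin-+ f _) ⟩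
          sumFin (λ e → f e + 2 * h e)                     ≡⟨ sumFin-cong (sym ∘ split) ⟩
          sumFin (λ e → χ C e * (κ (src e) + κ (tgt e)))   ≡⟨ sym (handshake C κ) ⟩
          sumFin (λ w → κ w * degree G C w)                ≡⟨ sumFin-cong doubled ⟩
          sumFin (λ w → 2 * κ w)                           ≡⟨ sumFin-* 2 κ ⟩
          2 * sumFin κ                                     ∎
        where
        open ≡.≡-Reasoning
        doubled : ∀ w → κ w * degree G C w ≡ 2 * κ w
        doubled w with K? w
        ... | yes Kw = trans (ℕ.+-identityʳ _) (degree≡2 w (path-vertex u∈C Kw))
        ... | no _   = refl
      f-exit : ∀ e {w w′} → e ∈ C → incident G e x ≡ true → Joins e w w′ → f e ≡ κ w + κ w′
      f-exit e e∈ eq j rewrite eq with e ∈? C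
      ... | yes _ = joins-sum {e} κ j
      ... | no e∉ = ⊥-elim (e∉ e∈)
      exit : ∀ {w} → K w → Path C (anyEdge G) w x → ∃ λ e → 1 ≤ f e
      exit Kx here = ⊥-elim (path-avoid-≢ u≢x Kx refl)
      exit {w} Kw (step {w = w′} e e∈ _ j p) with incident G e x in eq
      ... | true  = e , subst (1 ≤_) (sym (f-exit e e∈ eq j)) (subst (λ k → 1 ≤ k + κ w′) (sym (⟪⟫-yes (K? w) Kw)) (s≤s z≤n))
      ... | false = exit (across {e} e∈ eq j Kw) p
      1≤∑f : 1 ≤ sumFin f
      1≤∑f with exit here (connected u x u∈C x∈C)
      ... | e , 1≤fe = ℕ.≤-trans 1≤fe (sumFin-term f e)
      ∑f≢1 : sumFin f ≢ 1
      ∑f≢1 eq = ℕ.even≢odd (sumFin κ) (sumFin h) (trans (sym parity) (cong (_+ 2 * sumFin h) eq))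
      -- The sum of `f` is positive by connectedness and not 1 by parity, hence at least 2, the
      -- degree of `x`. As `f` is bounded termwise by the incidence at `x`, the two agree.
      f≡inc : ∀ e → f e ≡ inc C e x
      f≡inc = sumFin-≤-equality f≤inc (subst (_≤ sumFin f) (sym (degree≡2 x x∈C)) (ℕ.≤∧≢⇒< 1≤∑f (∑f≢1 ∘ sym)))
      -- A walk from `w` first reaches `x` along an edge whose other end lies in `K`; membership in
      -- `K` then spreads back along the edges that avoid `x`.
      entry : ∀ {w} → w ≢ x → Path C (anyEdge G) w x → K w
      entry w≢x here = ⊥-elim (w≢x refl)
      entry {w} w≢x (step {w = w′} e e∈ _ j p) with incident G e x in eq
      ... | false = across {e} e∈ eq (joins-sym {e} j) (entry (avoid-end {e} eq j) p)
      ... | true with joins-end {e} j eq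
      ... | inj₁ w≡x  = ⊥-elim (w≢x w≡x)
      ... | inj₂ refl = ⟪⟫≡1 (K? w) (begin
          κ w          ≡⟨ sym (ℕ.+-identityʳ _) ⟩
          κ w + 0      ≡⟨ cong (κ w +_) (sym κ-x) ⟩
          κ w + κ x    ≡⟨ sym (f-exit e e∈ eq j) ⟩
          f e          ≡⟨ f≡inc e ⟩
          inc C e x    ≡⟨ inc-yes {C} {e} e∈ eq ⟩
          1            ∎)
        where open ≡.≡-Reasoning

    cycle-nonSeparable : ∀ {C} → IsCycle G C → NonSeparable G C
    cycle-nonSeparable {C} cycle@(nonempty , connected , _) = nonempty , connected , cycle-noCutVertex C cycle

    -- A degree counts each edge at most once, so degree 2 at a single vertex requires two edges.
    -- The bound keeps the leading coefficient of the Betti polynomial nonzero.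
    2≤∣cycle∣ : ∀ {C} → IsCycle G C → 2 ≤ ∣ C ∣
    2≤∣cycle∣ {C} ((e , e∈) , _ , degree≡2) = begin
      2                    ≡⟨ sym (degree≡2 (src e) (e , e∈ , incident-src e)) ⟩
      degree G C (src e)   ≤⟨ sumFin-mono (λ e′ → inc≤χ C e′ (src e)) ⟩
      sumFin (χ C)         ≡⟨ sym (∣∣≡sumFin C) ⟩
      ∣ C ∣                ∎
      where open ℕ.≤-Reasoning

    -- At a vertex of `C` both edge sets have degree 2, so `B` has no further edge there. Walks in
    -- `B` therefore never leave `C`, and `B` is connected.
    cycle-⊆⇒≡ : ∀ {C B} → IsCycle G C → IsCycle G B → C ⊆ B → C ≡ B
    cycle-⊆⇒≡ {C} {B} ((e₀ , e₀∈) , _ , degC) (_ , connB , degB) C⊆B = ⊆-antisym C⊆B B⊆C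
      where
      edge-at : ∀ {v} → VertexOf G C v → ∀ {e} → e ∈ B → incident G e v ≡ true → e ∈ C
      edge-at {v} v∈C@(e₁ , e₁∈ , h₁) {e} e∈ h = proj₁ (inc⁻ C e v (trans
        (sumFin-≤-equality (λ e → inc-mono C⊆B e v)
          (ℕ.≤-reflexive (trans (degB v (e₁ , C⊆B e₁∈ , h₁)) (sym (degC v v∈C)))) e)
        (inc-yes {B} {e} e∈ h)))
      spread : ∀ {u v} → VertexOf G C u → Path B (anyEdge G) u v → VertexOf G C v
      spread u∈ here              = u∈
      spread u∈ (step e e∈ _ j p) = spread (e , edge-at u∈ e∈ (joins-incidentˡ {e} j) , joins-incidentʳ {e} j) p
      B⊆C : B ⊆ C
      B⊆C {e} e∈ = edge-at (spread (e₀ , e₀∈ , incident-src e₀)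
        (connB (src e₀) (src e) (e₀ , C⊆B e₀∈ , incident-src e₀) (e , e∈ , incident-src e))) e∈ (incident-src e)

    -- A shared edge gives two shared vertices, so removing one vertex never disconnects the parts
    -- from each other; a single shared vertex would not suffice.
    ∪-nonSeparable : ∀ {A B e} → e ∈ A → e ∈ B → NonSeparable G A → NonSeparable G B → NonSeparable G (A ∪ B)
    ∪-nonSeparable {A} {B} {e} e∈A e∈B nsA nsB = (e , A⊆ e∈A) , connected , noCut
      where
      A⊆ : ∀ {e} → e ∈ A → e ∈ A ∪ B
      A⊆ e∈ = x∈p∪q⁺ (inj₁ e∈)
      B⊆ : ∀ {e} → e ∈ B → e ∈ A ∪ B
      B⊆ e∈ = x∈p∪q⁺ (inj₂ e∈)
      part : ∀ {v} → VertexOf G (A ∪ B) v → VertexOf G A v ⊎ VertexOf G B v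
      part (e , e∈ , h) = Sum.map (λ e∈A → e , e∈A , h) (λ e∈B → e , e∈B , h) (x∈p∪q⁻ A B e∈)
      connected : ConnectedSub G (A ∪ B)
      connected u v u∈ v∈ = path-trans (toward u∈) (path-sym (toward v∈))
        where
        toward : ∀ {w} → VertexOf G (A ∪ B) w → Path (A ∪ B) (anyEdge G) w (src e)
        toward w∈ with part w∈
        ... | inj₁ w∈A = path-mono A⊆ (λ _ ok → ok) (proj₁ (proj₂ nsA) _ _ w∈A (e , e∈A , incident-src e))
        ... | inj₂ w∈B = path-mono B⊆ (λ _ ok → ok) (proj₁ (proj₂ nsB) _ _ w∈B (e , e∈B , incident-src e))
      -- The vertex `x` may lie outside `Y`. Then no edge of `Y` meets it, and connectedness of `Y`
      -- is enough.
      avoiding : ∀ {Y} → NonSeparable G Y → ∀ x {u v} → VertexOf G Y u → VertexOf G Y v → u ≢ x → v ≢ x → Path Y (avoid G x) u v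
      avoiding {Y} (_ , conn , noCut) x {u} {v} u∈ v∈ u≢x v≢x with vertexOf? Y x
      ... | yes x∈ = noCut x x∈ u v u∈ v∈ u≢x v≢x
      ... | no x∉  = path-mono (λ e∈ → e∈) avoids (conn u v u∈ v∈)
        where
        avoids : ∀ {e} → e ∈ Y → anyEdge G e → avoid G x e
        avoids {e} e∈ _ = Bool.¬-not (λ h → x∉ (e , e∈ , h))
      noCut : NoCutVertex G (A ∪ B)
      -- One end of the common edge e differs from x.
      noCut x _ u v u∈ v∈ u≢x v≢x with src e Fin.≟ x
      ... | no a≢x = path-trans (toward u∈ u≢x) (path-sym (toward v∈ v≢x))
        where
        toward : ∀ {w} → VertexOf G (A ∪ B) w → w ≢ x → Path (A ∪ B) (avoid G x) w (src e)
        toward w∈ w≢x with part w∈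
        ... | inj₁ w∈A = path-mono A⊆ (λ _ ok → ok) (avoiding nsA x w∈A (e , e∈A , incident-src e) w≢x a≢x)
        ... | inj₂ w∈B = path-mono B⊆ (λ _ ok → ok) (avoiding nsB x w∈B (e , e∈B , incident-src e) w≢x a≢x)
      ... | yes refl = path-trans (toward u∈ u≢x) (path-sym (toward v∈ v≢x))
        where
        b≢x : tgt e ≢ src e
        b≢x = loopFree e ∘ sym
        toward : ∀ {w} → VertexOf G (A ∪ B) w → w ≢ x → Path (A ∪ B) (avoid G x) w (tgt e)
        toward w∈ w≢x with part w∈
        ... | inj₁ w∈A = path-mono A⊆ (λ _ ok → ok) (avoiding nsA x w∈A (e , e∈A , incident-tgt e) w≢x b≢x)
        ... | inj₂ w∈B = path-mono B⊆ (λ _ ok → ok) (avoiding nsB x w∈B (e , e∈B , incident-tgt e) w≢x b≢x)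

    -- Assuming there is no block above `A`, induction on larger edge sets refutes every proper
    -- non-separable extension, and so `A` itself is a block. The argument decides nothing about
    -- non-separability.
    ¬¬-block : ∀ {A} → NonSeparable G A → ¬ ¬ (∃ λ B → A ⊆ B × Block G B)
    ¬¬-block {A} = go A (⊃-wellFounded A)
      where
      go : ∀ A → Acc _⊃_ A → NonSeparable G A → ¬ ¬ (∃ λ B → A ⊆ B × Block G B)
      go A (acc rec) nsA none = none (A , (λ e∈ → e∈) , nsA , maximal)
        where
        maximal : ∀ B → A ⊆ B → NonSeparable G B → B ⊆ A
        maximal B A⊆B nsB {e} e∈B with e ∈? A
        ... | yes e∈A = e∈A
        ... | no e∉A  = ⊥-elim (go B (rec (A⊆B , e , e∈B , e∉A)) nsB
                          λ { (B′ , B⊆B′ , block) → none (B′ , (λ e∈ → B⊆B′ (A⊆B e∈)) , block) })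

    cactus-cycles-disjoint : Cactus G → ∀ {C C′ e} → IsCycle G C → IsCycle G C′ → e ∈ C → e ∈ C′ → C ≡ C′
    cactus-cycles-disjoint (_ , blocks) {C} {C′} cycle cycle′ e∈C e∈C′ =
      -- Equality of edge sets is decidable, so the block may be used although it exists only under
      -- a double negation.
      decidable-stable (Vec.≡-dec Bool._≟_ C C′) λ C≢C′ →
        ¬¬-block (∪-nonSeparable e∈C e∈C′ (cycle-nonSeparable cycle) (cycle-nonSeparable cycle′))
          λ { (B , ∪⊆B , block) → [ (λ cycleB → C≢C′ (trans (cycle-⊆⇒≡ cycle cycleB (λ e∈ → ∪⊆B (x∈p∪q⁺ (inj₁ e∈))))
                                                (sym (cycle-⊆⇒≡ cycle′ cycleB (λ e∈ → ∪⊆B (x∈p∪q⁺ (inj₂ e∈)))))))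
                                  , (λ ∣B∣≡1 → ℕ.<⇒≢ (ℕ.≤-trans (2≤∣cycle∣ cycle) (p⊆q⇒∣p∣≤∣q∣ (λ e∈ → ∪⊆B (x∈p∪q⁺ (inj₁ e∈))))) (sym ∣B∣≡1))
                                  ]′ (blocks B block) }

  subsets : ∀ n → List (Subset n)
  subsets zero    = [] ∷ []
  subsets (suc n) = map (inside ∷_) (subsets n) ++ map (outside ∷_) (subsets n)

  ∈-subsets : ∀ {n} (σ : Subset n) → σ ∈ˡ subsets n
  ∈-subsets []            = here refl
  ∈-subsets (inside  ∷ σ) = ∈-++⁺ˡ (∈-map⁺ (inside ∷_) (∈-subsets σ))
  ∈-subsets (outside ∷ σ) = ∈-++⁺ʳ (map (inside ∷_) (subsets _)) (∈-map⁺ (outside ∷_) (∈-subsets σ))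

  subsets-unique : ∀ n → Unique (subsets n)
  subsets-unique zero    = [] ∷ []
  subsets-unique (suc n) = Unique.++⁺ (Unique.map⁺ Vec.∷-injectiveʳ (subsets-unique n))
    (Unique.map⁺ Vec.∷-injectiveʳ (subsets-unique n)) heads-differ
    where
    heads-differ : Disjoint (map (inside ∷_) (subsets n)) (map (outside ∷_) (subsets n))
    heads-differ (p , q) with ∈-map⁻ (inside ∷_) p | ∈-map⁻ (outside ∷_) q
    ... | _ , _ , refl | _ , _ , ()

  elements : ∀ {n} → Subset n → List (Fin n)
  elements {n} σ = filter (_∈? σ) (allFin n)

  ∈-elements⁺ : ∀ {n v} {σ : Subset n} → v ∈ σ → v ∈ˡ elements σ
  ∈-elements⁺ {σ = σ} = ∈-filter⁺ (_∈? σ) (∈-allFin _)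

  ∈-elements⁻ : ∀ {n v} {σ : Subset n} → v ∈ˡ elements σ → v ∈ σ
  ∈-elements⁻ {n} {σ = σ} v∈ = proj₂ (∈-filter⁻ (_∈? σ) {xs = allFin n} v∈)

  elements-unique : ∀ {n} (σ : Subset n) → Unique (elements σ)
  elements-unique {n} σ = Unique.filter⁺ (_∈? σ) (Unique.allFin⁺ n)

  length-elements : ∀ {n} (σ : Subset n) → length (elements σ) ≡ ∣ σ ∣
  length-elements σ = length≡∣∣ (elements-unique σ) ∈-elements⁻ ∈-elements⁺

  module CactusCircuits (G : Graph) (loopFree : LoopFree G) (cactus : Cactus G) where
    open Paths G
    open LoopFreeGraph G loopFree

    cycles : List (EdgeSet G)
    cycles = filter isCycle? (subsets (E G))

    circuits : List (List (Fin (E G)))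
    circuits = map elements cycles

    isCycle-∈ : ∀ {C} → C ∈ˡ cycles → IsCycle G C
    isCycle-∈ C∈ = proj₂ (∈-filter⁻ isCycle? {xs = subsets (E G)} C∈)

    2≤length : All (λ C → 2 ≤ length C) circuits
    2≤length = All.map⁺ (All.tabulate λ {C} C∈ → subst (2 ≤_) (sym (length-elements C)) (2≤∣cycle∣ (isCycle-∈ C∈)))

    circuits-unique : All Unique circuits
    circuits-unique = All.map⁺ (All.tabulate λ {C} _ → elements-unique C)

    circuits-disjoint : AllPairs Disjoint circuits
    circuits-disjoint = AllPairs.map⁺ (disjoint (All.tabulate isCycle-∈) (Unique.filter⁺ isCycle? (subsets-unique (E G))))
      where
      disjoint : ∀ {Cs} → All (IsCycle G) Cs → Unique Cs → AllPairs (λ C C′ → Disjoint (elements C) (elements C′)) Cs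
      disjoint []               []            = []
      disjoint (cycle ∷ cycles) (C≢ ∷ unique) = All.zipWith (λ { (cycle′ , C≢C′) (v∈ , v∈′) →
        C≢C′ (cactus-cycles-disjoint cactus cycle cycle′ (∈-elements⁻ v∈) (∈-elements⁻ v∈′)) }) (cycles , C≢) ∷ disjoint cycles unique

    independent⇒missing : ∀ {I} → Independent G I → ∀ {C} → C ∈ˡ circuits → ∃ λ c → c ∈ˡ C × c ∉ I
    independent⇒missing {I} indep C∈ with ∈-map⁻ elements C∈
    ... | S , S∈ , refl = find (All.¬All⇒Any¬ (_∈? I) (elements S)
          (λ all∈ → indep S (λ v∈ → All.lookup all∈ (∈-elements⁺ v∈)) (isCycle-∈ S∈)))

    missing⇒independent : ∀ {I} → (∀ {C} → C ∈ˡ circuits → ∃ λ c → c ∈ˡ C × c ∉ I) → Independent G I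
    missing⇒independent missing C C⊆I cycle with missing (∈-map⁺ elements (∈-filter⁺ isCycle? (∈-subsets C) cycle))
    ... | c , c∈ , c∉I = c∉I (C⊆I (∈-elements⁻ c∈))

    open DisjointCircuits G circuits (All.map (ℕ.≤-trans (s≤s z≤n)) 2≤length) circuits-unique circuits-disjoint
      independent⇒missing missing⇒independent public

-- Equal Betti numbers give equal cycle lengths

open import Data.List using (map; length)
import Data.List.Relation.Unary.All.Properties as All
open import Data.List.Relation.Binary.Permutation.Propositional using (_↭_; ↭-sym)
open import Data.Product using (_,_)
open import Relation.Binary.PropositionalEquality using (sym; trans)

theorem3 : ∀ {c ℓ} (k : Field c ℓ) (G H : Graph) →
    LoopFree G → Cactus G → LoopFree H → Cactus H →
    Σ (MinimalFreeResolution k (E G) (FacetIdeal k G)) (λ RG →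
    Σ (MinimalFreeResolution k (E H) (FacetIdeal k H)) (λ RH →
    ∀ i → MinimalFreeResolution.β RG i ≡ MinimalFreeResolution.β RH i)) →
    ∀ i d → (IsHigherWeight G i d → IsHigherWeight H i d)
    × (IsHigherWeight H i d → IsHigherWeight G i d)
theorem3 k G H loopFreeG cactusG loopFreeH cactusH (RG , RH , same-β) i d =
    (λ weight → H.leastSum⇒higherWeight i d (leastSum-↭ same-sizes (G.higherWeight⇒leastSum i d weight)))
  , (λ weight → G.leastSum⇒higherWeight i d (leastSum-↭ (↭-sym same-sizes) (H.higherWeight⇒leastSum i d weight)))
  where
  open BettiPolynomials using (bettiPoly-injective; leastSum-↭)
  open FacetIdealBetti.FacetResolution using (betti-facetIdeal)
  module G = Cacti.CactusCircuits G loopFreeG cactusG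
  module H = Cacti.CactusCircuits H loopFreeH cactusH
  same-sizes : map length G.circuits ↭ map length H.circuits
  same-sizes = bettiPoly-injective _ _ (All.map⁺ G.2≤length) (All.map⁺ H.2≤length) λ j →
    trans (sym (betti-facetIdeal k G G.bridges G.circuits G.separated G.basis⇒generates G.generates⇒basis RG j))
      (trans (same-β j) (betti-facetIdeal k H H.bridges H.circuits H.separated H.basis⇒generates H.generates⇒basis RH j))
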